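{- Let $G$ be a $3$-connected cubic graph. Then (i) $\lambda(G)=n(G)$ if and only if $(G,V(G))\in\mathcal{N}$; and (ii) $\lambda(G)=n(G)-1$ if and only if $(G,\{u\})\in\mathcal{N}$, where $u$ is the unique vertex of $G$ that is not $\lambda$-matchable.
   Context: Graphs are loopless but may have parallel edges. For a vertex $v$ of a $2$-connected cubic graph $G$, a $v$-matching is a spanning subgraph in which $v$ has degree $3$ and every other vertex degree $1$; $v$ is $\lambda$-matchable if one exists; $\lambda(G)$ counts them. For a connected bipartite cubic graph $H[A,B]$, $a\in A$, $b\in B$, the pair $(a,b)$ is $\lambda$-matchable if $H$ has a spanning subgraph in which $a,b$ have degree $3$ and all other vertices degree $1$. A brick is a nonbipartite matching covered graph with no nontrivial tight cut (a cut $C$ is tight if $|C\cap M|=1$ for every perfect matching $M$; trivial if a shore has at most one vertex). Splicing $G_1$ at $u$ with $G_2$ at $v$: from $(G_1-u)\cup(G_2-v)$, via a bijection $\pi:\partial(u)\to\partial(v)$, join the end of each $e\in\partial(u)$ other than $u$ to the end of $\pi(e)$ other than $v$. The family $\mathcal{N}$ of pairs $(G,X)$ with $X\subseteq V(G)$ is defined recursively: $(G,V(G))\in\mathcal{N}$ for every cubic brick $G$; and if $H[A,B]$ is a $3$-connected bipartite cubic graph distinct from $\Theta$ (two vertices, three parallel edges) with $A=\{a_1,\dots,a_{|B|}\}$, $A_0\subseteq A$ is such that for each $b\in B$ some $a\in A_0$ makes $(a,b)$ $\lambda$-matchable in $H$, and $A_1\subseteq A-A_0$ with $|A_1|\le 1$,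 then $(G,X)\in\mathcal{N}$, where $G$ is obtained from $H$ by splicing at each $a_i\in A_0$ with some graph $G_i$ (at any vertex) such that $(G_i,V(G_i))\in\mathcal{N}$, and at each $a_i\in A-A_0-A_1$ with some graph $G_i$ at a vertex $v_i$ such that $(G_i,\{v_i\})\in\mathcal{N}$ (vertices of $A_1$ are left unspliced); and $X=V(G)$ if $A_1=\emptyset$, $X=A_1$ otherwise. -}

module Defs where

open import Data.Bool using (_xor_)
import Data.Empty as Empty
open import Data.Fin using (Fin; zero; suc)
open import Data.Fin.Properties using (_≟_; all?)
open import Data.Fin.Subset using (Subset; _∈_; _∉_; _⊆_; _∩_; _─_; ∁; ∣_∣; ⁅_⁆; ⊥; ⊤; Nonempty)
open import Data.Fin.Subset.Properties using (_∈?_; anySubset?)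
open import Data.List using (length; filter; allFin)
open import Data.Nat using (ℕ; _≤_; _<_)
import Data.Nat.Properties as ℕ
open import Data.Product using (Σ; ∃; _×_; _,_; proj₁; proj₂; swap) renaming (map to map×)
open import Data.Sum using (_⊎_; inj₁; inj₂)
open import Data.Vec using (lookup; tabulate)
open import Function using (_∘_)
open import Function.Bundles using (_↔_; _⇔_; Inverse)
open import Relation.Binary.Construct.Closure.ReflexiveTransitive using (Star)
open import Relation.Binary.PropositionalEquality using (_≡_; _≢_; refl; sym; trans)
open import Relation.Nullary using (¬_; Dec; yes; no)
open import Relation.Nullary.Decidable using (¬?; _×-dec_; _→-dec_)

-- Finite loopless graphs, parallel edges allowed.  The order in which `ends`
-- lists the two ends of an edge carries no meaning.
record Graph : Set where
  field
    n m      : ℕ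
    ends     : Fin m → Fin n × Fin n
    loopless : ∀ e → proj₁ (ends e) ≢ proj₂ (ends e)

  V E : Set
  V = Fin n
  E = Fin m

  Incident : E → V → Set
  Incident e v = proj₁ (ends e) ≡ v ⊎ proj₂ (ends e) ≡ v

  -- E[∂ v] is ∂(v) as a type; Incident is a proposition because G is loopless.
  E[∂_] : V → Set
  E[∂ v ] = Σ E λ e → Incident e v

  otherEnd : ∀ {v} → E[∂ v ] → V
  otherEnd (e , inj₁ _) = proj₂ (ends e)
  otherEnd (e , inj₂ _) = proj₁ (ends e)

  otherEnd≢ : ∀ {v} (e : E[∂ v ]) → otherEnd e ≢ v
  otherEnd≢ (e , inj₁ p) q = loopless e (trans p (sym q))
  otherEnd≢ (e , inj₂ p) q = loopless e (trans q (sym p))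

  -- The cut ∂(X): edges with exactly one end in X.  As G is loopless,
  -- ∂ ⁅ v ⁆ consists of the edges incident with v.
  ∂ : Subset n → Subset m
  ∂ X = tabulate λ e → lookup X (proj₁ (ends e)) xor lookup X (proj₂ (ends e))

  -- Degree of v in the spanning subgraph with edge set F.
  deg : Subset m → V → ℕ
  deg F v = ∣ F ∩ ∂ ⁅ v ⁆ ∣

open Graph using (V; E; E[∂_]; Incident)

-- Isomorphism is needed also for the graphs produced by splicing, whose vertex
-- and edge types are not literally of the form Fin k.
record Multigraph : Set₁ where
  field
    Vertex Edge : Set
    ends        : Edge → Vertex × Vertex

⟦_⟧ : Graph → Multigraph
⟦ G ⟧ = record { Vertex = V G ; Edge = E G ; ends = Graph.ends G }

record _≅_ (G H : Multigraph) : Set where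
  private
    module G = Multigraph G
    module H = Multigraph H
  field
    onV : G.Vertex ↔ H.Vertex
    onE : G.Edge ↔ H.Edge

  toV : G.Vertex → H.Vertex
  toV = Inverse.to onV

  field
    preserves : ∀ e → let p = H.ends (Inverse.to onE e) ; q = map× toV toV (G.ends e)
                      in p ≡ q ⊎ p ≡ swap q

Θ : Graph
Θ = record { n = 2 ; m = 3 ; ends = λ _ → zero , suc zero ; loopless = λ _ () }

module _ (G : Graph) where
  open Graph G hiding (V; E; E[∂_]; Incident)

  IsCubic : Set
  IsCubic = ∀ v → deg ⊤ v ≡ 3

  -- Adjacency in G − S.
  AdjacentOff : Subset n → V G → V G → Set
  AdjacentOff S x y = x ∉ S × y ∉ S × ∃ λ e → ends e ≡ (x , y) ⊎ ends e ≡ (y , x)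

  -- No bound n > k is imposed, so that Θ counts as 3-connected.  On cubic
  -- graphs with more than two vertices this is the usual notion.
  IsConnected[_] : ℕ → Set
  IsConnected[ k ] = 1 ≤ n × (∀ S → ∣ S ∣ < k → ∀ x y → x ∉ S → y ∉ S → Star (AdjacentOff S) x y)

  -- A is one colour class of a bipartition, the other being ∁ A.
  IsBipartition : Subset n → Set
  IsBipartition A = ∀ e → e ∈ ∂ A

  IsBipartite : Set
  IsBipartite = ∃ IsBipartition

  IsPerfectMatching : Subset m → Set
  IsPerfectMatching M = ∀ v → deg M v ≡ 1

  IsMatchingCovered : Set
  IsMatchingCovered = 2 ≤ n × IsConnected[ 1 ] × (∀ e → ∃ λ M → IsPerfectMatching M × e ∈ M)

  -- Properties of the cut ∂ X, stated for its shore X.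
  IsTight : Subset n → Set
  IsTight X = ∀ M → IsPerfectMatching M → ∣ ∂ X ∩ M ∣ ≡ 1

  IsTrivial : Subset n → Set
  IsTrivial X = ∣ X ∣ ≤ 1 ⊎ ∣ ∁ X ∣ ≤ 1

  IsBrick : Set
  IsBrick = ¬ IsBipartite × IsMatchingCovered × (∀ X → IsTight X → IsTrivial X)

  Is[_]-Matching : V G → Subset m → Set
  Is[ v ]-Matching F = deg F v ≡ 3 × (∀ w → w ≢ v → deg F w ≡ 1)

  λ-Matchable : V G → Set
  λ-Matchable v = ∃ Is[ v ]-Matching

  λ-matchable? : ∀ v → Dec (λ-Matchable v)
  λ-matchable? v = anySubset? λ F →
    (deg F v ℕ.≟ 3) ×-dec all? λ w → ¬? (w ≟ v) →-dec (deg F w ℕ.≟ 1)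

  -- λ(G), the number of λ-matchable vertices.
  λ-number : ℕ
  λ-number = length (filter λ-matchable? (allFin n))

  IsUniqueUnmatchable : V G → Set
  IsUniqueUnmatchable u = ¬ λ-Matchable u × (∀ w → ¬ λ-Matchable w → w ≡ u)

  λ-MatchablePair : V G → V G → Set
  λ-MatchablePair a b = ∃ λ F →
    deg F a ≡ 3 × deg F b ≡ 3 × (∀ w → w ≢ a → w ≢ b → deg F w ≡ 1)

-- What is needed to splice H at a: a graph, one of its vertices, and π.
record Plug (H : Graph) (a : V H) : Set where
  field
    graph : Graph
    at    : V graph
    π     : E[∂_] H a ↔ E[∂_] graph at

open Plug

-- Splicing H at every vertex a ∈ S with the graph given by plug a.  The case
-- S = ⁅ u ⁆ is the splicing of two graphs; the general case is the result of
-- carrying out these splicings one after another, in any order.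
module _ (H : Graph) (S : Subset (Graph.n H)) (plug : ∀ a → a ∈ S → Plug H a) where

  data SpliceV : Set where
    host  : (w : V H) → .(w ∉ S) → SpliceV
    guest : (a : V H) (s : a ∈ S) (x : V (graph (plug a s))) → .(x ≢ at (plug a s)) → SpliceV

  -- An edge e of ∂(a), a ∈ S, survives as the edge joining the other end of e
  -- to the other end of π e; the edges of ∂(at (plug a)) are thereby used up.
  data SpliceE : Set where
    host  : E H → SpliceE
    guest : (a : V H) (s : a ∈ S) (f : E (graph (plug a s))) →
            .(¬ Incident (graph (plug a s)) f (at (plug a s))) → SpliceE

  hostEnd : (w : V H) → E[∂_] H w → SpliceV
  hostEnd w e with w ∈? S
  ... | no  w∉S = host w w∉S
  ... | yes s   = guest w s (otherEnd (Inverse.to (π (plug w s)) e)) (otherEnd≢ (Inverse.to (π (plug w s)) e))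
    where open Graph (graph (plug w s))

  spliceEnds : SpliceE → SpliceV × SpliceV
  spliceEnds (host e) = hostEnd (proj₁ (Graph.ends H e)) (e , inj₁ refl) ,
                        hostEnd (proj₂ (Graph.ends H e)) (e , inj₂ refl)
  spliceEnds (guest a s f f∉∂) =
    guest a s (proj₁ (ends f)) (f∉∂ ∘ inj₁) , guest a s (proj₂ (ends f)) (f∉∂ ∘ inj₂)
    where open Graph (graph (plug a s))

  splice : Multigraph
  splice = record { Vertex = SpliceV ; Edge = SpliceE ; ends = spliceEnds }

  -- The vertex is an unspliced vertex of H lying in T.
  _∈Host_ : SpliceV → Subset (Graph.n H) → Set
  host w _      ∈Host T = w ∈ T
  guest _ _ _ _ ∈Host T = Empty.⊥

-- 𝒩 G X is (G , X) ∈ 𝒩, with G taken up to isomorphism.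
data 𝒩 (G : Graph) (X : Subset (Graph.n G)) : Set where

  brick : IsCubic G → IsBrick G → X ≡ ⊤ → 𝒩 G X

  spliced :
    (H : Graph) (A A₀ A₁ : Subset (Graph.n H)) →
    IsConnected[_] H 3 → IsBipartition H A → IsCubic H → ¬ (⟦ H ⟧ ≅ ⟦ Θ ⟧) →
    A₀ ⊆ A → (∀ b → b ∉ A → ∃ λ a → a ∈ A₀ × λ-MatchablePair H a b) →
    A₁ ⊆ A ─ A₀ → ∣ A₁ ∣ ≤ 1 →
    (plug : ∀ a → a ∈ A ─ A₁ → Plug H a) →
    (∀ a s → a ∈ A₀ → 𝒩 (graph (plug a s)) ⊤) →
    (∀ a s → a ∉ A₀ → 𝒩 (graph (plug a s)) ⁅ at (plug a s) ⁆) →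
    (φ : ⟦ G ⟧ ≅ splice H (A ─ A₁) plug) →
    (A₁ ≡ ⊥ → X ≡ ⊤) →
    (Nonempty A₁ → ∀ x → x ∈ X ⇔ (_∈Host_ H (A ─ A₁) plug (_≅_.toV φ x) A₁)) →
    𝒩 G X

{-# OPTIONS --safe #-}
-- The engine is the Cunningham–Marsh duality theorem for weighted matchings.  In
-- a 3-edge-connected cubic graph the vector 1/3 is a fractional perfect matching,
-- which has two consequences.  First, every edge set C has a perfect matching M
-- with 3 |M ∩ C| ≥ |C|, so tight cuts have three edges.  Second, when a set of
-- vertices cannot be matched as required, the optimal dual solution satisfies
-- every inequality with equality, and hence is a barrier: a stable set B such that
-- each component of G − B sends exactly three edges to B.  Applied to the closed
-- neighbourhood of an unmatchable vertex u this yields a barrier with {u} as a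
-- component; applied to a pair of vertices it shows that a graph without
-- nontrivial barriers is a brick.
--
-- Contracting the components of G − B gives the bipartite graph H, and contracting
-- everything else gives the guests.  Counting degrees in H, where the two colour
-- classes have the same size and components are odd, shows that a λ-matching of G
-- centred in a component meets each component cut once, and one centred in B meets
-- one component cut three times and the others once.  This transports
-- λ-matchings between G, H and the guests in both directions.
module Submission where

open import Defs
open import Data.Bool using (Bool; true; false; not; _∧_; _∨_; _xor_)
import Data.Bool.Properties as Bool
open import Data.Empty using (⊥-elim; ⊥-elim-irr) renaming (⊥ to ∅)
open import Data.Fin using (Fin; zero; suc)
import Data.Fin.Properties as Fin
open import Data.Fin.Properties using (_≟_; any?; all?)
open import Data.Fin.Subset using (Subset; ∣_∣; _∈_; _∉_; _∩_; _─_; ∁; ⁅_⁆; ⊥; ⊤; Nonempty)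
open import Data.Fin.Subset.Properties using (anySubset?; _∈?_; ∈⊤; ∉⊥; nonempty?; Empty-unique; ∣⊥∣≡0; ∣⁅x⁆∣≡1; ⊆-antisym; x∈⁅x⁆; x∈⁅y⁆⇒x≡y; p─q⊆p; x∈p∧x∉q⇒x∈p─q)
open import Data.List using (length; filter; allFin)
import Data.List as List
open import Data.Nat using (ℕ; zero; suc; _+_; _*_; _∸_; _≤_; _<_; z≤n; s≤s)
import Data.Nat.Properties as ℕ
open import Data.Nat.Tactic.RingSolver using (solve-∀)
open import Data.Product using (Σ; ∃; ∃₂; _×_; _,_; proj₁; proj₂) renaming (map to map×)
open import Data.Product.Properties using (≡-dec)
open import Data.Sum using (_⊎_; inj₁; inj₂; [_,_]′)
open import Data.Vec using (lookup; tabulate; []; _∷_; here; there)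
import Data.Vec.Functional as Vector
open import Data.Vec.Properties using (lookup∘tabulate; lookup-zipWith; lookup-map; lookup-replicate; lookup⇒[]=; []=⇒lookup)
open import Function using (_∘_; id; case_of_)
open import Function.Bundles using (_⇔_; mk⇔; mk↔ₛ′; Equivalence; Inverse)
open import Relation.Binary.Construct.Closure.ReflexiveTransitive using (Star; ε; _◅_; _◅◅_; reverse)
open import Relation.Binary.PropositionalEquality hiding ([_])
open import Relation.Nullary using (¬_; Dec; yes; no; does)
open import Relation.Nullary.Decidable using (¬?; _×-dec_; _→-dec_; _⊎-dec_; dec-true; dec-false; decidable-stable) renaming (map′ to mapDec)
import Algebra.Properties.Semiring.Sum ℕ.+-*-semiring as Sum

-- A barrier comes out of a shortfall of one unit. In a 3-edge-connected cubic graph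
-- `m / 3 = n / 2`, so no dual solution for unit weights has value below `n / 2`. A matching that
-- fails its target leaves, as `n` is even, at least two vertices too many uncovered. This frees one
-- unit of dual value, and both sets `T` used below cost exactly one unit more than `|S| / 2`. The
-- induction towards `𝒩` descends to contractions of `G`. Every cut of a contraction is a cut of
-- `G`, so 3-edge-connectivity is inherited at once; hence the proof runs on edge cuts and
-- translates to vertex connectivity only at its boundary. Both claims share one induction because
-- guests of both kinds can occur in either. In the converse, the definition of a brick grants only
-- ordinary connectedness, so cuts with one or two edges have to be excluded before the duality
-- applies. The converse also carries along that every edge lies in a perfect matching: a matching
-- of the host can be continued into a guest only from the edge that it prescribes there.

private variable
  k l : ℕ

-- Finite sums

-- Opaque, so that unification never looks inside a sum.
opaque

  ∑ : (Fin k → ℕ) → ℕ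
  ∑ = Sum.sum

  ∑-cong : {f g : Fin k → ℕ} → (∀ i → f i ≡ g i) → ∑ f ≡ ∑ g
  ∑-cong = Sum.sum-cong-≗

  ∑-+ : (f g : Fin k → ℕ) → ∑ (λ i → f i + g i) ≡ ∑ f + ∑ g
  ∑-+ = Sum.∑-distrib-+

  ∑-swap : (f : Fin k → Fin l → ℕ) → ∑ (λ i → ∑ (f i)) ≡ ∑ (λ j → ∑ λ i → f i j)
  ∑-swap = Sum.∑-comm

  ∑-*ˡ : ∀ c (f : Fin k → ℕ) → ∑ (λ i → c * f i) ≡ c * ∑ f
  ∑-*ˡ c f = sym (Sum.*-distribˡ-sum c f)

  ∑-[] : (f : Fin 0 → ℕ) → ∑ f ≡ 0
  ∑-[] f = refl

  ∑-∷ : (f : Fin (suc k) → ℕ) → ∑ f ≡ f zero + ∑ (f ∘ suc)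
  ∑-∷ f = refl

  ∑-mono : {f g : Fin k → ℕ} → (∀ i → f i ≤ g i) → ∑ f ≤ ∑ g
  ∑-mono {zero}  p = z≤n
  ∑-mono {suc k} p = ℕ.+-mono-≤ (p zero) (∑-mono (p ∘ suc))

  term≤∑ : (f : Fin k → ℕ) → ∀ i → f i ≤ ∑ f
  term≤∑ f zero    = ℕ.m≤m+n _ _
  term≤∑ f (suc i) = ℕ.≤-trans (term≤∑ (f ∘ suc) i) (ℕ.m≤n+m _ (f zero))

  ∑-positive : (f : Fin k → ℕ) → 1 ≤ ∑ f → ∃ λ i → 1 ≤ f i
  ∑-positive {suc k} f p with f zero in eq
  ... | suc _ = zero , subst (1 ≤_) (sym eq) (s≤s z≤n)
  ... | zero  = let i , q = ∑-positive (f ∘ suc) p in suc i , q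

  ∑-rigid : {f g : Fin k → ℕ} → (∀ i → f i ≤ g i) → ∑ g ≤ ∑ f → ∀ i → f i ≡ g i
  ∑-rigid {suc k} {f} {g} p q zero = ℕ.≤-antisym (p zero)
    (ℕ.+-cancelʳ-≤ (∑ (f ∘ suc)) _ _ (ℕ.≤-trans (ℕ.+-monoʳ-≤ (g zero) (∑-mono (p ∘ suc))) q))
  ∑-rigid {suc k} {f} {g} p q (suc i) = ∑-rigid (p ∘ suc)
    (ℕ.+-cancelˡ-≤ (f zero) _ _ (ℕ.≤-trans (ℕ.+-monoˡ-≤ _ (p zero)) q)) i

  ∑-zero : {f : Fin k → ℕ} → (∀ i → f i ≡ 0) → ∑ f ≡ 0
  ∑-zero {k} p = trans (∑-cong p) (Sum.sum-replicate-zero k)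

  ∑-one : ∀ k → ∑ {k} (λ _ → 1) ≡ k
  ∑-one zero    = refl
  ∑-one (suc k) = cong suc (∑-one k)

χ : Bool → ℕ
χ true  = 1
χ false = 0

χ≤1 : ∀ b → χ b ≤ 1
χ≤1 true  = s≤s z≤n
χ≤1 false = z≤n

χ-∧ : ∀ a b → χ (a ∧ b) ≡ χ a * χ b
χ-∧ true  b = sym (ℕ.+-identityʳ _)
χ-∧ false b = refl

-- Counts the ends of an edge in a vertex set: an inner edge has two, a cut edge one.
χ-∈ : ∀ a b → χ a + χ b ≡ 2 * χ (a ∧ b) + χ (a xor b)
χ-∈ true  true  = refl
χ-∈ true  false = refl
χ-∈ false true  = refl
χ-∈ false false = refl

_==_ : Fin k → Fin k → Bool
i == j = does (i ≟ j)

==-refl : (i : Fin k) → (i == i) ≡ true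
==-refl i = dec-true (i ≟ i) refl

==-≢ : {i j : Fin k} → i ≢ j → (i == j) ≡ false
==-≢ {i = i} {j} p = dec-false (i ≟ j) p

==-sound : {i j : Fin k} → (i == j) ≡ true → i ≡ j
==-sound {i = i} {j} p with i ≟ j
... | yes q = q

∑-at : (f : Fin k → ℕ) (i : Fin k) → ∑ (λ j → f j * χ (i == j)) ≡ f i
∑-at {suc k} f zero = trans (∑-∷ _) (trans (cong₂ _+_ (ℕ.*-identityʳ (f zero)) (∑-zero λ j → ℕ.*-zeroʳ (f (suc j)))) (ℕ.+-identityʳ _))
∑-at {suc k} f (suc i) = trans (∑-∷ _) (cong₂ _+_ (ℕ.*-zeroʳ (f zero)) (∑-at (f ∘ suc) i))

∑-point : (i : Fin k) → ∑ (λ j → χ (i == j)) ≡ 1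
∑-point i = trans (∑-cong λ j → sym (ℕ.+-identityʳ _)) (∑-at (λ _ → 1) i)

two-terms≤∑ : (f : Fin k → ℕ) {i j : Fin k} → i ≢ j → f i + f j ≤ ∑ f
two-terms≤∑ f {i} {j} i≢j = subst (_≤ ∑ f)
  (trans (∑-+ (λ l → f l * χ (i == l)) (λ l → f l * χ (j == l))) (cong₂ _+_ (∑-at f i) (∑-at f j)))
  (∑-mono bound)
  where
  bound : ∀ l → f l * χ (i == l) + f l * χ (j == l) ≤ f l
  bound l with i ≟ l | j ≟ l
  ... | yes refl | yes refl = ⊥-elim (i≢j refl)
  ... | yes _ | no _  = ℕ.≤-reflexive (trans (cong₂ _+_ (ℕ.*-identityʳ (f l)) (ℕ.*-zeroʳ (f l))) (ℕ.+-identityʳ _))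
  ... | no _  | yes _ = ℕ.≤-reflexive (cong₂ _+_ (ℕ.*-zeroʳ (f l)) (ℕ.*-identityʳ (f l)))
  ... | no _  | no _  = subst (_≤ f l) (sym (cong₂ _+_ (ℕ.*-zeroʳ (f l)) (ℕ.*-zeroʳ (f l)))) z≤n

-- The injection `h` is defined only where `f` does not vanish, because later it maps the edges at a
-- vertex to edges of another graph and has no value elsewhere. The induction erases from `g` the
-- term already used; injectivity keeps the remaining terms intact.
∑-≤-injection : (f : Fin k → ℕ) (g : Fin l → ℕ) (h : ∀ i → f i ≢ 0 → Fin l) →
  (∀ i p → f i ≤ g (h i p)) → (∀ i p j q → h i p ≡ h j q → i ≡ j) → ∑ f ≤ ∑ g
∑-≤-injection {zero}  f g h le inj = subst (_≤ ∑ g) (sym (∑-[] f)) z≤n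
∑-≤-injection {suc k} {l} f g h le inj rewrite ∑-∷ f with f zero in eq
... | zero = ∑-≤-injection (f ∘ suc) g (h ∘ suc) (le ∘ suc) λ i p j q r → Fin.suc-injective (inj _ p _ q r)
... | suc x = subst (suc x + ∑ (f ∘ suc) ≤_) split
    (ℕ.+-mono-≤ (subst (_≤ g j₀) eq (le zero f₀≢0))
      (∑-≤-injection (f ∘ suc) g′ (h ∘ suc) le′ λ i p j q r → Fin.suc-injective (inj _ p _ q r)))
  where
  f₀≢0 : f zero ≢ 0
  f₀≢0 z = case trans (sym eq) z of λ ()
  j₀ : Fin l
  j₀ = h zero f₀≢0
  g′ : Fin l → ℕ
  g′ j = g j * χ (not (j₀ == j))
  split : g j₀ + ∑ g′ ≡ ∑ g
  split = trans (cong (_+ ∑ g′) (sym (∑-at g j₀)))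
    (trans (sym (∑-+ (λ j → g j * χ (j₀ == j)) g′)) (∑-cong λ j → both (g j) (j₀ == j)))
    where
    both : ∀ a b → a * χ b + a * χ (not b) ≡ a
    both a true  = trans (cong₂ _+_ (ℕ.*-identityʳ a) (ℕ.*-zeroʳ a)) (ℕ.+-identityʳ a)
    both a false = cong₂ _+_ (ℕ.*-zeroʳ a) (ℕ.*-identityʳ a)
  le′ : ∀ i p → f (suc i) ≤ g′ (h (suc i) p)
  le′ i p with j₀ ≟ h (suc i) p
  ... | yes q = case inj _ f₀≢0 _ p q of λ ()
  ... | no  q = subst (f (suc i) ≤_) (sym (ℕ.*-identityʳ _)) (le (suc i) p)

even≢odd : ∀ a b → 2 * a ≢ suc (2 * b)
even≢odd (suc a) zero    p = case trans (sym (ℕ.+-suc a (a + 0))) (ℕ.suc-injective p) of λ ()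
even≢odd (suc a) (suc b) p = even≢odd a b (ℕ.suc-injective (ℕ.suc-injective (trans (sym (ℕ.*-suc 2 a)) (trans p (cong suc (ℕ.*-suc 2 b))))))

-- The fuel is the distance to the bound.
opaque
  argmax : {P : Subset k → Set} → (∀ s → Dec (P s)) → (f : Subset k → ℕ) (b : ℕ) → (∀ s → P s → f s ≤ b) →
    ∃ P → ∃ λ s → P s × (∀ t → P t → f t ≤ f s)
  argmax {P = P} P? f b f≤b (s₀ , p₀) = climb b s₀ p₀ (ℕ.m≤n+m b (f s₀))
    where
    climb : ∀ fuel s → P s → b ≤ f s + fuel → ∃ λ s → P s × (∀ t → P t → f t ≤ f s)
    climb fuel s p le with anySubset? (λ t → P? t ×-dec (f s ℕ.<? f t))
    climb fuel s p le | no none = s , p , λ t q → ℕ.≮⇒≥ λ r → none (t , q , r)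
    climb zero s p le | yes (t , q , r) =
      ⊥-elim (ℕ.<⇒≱ r (ℕ.≤-trans (f≤b t q) (subst (b ≤_) (ℕ.+-identityʳ _) le)))
    climb (suc fuel) s p le | yes (t , q , r) =
      climb fuel t q (ℕ.≤-trans (subst (b ≤_) (ℕ.+-suc (f s) fuel) le) (ℕ.+-monoˡ-≤ fuel r))

-- Reachability in a finite decidable relation

module _ {R : Fin k → Fin k → Set} (R? : ∀ i j → Dec (R i j)) where

  private
    Reached : Fin k → (Fin k → Bool) → Set
    Reached r K = K r ≡ true × (∀ x → K x ≡ true → Star R r x)

    -- The fuel bounds the number of elements outside `K`. When it is used up, `K` is everything and
    -- no step can leave it.
    grow : ∀ fuel r K → Reached r K → k ≤ ∑ (χ ∘ K) + fuel →
      ∃ λ K → Reached r K × (∀ x y → K x ≡ true → R x y → K y ≡ true)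
    grow fuel r K rK le with any? (λ x → any? (λ y → (K x Bool.≟ true) ×-dec ((K y Bool.≟ false) ×-dec R? x y)))
    ... | no none = K , rK , λ x y Kx Rxy → closed x y Kx Rxy
      where
      closed : ∀ x y → K x ≡ true → R x y → K y ≡ true
      closed x y Kx Rxy with K y in eq
      ... | true  = refl
      ... | false = ⊥-elim (none (x , y , Kx , eq , Rxy))
    ... | yes (x , y , Kx , Ky , Rxy) with fuel
    ... | zero = ⊥-elim (case trans (sym Ky) (full y) of λ ())
      where
      full : ∀ z → K z ≡ true
      full z with K z | ∑-rigid {f = χ ∘ K} {λ _ → 1} (χ≤1 ∘ K)
                   (subst (_≤ ∑ (χ ∘ K)) (sym (∑-one k)) (subst (k ≤_) (ℕ.+-identityʳ _) le)) z
      ... | true | _ = refl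
    ... | suc fuel′ = grow fuel′ r K′ rK′ (ℕ.≤-trans le (subst (_≤ ∑ (χ ∘ K′) + fuel′) (sym (ℕ.+-suc (∑ (χ ∘ K)) fuel′)) (ℕ.+-monoˡ-≤ fuel′ more)))
      where
      K′ : Fin k → Bool
      K′ z = K z ∨ (y == z)
      more : suc (∑ (χ ∘ K)) ≤ ∑ (χ ∘ K′)
      more = ℕ.≤-trans (ℕ.≤-reflexive (trans (ℕ.+-comm 1 _) (trans (cong (∑ (χ ∘ K) +_) (sym (∑-point y)))
        (sym (∑-+ (χ ∘ K) (λ z → χ (y == z))))))) (∑-mono le′)
        where
        le′ : ∀ z → χ (K z) + χ (y == z) ≤ χ (K′ z)
        le′ z with y ≟ z
        le′ z | yes refl rewrite Ky = s≤s z≤n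
        le′ z | no _ with K z
        ... | true  = s≤s z≤n
        ... | false = z≤n
      rK′ : Reached r K′
      rK′ = cong (_∨ _) (proj₁ rK) , reach
        where
        reach : ∀ z → K′ z ≡ true → Star R r z
        reach z p with K z in eq
        ... | true  = proj₂ rK z eq
        ... | false = subst (Star R r) (==-sound p) (proj₂ rK x Kx ◅◅ (Rxy ◅ ε))

  opaque
    component : ∀ r → ∃ λ (K : Fin k → Bool) → K r ≡ true × (∀ x → K x ≡ true → Star R r x) × (∀ x y → K x ≡ true → R x y → K y ≡ true)
    component r = let K , (a , b) , c = grow k r (r ==_) (==-refl r , λ x p → subst (Star R r) (==-sound p) ε) (ℕ.m≤n+m k _)
                  in K , a , b , c

-- Degrees, cuts and alternating paths

==-sym : (i j : Fin k) → (i == j) ≡ (j == i)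
==-sym i j with i ≟ j
... | yes refl = sym (==-refl i)
... | no  p    = sym (==-≢ (p ∘ sym))

χ-true : ∀ {b} → 1 ≤ χ b → b ≡ true
χ-true {true} p = refl

+-≡0ˡ : ∀ a {b} → a + b ≡ 0 → a ≡ 0
+-≡0ˡ zero p = refl

+-≡0ʳ : ∀ a {b} → a + b ≡ 0 → b ≡ 0
+-≡0ʳ zero p = p

≤1-cases : ∀ {a} → a ≤ 1 → a ≡ 0 ⊎ a ≡ 1
≤1-cases {zero}        p       = inj₁ refl
≤1-cases {suc zero}    p       = inj₂ refl
≤1-cases {suc (suc a)} (s≤s ())

1≤* : ∀ {a b} → 1 ≤ a * b → 1 ≤ a × 1 ≤ b
1≤* {suc a} {suc b} p = s≤s z≤n , s≤s z≤n
1≤* {suc a} {zero}  p = ⊥-elim (ℕ.<-irrefl (sym (ℕ.*-zeroʳ a)) p)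

bits : Subset k → Fin k → ℕ
bits s e = χ (lookup s e)

support : (Fin k → ℕ) → Subset k
support F = tabulate λ e → does (1 ℕ.≤? F e)

bits-support : {F : Fin k → ℕ} → (∀ e → F e ≤ 1) → ∀ e → bits (support F) e ≡ F e
bits-support {F = F} p e with lookup (support F) e | lookup∘tabulate (λ e → does (1 ℕ.≤? F e)) e
... | _ | refl with F e | p e
... | 0 | _ = refl
... | 1 | _ = refl
... | suc (suc _) | s≤s ()

⟨_,_⟩ : (w F : Fin k → ℕ) → ℕ
⟨ w , F ⟩ = ∑ λ e → w e * F e

module _ {P : (Fin k → ℕ) → Set} (P? : ∀ F → Dec (P F)) (ext : ∀ {F F′} → (∀ e → F e ≡ F′ e) → P F → P F′)
         (small : ∀ {F} → P F → ∀ e → F e ≤ 1) where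

  opaque
    -- Functions bounded by 1 are indicators of subsets, so existence and maximisation over them are
    -- finite searches; `ext` makes up for the lack of function extensionality.
    anyBits? : Dec (∃ P)
    anyBits? = mapDec (λ (s , p) → bits s , p) (λ (F , p) → support F , ext (sym ∘ bits-support (small p)) p)
      (anySubset? (P? ∘ bits))

    maximiser : (w : Fin k → ℕ) → ∃ P → ∃ λ F → P F × (∀ F′ → P F′ → ⟨ w , F′ ⟩ ≤ ⟨ w , F ⟩)
    maximiser w (F₀ , p₀) =
      let s , p , best = argmax (P? ∘ bits) (λ s → ⟨ w , bits s ⟩) (∑ w)
            (λ s _ → ∑-mono λ e → ℕ.≤-trans (ℕ.*-monoʳ-≤ (w e) (χ≤1 (lookup s e))) (ℕ.≤-reflexive (ℕ.*-identityʳ (w e))))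
            (support F₀ , ext (sym ∘ bits-support (small p₀)) p₀)
      in bits s , p , λ F′ p′ → subst (_≤ ⟨ w , bits s ⟩) (∑-cong λ e → cong (w e *_) (bits-support (small p′) e))
           (best (support F′) (ext (sym ∘ bits-support (small p′)) p′))

δ : Fin k → Fin k → ℕ
δ e f = χ (e == f)

⟨,⟩-+ʳ : (w F F′ : Fin k → ℕ) → ⟨ w , (λ e → F e + F′ e) ⟩ ≡ ⟨ w , F ⟩ + ⟨ w , F′ ⟩
⟨,⟩-+ʳ w F F′ = trans (∑-cong λ e → ℕ.*-distribˡ-+ (w e) (F e) (F′ e)) (∑-+ _ _)

⟨,⟩-δ : (w : Fin k → ℕ) (e : Fin k) → ⟨ w , δ e ⟩ ≡ w e
⟨,⟩-δ w e = ∑-at w e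

peel : (F : Fin k → ℕ) (e : Fin k) → 1 ≤ F e → ∀ f → F f ∸ δ e f + δ e f ≡ F f
peel F e p f with e ≟ f
... | yes refl = ℕ.m∸n+n≡m p
... | no _     = ℕ.+-identityʳ _

module _ (G : Graph) where
  open Graph G

  src tgt : E → V
  src e = proj₁ (ends e)
  tgt e = proj₂ (ends e)

  inc : E → V → ℕ
  inc e v = χ (src e == v) + χ (tgt e == v)

  ins cut : (V → Bool) → E → ℕ
  ins X e = χ (X (src e) ∧ X (tgt e))
  cut X e = χ (X (src e) xor X (tgt e))

  d : (E → ℕ) → V → ℕ
  d F v = ∑ λ e → F e * inc e v

  d-cong : ∀ {F F′} → (∀ e → F e ≡ F′ e) → ∀ v → d F v ≡ d F′ v
  d-cong p v = ∑-cong λ e → cong (_* inc e v) (p e)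

  d-mono : ∀ {F F′} → (∀ e → F e ≤ F′ e) → ∀ v → d F v ≤ d F′ v
  d-mono p v = ∑-mono λ e → ℕ.*-monoˡ-≤ (inc e v) (p e)

  d-+ : ∀ F F′ v → d (λ e → F e + F′ e) v ≡ d F v + d F′ v
  d-+ F F′ v = trans (∑-cong λ e → ℕ.*-distribʳ-+ (inc e v) (F e) (F′ e)) (∑-+ _ _)

  d-δ : ∀ e v → d (δ e) v ≡ inc e v
  d-δ e v = trans (∑-cong λ f → ℕ.*-comm (δ e f) (inc f v)) (∑-at (λ f → inc f v) e)

  -- Double counting of incidences with vertex weights `y`. Instances have for `y` the indicator of
  -- a set, the constant 1 or a dual solution.
  handshake : ∀ y F → ∑ (λ v → y v * d F v) ≡ ∑ (λ e → F e * (y (src e) + y (tgt e)))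
  handshake y F = begin
    ∑ (λ v → y v * d F v)                      ≡⟨ ∑-cong (λ v → ∑-*ˡ (y v) _) ⟨
    ∑ (λ v → ∑ λ e → y v * (F e * inc e v))    ≡⟨ ∑-swap _ ⟩
    ∑ (λ e → ∑ λ v → y v * (F e * inc e v))    ≡⟨ ∑-cong (λ e → trans (∑-cong λ v → assoc (y v) (F e) (inc e v)) (∑-*ˡ (F e) _)) ⟩
    ∑ (λ e → F e * ∑ (λ v → y v * inc e v))    ≡⟨ ∑-cong (λ e → cong (F e *_) (trans
                                                     (trans (∑-cong λ v → ℕ.*-distribˡ-+ (y v) _ _) (∑-+ _ _))
                                                     (cong₂ _+_ (∑-at y (src e)) (∑-at y (tgt e))))) ⟩
    ∑ (λ e → F e * (y (src e) + y (tgt e)))    ∎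
    where
    open ≡-Reasoning
    assoc : ∀ a b c → a * (b * c) ≡ b * (a * c)
    assoc = solve-∀

  volume : ∀ X F → ∑ (λ v → χ (X v) * d F v) ≡ 2 * ⟨ F , ins X ⟩ + ⟨ F , cut X ⟩
  volume X F = trans (handshake (χ ∘ X) F) (trans (∑-cong λ e → trans (cong (F e *_) (χ-∈ (X (src e)) (X (tgt e)))) (dist (F e) _ _))
    (trans (∑-+ _ _) (cong (_+ ⟨ F , cut X ⟩) (∑-*ˡ 2 _))))
    where
    dist : ∀ a b c → a * (2 * b + c) ≡ 2 * (a * b) + a * c
    dist = solve-∀

  inc-src : ∀ e → inc e (src e) ≡ 1
  inc-src e rewrite ==-refl (src e) | ==-≢ {i = tgt e} {src e} (loopless e ∘ sym) = refl

  inc-tgt : ∀ e → inc e (tgt e) ≡ 1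
  inc-tgt e rewrite ==-refl (tgt e) | ==-≢ {i = src e} {tgt e} (loopless e) = refl

  Incident⇒inc : ∀ {e v} → Incident e v → inc e v ≡ 1
  Incident⇒inc {e} (inj₁ refl) = inc-src e
  Incident⇒inc {e} (inj₂ refl) = inc-tgt e

  inc⇒Incident : ∀ {e v} → inc e v ≢ 0 → Incident e v
  inc⇒Incident {e} {v} p with src e ≟ v | tgt e ≟ v
  ... | yes q | _     = inj₁ q
  ... | no _  | yes q = inj₂ q
  ... | no _  | no _  = ⊥-elim (p refl)

  inc≤1 : ∀ e v → inc e v ≤ 1
  inc≤1 e v with inc e v in eq
  ... | zero  = z≤n
  ... | suc _ = ℕ.≤-reflexive (trans (sym eq) (Incident⇒inc {e} (inc⇒Incident λ p → case trans (sym eq) p of λ ())))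

  inc-otherEnd : ∀ {v} (e : E[∂ v ]) x → inc (proj₁ e) x ≡ χ (v == x) + χ (otherEnd e == x)
  inc-otherEnd (e , inj₁ refl) x = refl
  inc-otherEnd (e , inj₂ refl) x = ℕ.+-comm (χ (src e == x)) _

  d-positive : ∀ F v → 1 ≤ d F v → ∃ λ (e : E[∂ v ]) → 1 ≤ F (proj₁ e)
  d-positive F v p =
    let e , q = ∑-positive _ p ; r , s = 1≤* {F e} q
    in (e , inc⇒Incident (ℕ.>⇒≢ s)) , r

  F≤d : ∀ F {e v} → Incident e v → F e ≤ d F v
  F≤d F {e} {v} i = subst (_≤ d F v) (trans (cong (F e *_) (Incident⇒inc i)) (ℕ.*-identityʳ _)) (term≤∑ (λ e → F e * inc e v) e)

  IsMatching : (E → ℕ) → Set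
  IsMatching M = ∀ v → d M v ≤ 1

  add-edge : ∀ F {v} (f : E[∂ v ]) → IsMatching F → d F v ≡ 0 → d F (otherEnd f) ≡ 0 → IsMatching (λ g → F g + δ (proj₁ f) g)
  add-edge F {v} f mF a b x rewrite d-+ F (δ (proj₁ f)) x | d-δ (proj₁ f) x | inc-otherEnd f x with v ≟ x
  ... | yes refl rewrite a | ==-≢ (otherEnd≢ f) = s≤s z≤n
  ... | no _ with otherEnd f ≟ x
  ... | yes refl rewrite b = s≤s z≤n
  ... | no _ rewrite ℕ.+-identityʳ (d F x) = mF x

  -- The symmetric difference of two matchings is exchanged along the
  -- alternating path that starts at t; q is its other end.
  record Exchange (M N : E → ℕ) (t : V) : Set where
    field
      M′ N′ : E → ℕ
      q     : V
      total : ∀ e → M′ e + N′ e ≡ M e + N e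
      M′-matching : IsMatching M′
      N′-matching : IsMatching N′
      N′-at-t  : d N′ t ≡ 0
      N′-other : ∀ v → v ≢ t → v ≢ q → d N′ v ≡ d N v
      q-or-t   : d N t ≡ 1 ⊎ q ≡ t

  opaque
    -- The alternating path is followed two edges at a time: the `N`-edge `e` at `t`, then the
    -- `M`-edge `f` at its far end `t₁`, then the rest from `t₂`. With `e` and `f` removed, `t` and
    -- `t₁` are uncovered by both matchings and stay so in the recursive result, so both edges can
    -- be put back with their roles swapped. The fuel bounds the edges of `N`.
    exchange : ∀ fuel M N t → ∑ N ≤ fuel → IsMatching M → IsMatching N → d M t ≡ 0 → Exchange M N t
    exchange fuel M N t le mM mN Mt with ≤1-cases (mN t)
    ... | inj₁ Nt = record { M′ = M ; N′ = N ; q = t ; total = λ _ → refl ; M′-matching = mM ; N′-matching = mN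
                           ; N′-at-t = Nt ; N′-other = λ _ _ _ → refl ; q-or-t = inj₂ refl }
    ... | inj₂ Nt with d-positive N t (ℕ.≤-reflexive (sym Nt))
    ... | e∂ , Ne = step (≤1-cases (mM t₁))
      where
      e : E
      e = proj₁ e∂
      t₁ : V
      t₁ = otherEnd e∂
      t≢t₁ : t ≢ t₁
      t≢t₁ = otherEnd≢ e∂ ∘ sym
      N₀ : E → ℕ
      N₀ f = N f ∸ δ e f
      dN : ∀ v → d N v ≡ d N₀ v + inc e v
      dN v = trans (d-cong (sym ∘ peel N e Ne) v) (trans (d-+ N₀ (δ e) v) (cong (d N₀ v +_) (d-δ e v)))
      N₀-at : ∀ {v} → inc e v ≡ 1 → d N₀ v ≡ 0
      N₀-at {v} p = ℕ.n≤0⇒n≡0 (ℕ.+-cancelʳ-≤ 1 _ _ (subst (_≤ 1) (trans (dN v) (cong (d N₀ v +_) p)) (mN v)))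
      inc-t : inc e t ≡ 1
      inc-t = Incident⇒inc (proj₂ e∂)
      inc-t₁ : inc e t₁ ≡ 1
      inc-t₁ = trans (inc-otherEnd e∂ t₁) (cong₂ _+_ (cong χ (==-≢ t≢t₁)) (cong χ (==-refl t₁)))
      mN₀ : IsMatching N₀
      mN₀ v = ℕ.≤-trans (subst (d N₀ v ≤_) (sym (dN v)) (ℕ.m≤m+n _ _)) (mN v)
      step : d M t₁ ≡ 0 ⊎ d M t₁ ≡ 1 → Exchange M N t
      step (inj₁ Mt₁) = record
        { M′ = λ f → M f + δ e f ; N′ = N₀ ; q = t₁
        ; total = λ f → trans (ℕ.+-assoc (M f) _ _) (cong (M f +_) (trans (ℕ.+-comm (δ e f) (N₀ f)) (peel N e Ne f)))
        ; M′-matching = add-edge M e∂ mM Mt Mt₁ ; N′-matching = mN₀ ; N′-at-t = N₀-at inc-t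
        ; N′-other = λ v p q → sym (trans (dN v) (trans (cong (d N₀ v +_) (trans (inc-otherEnd e∂ v)
            (cong₂ _+_ (cong χ (==-≢ (p ∘ sym))) (cong χ (==-≢ (q ∘ sym)))))) (ℕ.+-identityʳ _)))
        ; q-or-t = inj₁ Nt }
      step (inj₂ Mt₁) with d-positive M t₁ (ℕ.≤-reflexive (sym Mt₁))
      ... | f∂ , Mf = finish fuel le
        where
        f : E
        f = proj₁ f∂
        t₂ : V
        t₂ = otherEnd f∂
        t₁≢t₂ : t₁ ≢ t₂
        t₁≢t₂ = otherEnd≢ f∂ ∘ sym
        M₀ : E → ℕ
        M₀ g = M g ∸ δ f g
        dM : ∀ v → d M v ≡ d M₀ v + inc f v
        dM v = trans (d-cong (sym ∘ peel M f Mf) v) (trans (d-+ M₀ (δ f) v) (cong (d M₀ v +_) (d-δ f v)))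
        M₀-at : ∀ {v} → inc f v ≡ 1 → d M₀ v ≡ 0
        M₀-at {v} p = ℕ.n≤0⇒n≡0 (ℕ.+-cancelʳ-≤ 1 _ _ (subst (_≤ 1) (trans (dM v) (cong (d M₀ v +_) p)) (mM v)))
        inc-f-t₁ : inc f t₁ ≡ 1
        inc-f-t₁ = Incident⇒inc (proj₂ f∂)
        inc-f-t₂ : inc f t₂ ≡ 1
        inc-f-t₂ = trans (inc-otherEnd f∂ t₂) (cong₂ _+_ (cong χ (==-≢ t₁≢t₂)) (cong χ (==-refl t₂)))
        inc-f-t : inc f t ≡ 0
        inc-f-t = +-≡0ʳ (d M₀ t) (trans (sym (dM t)) Mt)
        M₀-t : d M₀ t ≡ 0
        M₀-t = +-≡0ˡ (d M₀ t) (trans (sym (dM t)) Mt)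
        mM₀ : IsMatching M₀
        mM₀ v = ℕ.≤-trans (subst (d M₀ v ≤_) (sym (dM v)) (ℕ.m≤m+n _ _)) (mM v)
        ∑N : ∑ N ≡ ∑ N₀ + 1
        ∑N = trans (∑-cong (sym ∘ peel N e Ne)) (trans (∑-+ N₀ (δ e)) (cong (∑ N₀ +_) (∑-point e)))
        finish : ∀ fuel → ∑ N ≤ fuel → Exchange M N t
        finish zero le = case subst (_≤ 0) (trans ∑N (ℕ.+-comm _ 1)) le of λ ()
        finish (suc fuel) le = record
          { M′ = λ g → M′ g + δ e g ; N′ = λ g → N′ g + δ f g ; q = q
          ; total = λ g → trans (shuffle (M′ g) (δ e g) (N′ g) (δ f g)) (trans (cong (_+ (δ f g + δ e g)) (total g))
              (trans (shuffle (M₀ g) (N₀ g) (δ f g) (δ e g)) (cong₂ _+_ (peel M f Mf g) (trans (ℕ.+-comm (δ e g) (N₀ g)) (peel N e Ne g)))))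
          ; M′-matching = add-edge M′ e∂ M′-matching (proj₁ (free M₀-t (N₀-at inc-t))) (proj₁ (free (M₀-at inc-f-t₁) (N₀-at inc-t₁)))
          ; N′-matching = add-edge N′ f∂ N′-matching (proj₂ (free (M₀-at inc-f-t₁) (N₀-at inc-t₁))) N′-at-t
          ; N′-at-t = trans (dN′ t) (cong₂ _+_ (proj₂ (free M₀-t (N₀-at inc-t))) inc-f-t)
          ; N′-other = other ; q-or-t = inj₁ Nt }
          where
          open Exchange (exchange fuel M₀ N₀ t₂ (ℕ.≤-pred (subst (_≤ suc fuel) (trans ∑N (ℕ.+-comm _ 1)) le)) mM₀ mN₀ (M₀-at inc-f-t₂))
          shuffle : ∀ a b c d → (a + b) + (c + d) ≡ (a + c) + (d + b)
          shuffle = solve-∀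
          dN′ : ∀ v → d (λ g → N′ g + δ f g) v ≡ d N′ v + inc f v
          dN′ v = trans (d-+ N′ (δ f) v) (cong (d N′ v +_) (d-δ f v))
          free : ∀ {v} → d M₀ v ≡ 0 → d N₀ v ≡ 0 → d M′ v ≡ 0 × d N′ v ≡ 0
          free {v} a b = +-≡0ˡ (d M′ v) sum≡0 , +-≡0ʳ (d M′ v) sum≡0
            where
            sum≡0 : d M′ v + d N′ v ≡ 0
            sum≡0 = trans (sym (d-+ M′ N′ v)) (trans (d-cong total v) (trans (d-+ M₀ N₀ v) (cong₂ _+_ a b)))
          other : ∀ v → v ≢ t → v ≢ q → d (λ g → N′ g + δ f g) v ≡ d N v
          other v v≢t v≢q with v ≟ t₂ | v ≟ t₁
          -- `q-or-t` exists for this case: unless the path stops at `t₂`, the matching `N` covers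
          -- `t₂`, and `f` restores that degree.
          ... | yes refl | _ = trans (dN′ v) (trans (cong₂ _+_ N′-at-t inc-f-t₂) (sym (ℕ.≤-antisym (mN v) (subst (1 ≤_) (sym (dN v)) (ℕ.≤-trans N₀≥1 (ℕ.m≤m+n _ _))))))
            where
            N₀≥1 : 1 ≤ d N₀ v
            N₀≥1 = [ ℕ.≤-reflexive ∘ sym , (λ p → ⊥-elim (v≢q (sym p))) ]′ q-or-t
          ... | no _ | yes refl = trans (dN′ v) (trans (cong₂ _+_ (proj₂ (free (M₀-at inc-f-t₁) (N₀-at inc-t₁))) inc-f-t₁)
                  (sym (trans (dN v) (cong₂ _+_ (N₀-at inc-t₁) inc-t₁))))
          ... | no v≢t₂ | no v≢t₁ = trans (dN′ v) (trans (cong₂ _+_ (N′-other v v≢t₂ v≢q)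
                  (trans (trans (inc-otherEnd f∂ v) (cong₂ _+_ (cong χ (==-≢ (v≢t₁ ∘ sym))) (cong χ (==-≢ (v≢t₂ ∘ sym)))))
                    (sym (trans (inc-otherEnd e∂ v) (cong₂ _+_ (cong χ (==-≢ (v≢t ∘ sym))) (cong χ (==-≢ (v≢t₁ ∘ sym))))))))
                  (sym (dN v)))

-- Weighted matching duality

⟨,⟩-comm : (w F : Fin k → ℕ) → ⟨ w , F ⟩ ≡ ⟨ F , w ⟩
⟨,⟩-comm w F = ∑-cong λ e → ℕ.*-comm (w e) (F e)

⟨,⟩-congʳ : (w : Fin k → ℕ) {F F′ : Fin k → ℕ} → (∀ e → F e ≡ F′ e) → ⟨ w , F ⟩ ≡ ⟨ w , F′ ⟩
⟨,⟩-congʳ w p = ∑-cong λ e → cong (w e *_) (p e)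

⟨,⟩-monoˡ : {w w′ : Fin k → ℕ} (F : Fin k → ℕ) → (∀ e → w e ≤ w′ e) → ⟨ w , F ⟩ ≤ ⟨ w′ , F ⟩
⟨,⟩-monoˡ F p = ∑-mono λ e → ℕ.*-monoˡ-≤ (F e) (p e)

∑-< : {f g : Fin k → ℕ} → (∀ i → f i ≤ g i) → ∀ i → f i < g i → ∑ f < ∑ g
∑-< le i lt = ℕ.≰⇒> λ p → ℕ.<-irrefl (∑-rigid le p i) lt

⟨,⟩-∸ : (w c F : Fin k → ℕ) → (∀ e → F e ≢ 0 → c e ≤ w e) → ⟨ w , F ⟩ ≡ ⟨ (λ e → w e ∸ c e) , F ⟩ + ⟨ c , F ⟩
⟨,⟩-∸ w c F p = trans (∑-cong split) (∑-+ _ _)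
  where
  split : ∀ e → w e * F e ≡ (w e ∸ c e) * F e + c e * F e
  split e with F e ℕ.≟ 0
  ... | yes z rewrite z | ℕ.*-zeroʳ (w e) | ℕ.*-zeroʳ (w e ∸ c e) | ℕ.*-zeroʳ (c e) = refl
  ... | no nz = trans (cong (_* F e) (sym (ℕ.m∸n+n≡m (p e nz)))) (ℕ.*-distribʳ-+ (F e) (w e ∸ c e) (c e))

module _ (G : Graph) where
  open Graph G

  -- An integral dual solution of maximum-weight matching. In place of a multiplier for each odd
  -- set, the family `U` lists a set as often as its multiplier says.
  record Dual (w : E → ℕ) : Set where
    field
      y      : V → ℕ
      {r}    : ℕ
      U      : Fin r → V → Bool
      h      : Fin r → ℕ   -- in the role of ⌊ |U i| / 2 ⌋
      size   : ∀ i → ∑ (χ ∘ U i) ≤ suc (2 * h i)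
      covers : ∀ e → w e ≤ y (src G e) + y (tgt G e) + ∑ (λ i → ins G (U i) e)

    value : ℕ
    value = ∑ y + ∑ h

  IsMatchingIn : (w M : E → ℕ) → Set
  IsMatchingIn w M = IsMatching G M × (∀ e → w e ≡ 0 → M e ≡ 0)

  isMatchingIn? : ∀ w M → Dec (IsMatchingIn w M)
  isMatchingIn? w M = all? (λ v → d G M v ℕ.≤? 1) ×-dec all? (λ e → (w e ℕ.≟ 0) →-dec (M e ℕ.≟ 0))

  isMatchingIn-ext : ∀ w {M M′} → (∀ e → M e ≡ M′ e) → IsMatchingIn w M → IsMatchingIn w M′
  isMatchingIn-ext w p (a , b) = (λ v → subst (_≤ 1) (d-cong G p v) (a v)) , λ e q → trans (sym (p e)) (b e q)

  matching≤1 : ∀ {M} → IsMatching G M → ∀ e → M e ≤ 1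
  matching≤1 {M} mM e = ℕ.≤-trans (F≤d G M (inj₁ refl)) (mM (src G e))

  empty-matching : ∀ w → IsMatchingIn w (λ _ → 0)
  empty-matching w = (λ v → subst (_≤ 1) (sym (∑-zero {f = λ e → 0} λ e → refl)) z≤n) , λ _ _ → refl

  DualityFor : (E → ℕ) → Set
  DualityFor w = ∃ λ M → IsMatchingIn w M × Σ (Dual w) λ D → Dual.value D ≤ ⟨ w , M ⟩

  private
    module Optimum (w : E → ℕ) where

      opaque
        maximum : ∃ λ M → IsMatchingIn w M × (∀ M′ → IsMatchingIn w M′ → ⟨ w , M′ ⟩ ≤ ⟨ w , M ⟩)
        maximum = maximiser (isMatchingIn? w) (isMatchingIn-ext w) (matching≤1 ∘ proj₁) w (_ , empty-matching w)

      M* : E → ℕ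
      M* = proj₁ maximum

      Optimal : (E → ℕ) → Set
      Optimal M = IsMatchingIn w M × ⟨ w , M* ⟩ ≤ ⟨ w , M ⟩

      Missing : V → Set
      Missing u = ∃ λ M → Optimal M × d G M u ≡ 0

      opaque
        missing? : ∀ u → Dec (Missing u)
        missing? u = anyBits? (λ M → (isMatchingIn? w M ×-dec (_ ℕ.≤? _)) ×-dec (d G M u ℕ.≟ 0))
          (λ p ((a , b) , c) → (isMatchingIn-ext w p a , subst (_ ≤_) (⟨,⟩-congʳ w p) b) , trans (sym (d-cong G p u)) c)
          (matching≤1 ∘ proj₁ ∘ proj₁ ∘ proj₁)

      positive : ∀ {M} → IsMatchingIn w M → ∀ e → M e ≢ 0 → 1 ≤ w e
      positive mM e nz = ℕ.n≢0⇒n>0 (nz ∘ proj₂ mM e)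

  module _ (w : E → ℕ) where
    open Optimum w

    private
      module CoveredVertex (u : V) (covered : ¬ Missing u) where

        w′ : E → ℕ
        w′ e = w e ∸ inc G e u

        decreases : ∑ w′ < ∑ w
        decreases with d-positive G M* u (ℕ.n≢0⇒n>0 λ z → covered (M* , (proj₁ (proj₂ maximum) , ℕ.≤-refl) , z))
        ... | (e , i) , p = ∑-< (λ e → ℕ.m∸n≤m (w e) (inc G e u)) e
                (subst (λ x → w e ∸ x < w e) (sym (Incident⇒inc G i))
                  (ℕ.∸-monoʳ-< {w e} (s≤s z≤n) (positive (proj₁ (proj₂ maximum)) e (ℕ.>⇒≢ p))))

        -- One more unit at `y u` has to be paid for. The matching `M′` either is not maximum for
        -- `w`, and then integrality gives the unit, or it is maximum, hence covers `u` and lost at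
        -- least one when the weights at `u` were lowered.
        extend : DualityFor w′ → DualityFor w
        extend (M′ , mM′ , D , le) = M* , proj₁ (proj₂ maximum) ,
          record { y = y′ ; U = U ; h = h ; size = size ; covers = covers′ } ,
          (begin
            ∑ y′ + ∑ h              ≡⟨ cong (_+ ∑ h) (trans (∑-+ y _) (cong (∑ y +_) (trans (∑-cong λ v → cong χ (==-sym v u)) (∑-point u)))) ⟩
            ∑ y + 1 + ∑ h           ≡⟨ move (∑ y) (∑ h) ⟩
            suc (∑ y + ∑ h)         ≤⟨ s≤s le ⟩
            suc ⟨ w′ , M′ ⟩         ≤⟨ drop ⟩
            ⟨ w , M* ⟩              ∎)
          where
          open Dual D
          open ℕ.≤-Reasoning
          move : ∀ a b → a + 1 + b ≡ suc (a + b)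
          move = solve-∀
          y′ : V → ℕ
          y′ v = y v + χ (v == u)
          covers′ : ∀ e → w e ≤ y′ (src G e) + y′ (tgt G e) + ∑ (λ i → ins G (U i) e)
          covers′ e = begin
            w e                      ≤⟨ ℕ.m≤n+m∸n (w e) (inc G e u) ⟩
            inc G e u + w′ e         ≤⟨ ℕ.+-monoʳ-≤ (inc G e u) (covers e) ⟩
            inc G e u + (y (src G e) + y (tgt G e) + ∑ (λ i → ins G (U i) e)) ≡⟨ move′ (χ (src G e == u)) (χ (tgt G e == u)) (y (src G e)) (y (tgt G e)) (∑ (λ i → ins G (U i) e)) ⟩
            y′ (src G e) + y′ (tgt G e) + ∑ (λ i → ins G (U i) e) ∎
            where
            move′ : ∀ a b c d e → a + b + (c + d + e) ≡ c + a + (d + b) + e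
            move′ = solve-∀
          mM : IsMatchingIn w M′
          mM = proj₁ mM′ , λ e z → proj₂ mM′ e (trans (cong (_∸ inc G e u) z) (ℕ.0∸n≡0 (inc G e u)))
          le-inc : ∀ e → M′ e ≢ 0 → inc G e u ≤ w e
          le-inc e nz = ℕ.<⇒≤ (ℕ.m∸n≢0⇒n<m (nz ∘ proj₂ mM′ e))
          drop : suc ⟨ w′ , M′ ⟩ ≤ ⟨ w , M* ⟩
          drop with ⟨ w , M* ⟩ ℕ.≤? ⟨ w , M′ ⟩
          ... | no  p = ℕ.≤-<-trans (⟨,⟩-monoˡ M′ λ e → ℕ.m∸n≤m (w e) (inc G e u)) (ℕ.≰⇒> p)
          ... | yes p = begin
            suc ⟨ w′ , M′ ⟩          ≡⟨ ℕ.+-comm 1 _ ⟩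
            ⟨ w′ , M′ ⟩ + 1          ≤⟨ ℕ.+-monoʳ-≤ _ (ℕ.n≢0⇒n>0 λ z → covered (M′ , (mM , p) , z)) ⟩
            ⟨ w′ , M′ ⟩ + d G M′ u   ≡⟨ cong (⟨ w′ , M′ ⟩ +_) (⟨,⟩-comm M′ (λ e → inc G e u)) ⟩
            ⟨ w′ , M′ ⟩ + ⟨ (λ e → inc G e u) , M′ ⟩ ≡⟨ ⟨,⟩-∸ w (λ e → inc G e u) M′ le-inc ⟨
            ⟨ w , M′ ⟩               ≤⟨ proj₂ (proj₂ maximum) M′ mM ⟩
            ⟨ w , M* ⟩               ∎

      -- `K` is a component of the graph of positive weights, and the weights inside it are lowered
      -- by one. A matching that is maximum for the lowered weights, and has most edges in `K` among
      -- these, misses at most one vertex of `K`. So `K` may join the dual with `h` the number of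
      -- matching edges in it, which is just what the matching gains when the weights are raised
      -- again.
      module AllMissing (missing : ∀ u → Missing u) (e₀ : E) (we₀ : 1 ≤ w e₀) where

        Joins : E → V → V → Set
        Joins e x z = src G e ≡ x × tgt G e ≡ z ⊎ tgt G e ≡ x × src G e ≡ z

        R : V → V → Set
        R x z = ∃ λ e → 1 ≤ w e × Joins e x z

        R? : ∀ x z → Dec (R x z)
        R? x z = any? λ e → (1 ℕ.≤? w e) ×-dec (((src G e ≟ x) ×-dec (tgt G e ≟ z)) ⊎-dec ((tgt G e ≟ x) ×-dec (src G e ≟ z)))

        R-sym : ∀ {x z} → R x z → R z x
        R-sym (e , p , inj₁ (a , b)) = e , p , inj₂ (b , a)
        R-sym (e , p , inj₂ (a , b)) = e , p , inj₁ (b , a)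

        opaque
          comp : ∃ λ (K : V → Bool) → K (src G e₀) ≡ true × (∀ x → K x ≡ true → Star R (src G e₀) x) × (∀ x z → K x ≡ true → R x z → K z ≡ true)
          comp = component R? (src G e₀)

        K : V → Bool
        K = proj₁ comp

        closed : ∀ x z → K x ≡ true → R x z → K z ≡ true
        closed = proj₂ (proj₂ (proj₂ comp))

        no-cut : ∀ e → 1 ≤ w e → cut G K e ≡ 0
        no-cut e p with K (src G e) in a | K (tgt G e) in b
        ... | true  | true  = refl
        ... | false | false = refl
        ... | true  | false = case trans (sym b) (closed _ _ a (e , p , inj₁ (refl , refl))) of λ ()
        ... | false | true  = case trans (sym a) (closed _ _ b (e , p , inj₂ (refl , refl))) of λ ()

        c w′ : E → ℕ
        c = ins G K
        w′ e = w e ∸ c e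

        decreases : ∑ w′ < ∑ w
        decreases = ∑-< (λ e → ℕ.m∸n≤m (w e) (c e)) e₀ (subst (λ x → w e₀ ∸ x < w e₀) (sym c₀) (ℕ.∸-monoʳ-< {w e₀} (s≤s z≤n) we₀))
          where
          c₀ : c e₀ ≡ 1
          c₀ = cong₂ (λ a b → χ (a ∧ b)) (proj₁ (proj₂ comp)) (closed _ _ (proj₁ (proj₂ comp)) (e₀ , we₀ , inj₁ (refl , refl)))

        split : ∀ {N} → IsMatchingIn w N → ⟨ w , N ⟩ ≡ ⟨ w′ , N ⟩ + ⟨ c , N ⟩
        split {N} mN = ⟨,⟩-∸ w c N λ e nz → ℕ.≤-trans (χ≤1 _) (positive mN e nz)

        K-volume : ∀ {N} → IsMatchingIn w N → ∑ (λ v → χ (K v) * d G N v) ≡ 2 * ⟨ c , N ⟩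
        K-volume {N} mN = trans (volume G K N) (trans (cong₂ _+_ (cong (2 *_) (⟨,⟩-comm N c)) (∑-zero zero-cut)) (ℕ.+-identityʳ _))
          where
          zero-cut : ∀ e → N e * cut G K e ≡ 0
          zero-cut e with N e ℕ.≟ 0
          ... | yes z rewrite z = refl
          ... | no nz rewrite no-cut e (positive mN e nz) = ℕ.*-zeroʳ (N e)

        opaque
          first : ∃ λ N → IsMatchingIn w N × (∀ N′ → IsMatchingIn w N′ → ⟨ w′ , N′ ⟩ ≤ ⟨ w′ , N ⟩)
          first = maximiser (isMatchingIn? w) (isMatchingIn-ext w) (matching≤1 ∘ proj₁) w′ (_ , empty-matching w)

        N₁ : E → ℕ
        N₁ = proj₁ first

        W′-max : (E → ℕ) → Set
        W′-max N = IsMatchingIn w N × ⟨ w′ , N₁ ⟩ ≤ ⟨ w′ , N ⟩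

        -- Maximality for `w′` comes before the number of edges in `K`, since the dual value for
        -- `w′` is compared with `⟨ w′ , N ⟩`. The support is still that of `w`: an edge whose
        -- weight drops from 1 to 0 remains available.
        Lex-max : (E → ℕ) → Set
        Lex-max N = W′-max N × (∀ N′ → W′-max N′ → ⟨ c , N′ ⟩ ≤ ⟨ c , N ⟩)

        opaque
          second : ∃ Lex-max
          second = maximiser (λ N → isMatchingIn? w N ×-dec (_ ℕ.≤? _))
            (λ p (a , b) → isMatchingIn-ext w p a , subst (_ ≤_) (⟨,⟩-congʳ w′ p) b)
            (matching≤1 ∘ proj₁ ∘ proj₁) c (N₁ , proj₁ (proj₂ first) , ℕ.≤-refl)

        -- The edge between the two missed vertices could be added; this does not lower the
        -- `w′`-weight and raises the number of edges in `K`.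
        no-free-edge : ∀ {N x z} → Lex-max N → K x ≡ true → R x z → d G N x ≡ 0 → d G N z ≡ 0 → ∅
        no-free-edge {N} {x} {z} ((mN , top) , best) Kx r@(e , we , joins) Nx Nz = ℕ.<-irrefl refl
          (ℕ.≤-trans (ℕ.≤-reflexive (trans (ℕ.+-comm 1 _) (sym (trans (⟨,⟩-+ʳ c N (δ e)) (cong (⟨ c , N ⟩ +_) (trans (⟨,⟩-δ c e) ce))))))
            (best N+e ((add , support⊆) , ℕ.≤-trans top (subst (⟨ w′ , N ⟩ ≤_) (sym (⟨,⟩-+ʳ w′ N (δ e))) (ℕ.m≤m+n _ _)))))
          where
          N+e : E → ℕ
          N+e f = N f + δ e f
          Kz : K z ≡ true
          Kz = closed x z Kx r
          both : ∀ {a b} → a ≡ true → b ≡ true → χ (a ∧ b) ≡ 1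
          both refl refl = refl
          ce : c e ≡ 1
          ce = [ (λ (p , q) → both (trans (cong K p) Kx) (trans (cong K q) Kz)) , (λ (p , q) → both (trans (cong K q) Kz) (trans (cong K p) Kx)) ]′ joins
          add : IsMatching G N+e
          add = [ (λ (p , q) → add-edge G N (e , inj₁ p) (proj₁ mN) Nx (trans (cong (d G N) q) Nz))
                , (λ (p , q) → add-edge G N (e , inj₂ p) (proj₁ mN) Nx (trans (cong (d G N) q) Nz)) ]′ joins
          support⊆ : ∀ f → w f ≡ 0 → N+e f ≡ 0
          support⊆ f z with e ≟ f
          ... | yes refl = ⊥-elim (ℕ.<-irrefl (sym z) we)
          ... | no _     = trans (ℕ.+-identityʳ _) (proj₂ mN f z)

        -- The exchange preserves the total weight and `M` is maximum for `w`, so `N′` weighs at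
        -- least as much as `N`. Within `K` it loses `t` and gains at most `q`, so it has no more
        -- edges there. On matchings in the support, `w` splits into `w′` and `c`; hence neither
        -- part can change.
        exchange-Lex-max : ∀ {N t} → Lex-max N → K t ≡ true → d G N t ≡ 1 → ((M , _) : Missing t) →
          (X : Exchange G M N t) → Lex-max (Exchange.N′ X)
        exchange-Lex-max {N} {t} ((mN , top) , best) Kt Nt (M , (mM , opt) , _) X =
          ((mN′ , ℕ.≤-trans top N≤N′) , λ F p → ℕ.≤-trans (best F p) c≤)
          where
          open Exchange X
          support-total : ∀ e → w e ≡ 0 → M′ e + N′ e ≡ 0
          support-total e z = trans (total e) (cong₂ _+_ (proj₂ mM e z) (proj₂ mN e z))
          mM′ : IsMatchingIn w M′
          mM′ = M′-matching , λ e z → +-≡0ˡ (M′ e) (support-total e z)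
          mN′ : IsMatchingIn w N′
          mN′ = N′-matching , λ e z → +-≡0ʳ (M′ e) (support-total e z)
          w≤ : ⟨ w , N ⟩ ≤ ⟨ w , N′ ⟩
          w≤ = ℕ.+-cancelˡ-≤ ⟨ w , M ⟩ _ _ (begin
            ⟨ w , M ⟩ + ⟨ w , N ⟩     ≡⟨ ⟨,⟩-+ʳ w M N ⟨
            ⟨ w , (λ e → M e + N e) ⟩ ≡⟨ ⟨,⟩-congʳ w total ⟨
            ⟨ w , (λ e → M′ e + N′ e) ⟩ ≡⟨ ⟨,⟩-+ʳ w M′ N′ ⟩
            ⟨ w , M′ ⟩ + ⟨ w , N′ ⟩   ≤⟨ ℕ.+-monoˡ-≤ _ (ℕ.≤-trans (proj₂ (proj₂ maximum) M′ mM′) opt) ⟩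
            ⟨ w , M ⟩ + ⟨ w , N′ ⟩    ∎)
            where open ℕ.≤-Reasoning
          pointwise : ∀ v → χ (K v) * d G N′ v + χ (t == v) ≤ χ (K v) * d G N v + χ (q == v)
          pointwise v with t ≟ v
          ... | yes refl rewrite Kt | Nt | N′-at-t = s≤s z≤n
          ... | no t≢v with q ≟ v
          ... | no q≢v rewrite N′-other v (t≢v ∘ sym) (q≢v ∘ sym) = ℕ.≤-refl
          ... | yes refl = ℕ.≤-trans (ℕ.≤-trans (ℕ.≤-reflexive (ℕ.+-identityʳ _)) (ℕ.*-mono-≤ (χ≤1 (K v)) (N′-matching v))) (ℕ.m≤n+m 1 _)
          c′≤ : ⟨ c , N′ ⟩ ≤ ⟨ c , N ⟩
          c′≤ = ℕ.*-cancelˡ-≤ 2 (subst₂ _≤_ (K-volume mN′) (K-volume mN) (ℕ.+-cancelʳ-≤ 1 _ _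
            (subst₂ _≤_ (trans (∑-+ _ _) (cong (∑ (λ v → χ (K v) * d G N′ v) +_) (∑-point t)))
              (trans (∑-+ _ _) (cong (∑ (λ v → χ (K v) * d G N v) +_) (∑-point q))) (∑-mono pointwise))))
          w≤″ : ⟨ w′ , N ⟩ + ⟨ c , N ⟩ ≤ ⟨ w′ , N′ ⟩ + ⟨ c , N′ ⟩
          w≤″ = subst₂ _≤_ (split mN) (split mN′) w≤
          N≤N′ : ⟨ w′ , N ⟩ ≤ ⟨ w′ , N′ ⟩
          N≤N′ = ℕ.+-cancelʳ-≤ ⟨ c , N ⟩ _ _ (ℕ.≤-trans w≤″ (ℕ.+-monoʳ-≤ _ c′≤))
          c≤ : ⟨ c , N ⟩ ≤ ⟨ c , N′ ⟩
          c≤ = ℕ.+-cancelˡ-≤ ⟨ w′ , N ⟩ _ _ (ℕ.≤-trans w≤″ (ℕ.+-monoˡ-≤ _ (ℕ.≤-trans (proj₂ (proj₂ first) N′ mN′) top)))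

        -- Gallai's lemma: "no Lex-max matching misses both" is a transitive relation.
        gallai : ∀ {x z} → Star R x z → K x ≡ true → x ≢ z → ∀ {N} → Lex-max N → d G N x ≡ 0 → d G N z ≡ 0 → ∅
        gallai ε Kx x≢z lN Nx Nz = x≢z refl
        gallai {x} {z} (_◅_ {j = t} r rs) Kx x≢z {N} lN Nx Nz with ≤1-cases (proj₁ (proj₁ (proj₁ lN)) t)
        ... | inj₁ Nt = no-free-edge lN Kx r Nx Nt
        ... | inj₂ Nt = decide (x ≟ q)
          where
          M : E → ℕ
          M = proj₁ (missing t)
          X : Exchange G M N t
          X = exchange G _ M N t ℕ.≤-refl (proj₁ (proj₁ (proj₁ (proj₂ (missing t))))) (proj₁ (proj₁ (proj₁ lN))) (proj₂ (proj₂ (missing t)))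
          open Exchange X
          Kt : K t ≡ true
          Kt = closed x t Kx r
          lN′ : Lex-max N′
          lN′ = exchange-Lex-max lN Kt Nt (missing t) X
          covered≢ : ∀ {v} → d G N v ≡ 0 → v ≢ t
          covered≢ Nv refl = case trans (sym Nv) Nt of λ ()
          decide : Dec (x ≡ q) → ∅
          -- `N′` misses `t`; if the path does not end at `x`, it still misses `x`, which is joined
          -- to `t`.
          decide (no x≢q)   = no-free-edge lN′ Kx r (trans (N′-other x (covered≢ Nx) x≢q) Nx) N′-at-t
          -- The path ends at `x`, so `N′` still misses `z`, and the walk from `t` to `z` is
          -- shorter.
          decide (yes refl) = gallai rs Kt (covered≢ Nz ∘ sym) lN′ N′-at-t (trans (N′-other z (covered≢ Nz) (x≢z ∘ sym)) Nz)

        N : E → ℕ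
        N = proj₁ second

        mN : IsMatchingIn w N
        mN = proj₁ (proj₁ (proj₂ second))

        near-perfect : ∑ (χ ∘ K) ≤ suc (2 * ⟨ c , N ⟩)
        near-perfect with any? (λ v → (K v Bool.≟ true) ×-dec (d G N v ℕ.≟ 0))
        ... | no none = ℕ.≤-trans (subst (∑ (χ ∘ K) ≤_) (K-volume mN) (∑-mono pointwise)) (ℕ.n≤1+n _)
          where
          pointwise : ∀ v → χ (K v) ≤ χ (K v) * d G N v
          pointwise v with K v in eq
          ... | false = z≤n
          ... | true  = subst (1 ≤_) (sym (ℕ.+-identityʳ _)) (ℕ.n≢0⇒n>0 λ z → none (v , eq , z))
        ... | yes (v₀ , Kv₀ , Nv₀) = subst (∑ (χ ∘ K) ≤_)
                (trans (∑-+ _ _) (trans (cong₂ _+_ (K-volume mN) (∑-point v₀)) (ℕ.+-comm _ 1))) (∑-mono pointwise)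
          where
          path : ∀ v → K v ≡ true → Star R v₀ v
          path v Kv = reverse R-sym (proj₁ (proj₂ (proj₂ comp)) v₀ Kv₀) ◅◅ proj₁ (proj₂ (proj₂ comp)) v Kv
          pointwise : ∀ v → χ (K v) ≤ χ (K v) * d G N v + χ (v₀ == v)
          pointwise v with v₀ ≟ v
          ... | yes refl = ℕ.≤-trans (χ≤1 (K v)) (ℕ.m≤n+m 1 _)
          ... | no  v₀≢v with K v in eq
          ... | false = z≤n
          ... | true  = ℕ.≤-trans (ℕ.n≢0⇒n>0 λ z → gallai (path v eq) Kv₀ v₀≢v (proj₂ second) Nv₀ z)
                          (ℕ.≤-reflexive (sym (trans (ℕ.+-identityʳ _) (ℕ.+-identityʳ _))))

        extend : DualityFor w′ → DualityFor w
        extend (M′ , mM′ , D , le) = N , mN ,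
          record { y = y ; U = K Vector.∷ U ; h = ⟨ c , N ⟩ Vector.∷ h ; size = size′ ; covers = covers′ } ,
          (begin
            ∑ y + ∑ (⟨ c , N ⟩ Vector.∷ h) ≡⟨ cong (∑ y +_) (∑-∷ _) ⟩
            ∑ y + (⟨ c , N ⟩ + ∑ h)        ≡⟨ move (∑ y) ⟨ c , N ⟩ (∑ h) ⟩
            ∑ y + ∑ h + ⟨ c , N ⟩          ≤⟨ ℕ.+-monoˡ-≤ _ (ℕ.≤-trans le (ℕ.≤-trans (proj₂ (proj₂ first) M′ mM) (proj₂ (proj₁ (proj₂ second))))) ⟩
            ⟨ w′ , N ⟩ + ⟨ c , N ⟩         ≡⟨ split mN ⟨
            ⟨ w , N ⟩                      ∎)
          where
          open Dual D
          open ℕ.≤-Reasoning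
          move : ∀ a b c → a + (b + c) ≡ a + c + b
          move = solve-∀
          mM : IsMatchingIn w M′
          mM = proj₁ mM′ , λ e z → proj₂ mM′ e (trans (cong (_∸ c e) z) (ℕ.0∸n≡0 (c e)))
          size′ : ∀ i → ∑ (χ ∘ (K Vector.∷ U) i) ≤ suc (2 * (⟨ c , N ⟩ Vector.∷ h) i)
          size′ zero    = near-perfect
          size′ (suc i) = size i
          covers′ : ∀ e → w e ≤ y (src G e) + y (tgt G e) + ∑ (λ i → ins G ((K Vector.∷ U) i) e)
          covers′ e = begin
            w e         ≤⟨ ℕ.m≤n+m∸n (w e) (c e) ⟩
            c e + w′ e  ≤⟨ ℕ.+-monoʳ-≤ (c e) (covers e) ⟩
            c e + (y (src G e) + y (tgt G e) + ∑ (λ i → ins G (U i) e)) ≡⟨ move′ (c e) (y (src G e) + y (tgt G e)) _ ⟩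
            y (src G e) + y (tgt G e) + (c e + ∑ (λ i → ins G (U i) e)) ≡⟨ cong (y (src G e) + y (tgt G e) +_) (∑-∷ (λ i → ins G ((K Vector.∷ U) i) e)) ⟨
            y (src G e) + y (tgt G e) + ∑ (λ i → ins G ((K Vector.∷ U) i) e) ∎
            where
            move′ : ∀ a b c → a + (b + c) ≡ b + (a + c)
            move′ = solve-∀

    -- Weight moves into the dual: onto a vertex that every maximum matching covers, or, if there is
    -- no such vertex, onto a whole component. Either way the total weight drops.
    duality-step : (∀ w′ → ∑ w′ < ∑ w → DualityFor w′) → DualityFor w
    duality-step rec with any? (λ e → 1 ℕ.≤? w e)
    ... | no none = (λ _ → 0) , empty-matching w ,
            record { y = λ _ → 0 ; U = λ () ; h = λ () ; size = λ () ; covers = λ e → ℕ.≤-trans (ℕ.≮⇒≥ λ p → none (e , p)) z≤n } ,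
            ℕ.≤-trans (ℕ.≤-reflexive (cong₂ _+_ (∑-zero λ _ → refl) (∑-[] _))) z≤n
    ... | yes (e₀ , we₀) with any? (λ u → ¬? (missing? u))
    ... | yes (u , covered) = let open CoveredVertex u covered in extend (rec w′ decreases)
    ... | no none = let open AllMissing (λ u → decidable-stable (missing? u) λ p → none (u , p)) e₀ we₀
                    in extend (rec w′ decreases)

  opaque
    duality : ∀ w → DualityFor w
    duality w = bounded (∑ w) w ℕ.≤-refl
      where
      bounded : ∀ fuel w → ∑ w ≤ fuel → DualityFor w
      bounded zero       w le = duality-step w λ w′ lt → case ℕ.<-≤-trans lt le of λ ()
      bounded (suc fuel) w le = duality-step w λ w′ lt → bounded fuel w′ (ℕ.≤-pred (ℕ.<-≤-trans lt le))

-- Perfect matchings and barriers of cubic graphs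

one : Fin k → ℕ
one _ = 1

⟨one,⟩ : (F : Fin k → ℕ) → ⟨ one , F ⟩ ≡ ∑ F
⟨one,⟩ F = ∑-cong λ e → ℕ.+-identityʳ (F e)

∑-all : {X : Fin k → Bool} → (∀ v → X v ≡ true) → ∑ (χ ∘ X) ≡ k
∑-all {k} p = trans (∑-cong λ v → cong χ (p v)) (∑-one k)

all-or-some : (X : Fin k → Bool) → (∀ v → X v ≡ true) ⊎ (∃ λ v → X v ≡ false)
all-or-some X with any? (λ v → X v Bool.≟ false)
... | yes p = inj₂ p
... | no  p = inj₁ λ v → Bool.¬-not λ q → p (v , q)

another-member : (X : Fin k → Bool) → 2 ≤ ∑ (χ ∘ X) → ∀ p → ∃ λ q → X q ≡ true × p ≢ q
another-member X le p with any? (λ q → (X q Bool.≟ true) ×-dec ¬? (p ≟ q))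
... | yes w   = w
... | no none = ⊥-elim (ℕ.<-irrefl refl (ℕ.≤-trans le (ℕ.≤-trans (∑-mono only) (ℕ.≤-reflexive (∑-point p)))))
  where
  only : ∀ q → χ (X q) ≤ χ (p == q)
  only q with X q in Xq | p ≟ q
  ... | false | _     = z≤n
  ... | true  | yes _ = s≤s z≤n
  ... | true  | no ne = ⊥-elim (none (q , Xq , ne))

half : ∀ a → ∃ λ b → a ≡ 2 * b ⊎ a ≡ suc (2 * b)
half zero    = 0 , inj₁ refl
half (suc a) with half a
... | b , inj₁ refl = b , inj₂ refl
... | b , inj₂ refl = suc b , inj₁ (sym (ℕ.*-suc 2 b))

module _ (G : Graph) where
  open Graph G

  IsThreeRegular IsThreeEdgeConnected : Set
  IsThreeRegular = ∀ v → d G one v ≡ 3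
  IsThreeEdgeConnected = ∀ X → (∃ λ x → X x ≡ true) → (∃ λ z → X z ≡ false) → 3 ≤ ⟨ one , cut G X ⟩

  ∑-degrees : ∀ F → ∑ (d G F) ≡ 2 * ∑ F
  ∑-degrees F = trans (∑-cong λ v → sym (ℕ.+-identityʳ _)) (trans (handshake G (λ _ → 1) F)
    (trans (∑-cong λ e → ℕ.*-comm (F e) 2) (∑-*ˡ 2 F)))

  cut-all : ∀ {X} → (∀ v → X v ≡ true) → ∀ e → cut G X e ≡ 0
  cut-all p e rewrite p (src G e) | p (tgt G e) = refl

  module Cubic (cubic : IsThreeRegular) where

    cubic-weight : ∀ y → ∑ (λ v → y v * d G one v) ≡ 3 * ∑ y
    cubic-weight y = trans (∑-cong λ v → trans (cong (y v *_) (cubic v)) (ℕ.*-comm (y v) 3)) (∑-*ˡ 3 y)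

    cubic-volume : ∀ X → 3 * ∑ (χ ∘ X) ≡ 2 * ⟨ one , ins G X ⟩ + ⟨ one , cut G X ⟩
    cubic-volume X = trans (sym (cubic-weight (χ ∘ X))) (volume G X one)

    3n≡2m : 3 * n ≡ 2 * m
    3n≡2m = trans (trans (cong (3 *_) (sym (∑-one n))) (sym (trans (∑-cong cubic) (trans (∑-cong λ _ → sym (ℕ.*-identityʳ 3)) (∑-*ˡ 3 _)))))
      (trans (∑-degrees one) (cong (2 *_) (∑-one m)))

    even-order : ∃ λ b → n ≡ 2 * b
    even-order with half n
    ... | b , inj₁ eq = b , eq
    ... | b , inj₂ eq = ⊥-elim (even≢odd m (3 * b + 1) (trans (sym 3n≡2m) (trans (cong (3 *_) eq) (expand b))))
      where
      expand : ∀ b → 3 * suc (2 * b) ≡ suc (2 * (3 * b + 1))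
      expand = solve-∀

    edge-at : ∀ v → E[∂ v ]
    edge-at v = proj₁ (d-positive G one v (subst (1 ≤_) (sym (cubic v)) (s≤s z≤n)))

    module ThreeConnected (3ec : IsThreeEdgeConnected) where

      -- This says that the uniform vector 1/3 satisfies the odd set inequalities of the matching
      -- polytope. For `|X| ≤ 2h` the degree sum suffices. For `|X| = 2h + 1` three of the
      -- `3 (2h + 1)` edge ends at least belong to the cut; the full vertex set cannot have odd
      -- size.
      ins-bound : ∀ X h → ∑ (χ ∘ X) ≤ suc (2 * h) → ⟨ one , ins G X ⟩ ≤ 3 * h
      ins-bound X h le with ℕ.m≤n⇒m<n∨m≡n le
      ... | inj₁ lt = even-case (cubic-volume X) (ℕ.≤-pred lt)
        where
        even-case : ∀ {u i c} → 3 * u ≡ 2 * i + c → u ≤ 2 * h → i ≤ 3 * h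
        even-case {u} {i} {c} eq le = ℕ.*-cancelˡ-≤ 2 (ℕ.≤-trans (ℕ.m≤m+n (2 * i) c) (ℕ.≤-trans (ℕ.≤-reflexive (sym eq))
          (ℕ.≤-trans (ℕ.*-monoʳ-≤ 3 le) (ℕ.≤-reflexive (swap h)))))
          where
          swap : ∀ h → 3 * (2 * h) ≡ 2 * (3 * h)
          swap = solve-∀
      ... | inj₂ eq with all-or-some X
      ... | inj₁ all = ⊥-elim (even≢odd ⟨ one , ins G X ⟩ (3 * h + 1) (trans (sym (ℕ.+-identityʳ _)) (trans
              (cong (2 * ⟨ one , ins G X ⟩ +_) (sym (∑-zero {f = λ e → 1 * cut G X e} λ e → trans (ℕ.+-identityʳ _) (cut-all all e))))
              (trans (sym (cubic-volume X)) (trans (cong (3 *_) eq) (parity h))))))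
        where
        parity : ∀ h → 3 * suc (2 * h) ≡ suc (2 * (3 * h + 1))
        parity = solve-∀
      ... | inj₂ out = odd-case (trans (cong (3 *_) (sym eq)) (cubic-volume X))
              (3ec X (let x , p = ∑-positive (χ ∘ X) (subst (1 ≤_) (sym eq) (s≤s z≤n)) in x , χ-true p) out)
        where
        odd-case : ∀ {i c} → 3 * suc (2 * h) ≡ 2 * i + c → 3 ≤ c → i ≤ 3 * h
        odd-case {i} {c} eq le = ℕ.*-cancelˡ-≤ 2 (ℕ.+-cancelʳ-≤ 3 _ _ (ℕ.≤-trans (ℕ.+-monoʳ-≤ (2 * i) le)
          (ℕ.≤-reflexive (trans (sym eq) (expand h)))))
          where
          expand : ∀ h → 3 * suc (2 * h) ≡ 2 * (3 * h) + 3
          expand = solve-∀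

      module _ {w} (D : Dual G w) where
        open Dual D

        coverage : E → ℕ
        coverage e = y (src G e) + y (tgt G e) + ∑ (λ i → ins G (U i) e)

        ∑-coverage : ∑ coverage ≡ 3 * ∑ y + ∑ (λ i → ⟨ one , ins G (U i) ⟩)
        ∑-coverage = trans (∑-+ _ _) (cong₂ _+_
          (trans (trans (∑-cong λ e → sym (ℕ.+-identityʳ _)) (sym (handshake G y one))) (cubic-weight y))
          (trans (∑-swap _) (∑-cong λ i → sym (⟨one,⟩ _))))

        ∑-ins≤ : ∑ (λ i → ⟨ one , ins G (U i) ⟩) ≤ 3 * ∑ h
        ∑-ins≤ = ℕ.≤-trans (∑-mono λ i → ins-bound (U i) (h i) (size i)) (ℕ.≤-reflexive (∑-*ˡ 3 h))

        -- The dual constraints are summed over all edges: a vertex weight is counted at three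
        -- edges, a set at its at most `3 h` inner edges.
        weak-duality : ∑ w ≤ 3 * value
        weak-duality = begin
          ∑ w                       ≤⟨ ∑-mono covers ⟩
          ∑ coverage                ≡⟨ ∑-coverage ⟩
          3 * ∑ y + ∑ (λ i → ⟨ one , ins G (U i) ⟩) ≤⟨ ℕ.+-monoʳ-≤ _ ∑-ins≤ ⟩
          3 * ∑ y + 3 * ∑ h         ≡⟨ ℕ.*-distribˡ-+ 3 (∑ y) (∑ h) ⟨
          3 * value                 ∎
          where open ℕ.≤-Reasoning

      -- The uniform vector 1/3 is a fractional perfect matching, so some perfect
      -- matching does as well as 1/3 on C; the summand n + 1 forces perfection.
      opaque
        perfect-matching : (C : E → ℕ) → (∀ e → C e ≤ 1) → ∃ λ M → (∀ v → d G M v ≡ 1) × ∑ C ≤ 3 * ⟨ C , M ⟩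
        perfect-matching C C≤1 = M , perfect , ratio (∑ C) ⟨ C , M ⟩ main (ℕ.≤-antisym 2∑M≤n 2∑M≥n)
          where
          w : E → ℕ
          w e = suc n + C e
          dual : DualityFor G w
          dual = duality G w
          M : E → ℕ
          M = proj₁ dual
          mM : IsMatching G M
          mM = proj₁ (proj₁ (proj₂ dual))
          2∑M≤n : 2 * ∑ M ≤ n
          2∑M≤n = subst₂ _≤_ (∑-degrees M) (∑-one n) (∑-mono mM)
          ∑w : ∑ w ≡ suc n * m + ∑ C
          ∑w = trans (∑-+ _ _) (cong (_+ ∑ C) (trans (trans (∑-cong λ _ → sym (ℕ.*-identityʳ (suc n))) (∑-*ˡ (suc n) one)) (cong (suc n *_) (∑-one m))))
          wM : ⟨ w , M ⟩ ≡ suc n * ∑ M + ⟨ C , M ⟩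
          wM = trans (∑-cong λ e → ℕ.*-distribʳ-+ (M e) (suc n) (C e)) (trans (∑-+ _ _) (cong (_+ ⟨ C , M ⟩) (∑-*ˡ (suc n) M)))
          main : suc n * m + ∑ C ≤ 3 * (suc n * ∑ M + ⟨ C , M ⟩)
          main = subst₂ _≤_ ∑w (cong (3 *_) wM) (ℕ.≤-trans (weak-duality (proj₁ (proj₂ (proj₂ dual)))) (ℕ.*-monoʳ-≤ 3 (proj₂ (proj₂ (proj₂ dual)))))
          CM≤M : ⟨ C , M ⟩ ≤ ∑ M
          CM≤M = ∑-mono λ e → ℕ.≤-trans (ℕ.*-monoˡ-≤ (M e) (C≤1 e)) (ℕ.≤-reflexive (ℕ.+-identityʳ _))
          doubled : ∀ C CM M → suc n * m + C ≤ 3 * (suc n * M + CM) → 3 * (suc n * n) + 2 * C ≤ 3 * (suc n * (2 * M)) + 6 * CM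
          doubled C CM M le = subst₂ _≤_ (trans (dist (suc n) m C) (cong (_+ 2 * C) (trans (cong (suc n *_) (sym 3n≡2m)) (pull (suc n) n)))) (dist′ (suc n) M CM) (ℕ.*-monoʳ-≤ 2 le)
            where
            dist : ∀ a b c → 2 * (a * b + c) ≡ a * (2 * b) + 2 * c
            dist = solve-∀
            pull : ∀ a b → a * (3 * b) ≡ 3 * (a * b)
            pull = solve-∀
            dist′ : ∀ a b c → 2 * (3 * (a * b + c)) ≡ 3 * (a * (2 * b)) + 6 * c
            dist′ = solve-∀
          -- A missed vertex would cost `3 (n + 1)` in the doubled inequality, while the
          -- contribution of `C` is at most `6 ∑ M`, that is, at most `3 n`.
          2∑M≥n : n ≤ 2 * ∑ M
          2∑M≥n = ℕ.≮⇒≥ λ lt → ℕ.<-irrefl refl (ℕ.<-≤-trans (s≤s 2∑M≤n) (short lt (doubled _ _ (∑ M) main)))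
            where
            short : 2 * ∑ M < n → 3 * (suc n * n) + 2 * ∑ C ≤ 3 * (suc n * (2 * ∑ M)) + 6 * ⟨ C , M ⟩ → suc n ≤ 2 * ∑ M
            short lt le = ℕ.*-cancelˡ-≤ 3 (ℕ.+-cancelˡ-≤ (3 * (suc n * (2 * ∑ M))) _ _ (begin
              3 * (suc n * (2 * ∑ M)) + 3 * suc n        ≡⟨ factor (suc n) (2 * ∑ M) ⟩
              3 * (suc n * suc (2 * ∑ M))                ≤⟨ ℕ.*-monoʳ-≤ 3 (ℕ.*-monoʳ-≤ (suc n) lt) ⟩
              3 * (suc n * n)                            ≤⟨ ℕ.m≤m+n _ _ ⟩
              3 * (suc n * n) + 2 * ∑ C                  ≤⟨ le ⟩
              3 * (suc n * (2 * ∑ M)) + 6 * ⟨ C , M ⟩    ≤⟨ ℕ.+-monoʳ-≤ (3 * (suc n * (2 * ∑ M))) (ℕ.*-monoʳ-≤ 6 CM≤M) ⟩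
              3 * (suc n * (2 * ∑ M)) + 6 * ∑ M          ≡⟨ cong (3 * (suc n * (2 * ∑ M)) +_) (six (∑ M)) ⟩
              3 * (suc n * (2 * ∑ M)) + 3 * (2 * ∑ M)    ∎))
              where
              open ℕ.≤-Reasoning
              factor : ∀ a b → 3 * (a * b) + 3 * a ≡ 3 * (a * suc b)
              factor = solve-∀
              six : ∀ a → 6 * a ≡ 3 * (2 * a)
              six = solve-∀
          perfect : ∀ v → d G M v ≡ 1
          perfect = ∑-rigid mM (subst₂ _≤_ (sym (∑-one n)) (sym (∑-degrees M)) 2∑M≥n)
          ratio : ∀ C CM → suc n * m + C ≤ 3 * (suc n * ∑ M + CM) → 2 * ∑ M ≡ n → C ≤ 3 * CM
          ratio C CM le eq = ℕ.*-cancelˡ-≤ 2 (ℕ.+-cancelˡ-≤ (3 * (suc n * n)) _ _ (subst (3 * (suc n * n) + 2 * C ≤_)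
            (cong₂ _+_ (cong (λ x → 3 * (suc n * x)) eq) (six CM)) (doubled C CM (∑ M) le)))
            where
            six : ∀ a → 6 * a ≡ 2 * (3 * a)
            six = solve-∀

does-true : {P : Set} (P? : Dec P) → does P? ≡ true → P
does-true (yes p) _ = p

-- Barriers from tight dual solutions

record Barrier (G : Graph) : Set where
  open Graph G
  field
    B : V → Bool
    -- The classes of c are the vertices of B and the components of G − B;
    -- c picks a representative of each.
    c : V → V
    c-idem    : ∀ v → c (c v) ≡ c v
    c-on-B    : ∀ v → B v ≡ true → c v ≡ v
    B-c       : ∀ v → B (c v) ≡ B v
    stable    : ∀ e → B (src G e) ≡ true → B (tgt G e) ≡ true → ∅
    together  : ∀ e → B (src G e) ≡ false → B (tgt G e) ≡ false → c (src G e) ≡ c (tgt G e)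
    class-cut : ∀ p → c p ≡ p → ⟨ one , cut G (λ v → c v == p) ⟩ ≡ 3
    -- What is recorded of the connectedness of a class. It shows that a vertex outside the barrier
    -- with all its neighbours in the barrier is a class by itself.
    alone     : ∀ v → (∀ z → c z ≡ c v → z ≡ v) ⊎ ∃ λ (e : E[∂ v ]) → c (otherEnd e) ≡ c v

module _ (G : Graph) where
  open Graph G

  d-one* : ∀ F v → d G (λ e → 1 * F e) v ≡ d G F v
  d-one* F = d-cong G λ e → ℕ.+-identityʳ (F e)

module _ (G : Graph) (cubic : IsThreeRegular G) (3ec : IsThreeEdgeConnected G) where
  open Graph G
  open Cubic G cubic
  open ThreeConnected 3ec

  private
    remove : (V → Bool) → V → V → Bool
    remove X p v = X v ∧ not (p == v)

    -- |∂(X − p)| = |∂X| + (edges from p into X) − (edges from p out of X).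
    cut-remove : ∀ X p → X p ≡ true →
      ⟨ one , cut G (remove X p) ⟩ + d G (cut G X) p ≡ ⟨ one , cut G X ⟩ + d G (ins G X) p
    cut-remove X p Xp = trans (sym (∑-+ _ _)) (trans (∑-cong λ e → pointwise e) (∑-+ _ _))
      where
      pointwise : ∀ e → 1 * cut G (remove X p) e + cut G X e * inc G e p ≡ 1 * cut G X e + ins G X e * inc G e p
      pointwise e with src G e ≟ p | tgt G e ≟ p
      ... | yes a | yes b = ⊥-elim (loopless e (trans a (sym b)))
      ... | yes refl | no b rewrite ==-refl p | ==-≢ (b ∘ sym) | Xp with X (tgt G e)
      ... | true  = refl
      ... | false = refl
      pointwise e | no a | yes refl rewrite ==-refl p | ==-≢ (a ∘ sym) | Xp with X (src G e)
      ... | true  = refl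
      ... | false = refl
      pointwise e | no a | no b rewrite ==-≢ (a ∘ sym) | ==-≢ (b ∘ sym) with X (src G e) | X (tgt G e)
      ... | true  | true  = refl
      ... | true  | false = refl
      ... | false | true  = refl
      ... | false | false = refl

    ins+cut : ∀ X p → X p ≡ true → d G (ins G X) p + d G (cut G X) p ≡ 3
    ins+cut X p Xp = trans (sym (d-+ G (ins G X) (cut G X) p)) (trans (∑-cong λ e → pointwise e) (cubic p))
      where
      pointwise : ∀ e → (ins G X e + cut G X e) * inc G e p ≡ 1 * inc G e p
      pointwise e with src G e ≟ p | tgt G e ≟ p
      ... | no _     | no _ = ℕ.*-zeroʳ (ins G X e + cut G X e)
      ... | yes a    | yes b = ⊥-elim (loopless e (trans a (sym b)))
      ... | yes refl | no _ rewrite Xp with X (tgt G e)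
      ... | true  = refl
      ... | false = refl
      pointwise e | no _ | yes refl rewrite Xp with X (src G e)
      ... | true  = refl
      ... | false = refl

  module _ {X p q} (cut3 : ⟨ one , cut G X ⟩ ≡ 3) (Xp : X p ≡ true) (Xq : X q ≡ true) (p≢q : p ≢ q) where

    private
      cut≤ins : d G (cut G X) p ≤ d G (ins G X) p
      cut≤ins = ℕ.+-cancelˡ-≤ 3 _ _ (ℕ.≤-trans (ℕ.+-monoˡ-≤ _ (3ec (remove X p) (q , in-q) (p , out-p)))
        (ℕ.≤-reflexive (trans (cut-remove X p Xp) (cong (_+ d G (ins G X) p) cut3))))
        where
        in-q : remove X p q ≡ true
        in-q rewrite Xq | ==-≢ p≢q = refl
        out-p : remove X p p ≡ false
        out-p rewrite Xp | ==-refl p = refl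

    -- Moving `p` out of `X` replaces its edges in the cut by its inner edges. The shore keeps `q`,
    -- so the new cut also has at least three edges, and the cut edges at `p` are a minority of
    -- three.
    cut-degree≤1 : d G (cut G X) p ≤ 1
    cut-degree≤1 = small (ins+cut X p Xp) cut≤ins
      where
      small : ∀ {a b} → a + b ≡ 3 → b ≤ a → b ≤ 1
      small {b = zero}  _ _ = z≤n
      small {b = suc zero} _ _ = s≤s z≤n
      small {a} {suc (suc b)} eq le = ⊥-elim (ℕ.<-irrefl (sym eq) (ℕ.+-mono-≤ (ℕ.≤-trans (s≤s (s≤s z≤n)) le) (s≤s (s≤s z≤n))))

    ins-degree≥2 : 2 ≤ d G (ins G X) p
    ins-degree≥2 = ℕ.+-cancelʳ-≤ 1 _ _ (ℕ.≤-trans (ℕ.≤-reflexive (sym (ins+cut X p Xp))) (ℕ.+-monoʳ-≤ _ cut-degree≤1))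

  module _ (D : Dual G one) (tight : 2 * Dual.value D ≤ n) (v₀ : V) (y₀ : 1 ≤ Dual.y D v₀) where
    open Dual D

    private
      I : Fin r → ℕ
      I i = ⟨ one , ins G (U i) ⟩

      2m≥ : 2 * (3 * ∑ y + 3 * ∑ h) ≤ 2 * m
      2m≥ = subst₂ _≤_ (swap (∑ y) (∑ h)) 3n≡2m (ℕ.*-monoʳ-≤ 3 tight)
        where
        swap : ∀ a b → 3 * (2 * (a + b)) ≡ 2 * (3 * a + 3 * b)
        swap = solve-∀

      total≤m : 3 * ∑ y + 3 * ∑ h ≤ m
      total≤m = ℕ.*-cancelˡ-≤ 2 2m≥

      m≤coverage : m ≤ 3 * ∑ y + ∑ I
      m≤coverage = subst₂ _≤_ (∑-one m) (∑-coverage D) (∑-mono covers)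

      -- Complementary slackness: the value is at most `n / 2`, which is a third of `m`, so weak
      -- duality holds with equality throughout. Here this is read off edge by edge, in `I≡3h` set
      -- by set.
      exact : ∀ e → 1 ≡ coverage D e
      exact = ∑-rigid covers (ℕ.≤-trans (ℕ.≤-reflexive (∑-coverage D))
        (ℕ.≤-trans (ℕ.+-monoʳ-≤ (3 * ∑ y) (∑-ins≤ D)) (ℕ.≤-trans total≤m (ℕ.≤-reflexive (sym (∑-one m))))))

      I≡3h : ∀ i → I i ≡ 3 * h i
      I≡3h = ∑-rigid (λ i → ins-bound (U i) (h i) (size i))
        (ℕ.≤-trans (ℕ.≤-reflexive (∑-*ˡ 3 h)) (ℕ.+-cancelˡ-≤ (3 * ∑ y) _ _ (ℕ.≤-trans total≤m m≤coverage)))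

      at-end : ∀ {e v} → Incident e v → y v ≤ y (src G e) + y (tgt G e)
      at-end (inj₁ refl) = ℕ.m≤m+n _ _
      at-end (inj₂ refl) = ℕ.m≤n+m _ _

      -- A set with `h i = 0` has at most one vertex and no inner edge; the others are the classes
      -- with more than one vertex.
      Proper : Fin r → V → Set
      Proper i v = 1 ≤ h i × U i v ≡ true

      d-coverage : ∀ v → d G (coverage D) v ≡ 3
      d-coverage v = trans (d-cong G (sym ∘ exact) v) (cubic v)

      -- If `U i` were everything, an edge at `v₀` would be covered twice, by `y v₀` and by `U i`.
      not-all : ∀ i → ∃ λ v → U i v ≡ false
      not-all i with all-or-some (U i)
      ... | inj₂ p   = p
      ... | inj₁ all = ⊥-elim (ℕ.<-irrefl (exact e) (ℕ.+-mono-≤ (ℕ.≤-trans y₀ (at-end (proj₂ (edge-at v₀))))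
              (ℕ.≤-trans (ℕ.≤-reflexive (sym ins≡1)) (term≤∑ (λ i → ins G (U i) e) i))))
        where
        e : E
        e = proj₁ (edge-at v₀)
        ins≡1 : ins G (U i) e ≡ 1
        ins≡1 rewrite all (src G e) | all (tgt G e) = refl

      module _ {i} (h≥1 : 1 ≤ h i) where

        cut≡3 : ⟨ one , cut G (U i) ⟩ ≡ 3
        cut≡3 = ℕ.≤-antisym upper (3ec (U i) nonempty (not-all i))
          where
          eq : 3 * ∑ (χ ∘ U i) ≡ 2 * (3 * h i) + ⟨ one , cut G (U i) ⟩
          eq = trans (cubic-volume (U i)) (cong (λ x → 2 * x + ⟨ one , cut G (U i) ⟩) (I≡3h i))
          upper : ⟨ one , cut G (U i) ⟩ ≤ 3
          upper = ℕ.+-cancelˡ-≤ (2 * (3 * h i)) _ _ (ℕ.≤-trans (ℕ.≤-reflexive (sym eq)) (ℕ.≤-trans (ℕ.*-monoʳ-≤ 3 (size i)) (ℕ.≤-reflexive (expand (h i)))))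
            where
            expand : ∀ h → 3 * suc (2 * h) ≡ 2 * (3 * h) + 3
            expand = solve-∀
          nonempty : ∃ λ v → U i v ≡ true
          nonempty = let v , p = ∑-positive (χ ∘ U i) (ℕ.n≢0⇒n>0 λ z → empty (trans (cong (3 *_) (sym z)) eq)) in v , χ-true p
            where
            empty : 0 ≡ 2 * (3 * h i) + ⟨ one , cut G (U i) ⟩ → ∅
            empty p = ℕ.<-irrefl p (ℕ.<-≤-trans (ℕ.*-monoʳ-< 2 (ℕ.*-monoʳ-< 3 h≥1)) (ℕ.m≤m+n _ _))

        second : ∀ p → ∃ λ q → U i q ≡ true × p ≢ q
        second = another-member (U i) three≤
          where
          three≤ : 2 ≤ ∑ (χ ∘ U i)
          three≤ = ℕ.*-cancelˡ-≤ 3 (ℕ.≤-trans (ℕ.≤-trans (ℕ.*-monoʳ-≤ 6 h≥1) (ℕ.≤-reflexive (ℕ.*-assoc 2 3 (h i))))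
            (ℕ.≤-trans (ℕ.m≤m+n _ ⟨ one , cut G (U i) ⟩)
              (ℕ.≤-reflexive (sym (trans (cubic-volume (U i)) (cong (λ x → 2 * x + ⟨ one , cut G (U i) ⟩) (I≡3h i)))))))

      interior : ∀ {i v} → Proper i v → 2 ≤ d G (ins G (U i)) v
      interior {i} {v} (h≥1 , Uv) = let q , Uq , ne = second h≥1 v in ins-degree≥2 {U i} (cut≡3 h≥1) Uv Uq ne

      -- A common vertex has two inner edges in each of the two sets, hence a coverage of at least
      -- four at its three edges, each of which is covered once.
      unique : ∀ {i j v} → Proper i v → Proper j v → i ≡ j
      unique {i} {j} {v} pi pj with i ≟ j
      ... | yes eq = eq
      ... | no  ne = ⊥-elim (ℕ.<-irrefl refl (ℕ.≤-trans (ℕ.+-mono-≤ (interior pi) (interior pj))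
              (ℕ.≤-trans (ℕ.≤-reflexive (sym (d-+ G (ins G (U i)) (ins G (U j)) v)))
                (ℕ.≤-trans (d-mono G {F′ = coverage D} (λ e → ℕ.≤-trans (two-terms≤∑ (λ i → ins G (U i) e) ne) (ℕ.m≤n+m _ _)) v) (ℕ.≤-reflexive (d-coverage v))))))

      -- A positive `y v` alone covers the three edges at `v`, and two of them are covered by `U i`
      -- again.
      proper⇒y≡0 : ∀ {i v} → Proper i v → 1 ≤ y v → ∅
      proper⇒y≡0 {i} {v} p y≥1 = ℕ.<-irrefl refl (ℕ.≤-trans (s≤s (s≤s (s≤s (s≤s (z≤n {1})))))
        (ℕ.≤-trans (ℕ.+-mono-≤ (ℕ.≤-reflexive (sym (cubic v))) (interior p))
          (ℕ.≤-trans (ℕ.≤-reflexive (sym (∑-+ _ _))) (ℕ.≤-trans (∑-mono pointwise) (ℕ.≤-reflexive (d-coverage v))))))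
        where
        pointwise : ∀ e → 1 * inc G e v + ins G (U i) e * inc G e v ≤ coverage D e * inc G e v
        pointwise e = ℕ.≤-trans (ℕ.≤-reflexive (sym (ℕ.*-distribʳ-+ (inc G e v) 1 (ins G (U i) e)))) at
          where
          at : (1 + ins G (U i) e) * inc G e v ≤ coverage D e * inc G e v
          at with inc G e v ℕ.≟ 0
          ... | yes z rewrite z | ℕ.*-zeroʳ (ins G (U i) e) = z≤n
          ... | no nz = ℕ.*-monoˡ-≤ (inc G e v) (ℕ.+-mono-≤ (ℕ.≤-trans y≥1 (at-end (inc⇒Incident G nz))) (term≤∑ (λ i → ins G (U i) e) i))

      proper? : ∀ v → Dec (∃ λ i → Proper i v)
      proper? v = any? λ i → (1 ℕ.≤? h i) ×-dec (U i v Bool.≟ true)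

      -- A vertex of U i chosen independently of v.
      root : ∀ i → V → V
      root i v with any? (λ z → U i z Bool.≟ true)
      ... | yes (z , _) = z
      ... | no _        = v

      root-∈ : ∀ {i v} → U i v ≡ true → U i (root i v) ≡ true
      root-∈ {i} {v} p with any? (λ z → U i z Bool.≟ true)
      ... | yes (_ , q) = q
      ... | no none     = ⊥-elim (none (v , p))

      root-const : ∀ {i v z} → U i v ≡ true → root i v ≡ root i z
      root-const {i} {v} p with any? (λ z → U i z Bool.≟ true)
      ... | yes _   = refl
      ... | no none = ⊥-elim (none (v , p))

      rep : ∀ v → Dec (∃ λ i → Proper i v) → V
      rep v (yes (i , _)) = root i v
      rep v (no _)        = v

      c : V → V
      c v = rep v (proper? v)

      c-proper : ∀ {i v} → Proper i v → c v ≡ root i v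
      c-proper {i} {v} p with proper? v
      ... | yes (j , q) = cong (λ k → root k v) (unique q p)
      ... | no none     = ⊥-elim (none (i , p))

      c-trivial : ∀ {v} → ¬ (∃ λ i → Proper i v) → c v ≡ v
      c-trivial {v} none with proper? v
      ... | yes p = ⊥-elim (none p)
      ... | no _  = refl

      proper-c : ∀ {i v} → Proper i v → Proper i (c v)
      proper-c {i} p@(a , b) = a , trans (cong (U i) (c-proper p)) (root-∈ b)

      proper-c⁻ : ∀ {i v} → Proper i (c v) → Proper i v
      proper-c⁻ {i} {v} p with proper? v
      ... | no none = p
      ... | yes (j , q) with unique p (proj₁ q , root-∈ (proj₂ q))
      ... | refl = q

      same-class : ∀ {i v z} → Proper i v → Proper i z → c v ≡ c z
      same-class p q = trans (c-proper p) (trans (root-const (proj₂ p)) (sym (c-proper q)))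

      B : V → Bool
      B v = does (1 ℕ.≤? y v)

      B-true : ∀ {v} → B v ≡ true → 1 ≤ y v
      B-true {v} = does-true (1 ℕ.≤? y v)

      B-false : ∀ {v} → B v ≡ false → y v ≡ 0
      B-false {v} p with y v
      ... | zero = refl

      class-cut : ∀ p → c p ≡ p → ⟨ one , cut G (λ v → c v == p) ⟩ ≡ 3
      class-cut p cp with proper? p
      ... | yes (i , q) = trans (∑-cong λ e → cong₂ (λ a b → 1 * χ (a xor b)) (members (src G e)) (members (tgt G e))) (cut≡3 (proj₁ q))
        where
        members : ∀ v → (c v == p) ≡ U i v
        members v with c v ≟ p | U i v in eq
        ... | yes _ | true  = refl
        ... | no _  | false = refl
        ... | yes a | false = case trans (sym eq) (proj₂ (proper-c⁻ {i} {v} (subst (Proper i) (sym a) q))) of λ ()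
        ... | no  a | true  = ⊥-elim (a (trans (same-class {i} (proj₁ q , eq) q) (trans (c-proper q) cp)))
      ... | no none = trans (∑-cong λ e → trans (ℕ.+-identityʳ _) (trans (cong₂ (λ a b → χ (a xor b)) (members (src G e)) (members (tgt G e))) (xor-inc e)))
                        (trans (∑-cong λ e → sym (ℕ.+-identityʳ _)) (cubic p))
        where
        members : ∀ v → (c v == p) ≡ (v == p)
        members v with c v ≟ p | v ≟ p
        ... | yes _ | yes _ = refl
        ... | no _  | no _  = refl
        ... | no a  | yes refl = ⊥-elim (a (c-trivial none))
        ... | yes a | no b with proper? v
        ... | yes (i , q) = ⊥-elim (none (i , subst (Proper i) a (proj₁ q , root-∈ (proj₂ q))))
        ... | no _ = ⊥-elim (b a)
        xor-inc : ∀ e → χ ((src G e == p) xor (tgt G e == p)) ≡ inc G e p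
        xor-inc e with src G e ≟ p | tgt G e ≟ p
        ... | yes a | yes b = ⊥-elim (loopless e (trans a (sym b)))
        ... | yes _ | no _  = refl
        ... | no _  | yes _ = refl
        ... | no _  | no _  = refl

      alone : ∀ v → (∀ z → c z ≡ c v → z ≡ v) ⊎ ∃ λ (e : E[∂ v ]) → c (otherEnd e) ≡ c v
      alone v = decide (proper? v)
        where
        decide : Dec (∃ λ i → Proper i v) → (∀ z → c z ≡ c v → z ≡ v) ⊎ ∃ λ (e : E[∂ v ]) → c (otherEnd e) ≡ c v
        decide (yes (i , p)) =
          let e , q = d-positive G (ins G (U i)) v (ℕ.≤-trans (s≤s z≤n) (interior p))
          in inj₂ (e , same-class (proj₁ p , other e q) p)
          where
          both : ∀ a b → 1 ≤ χ (a ∧ b) → a ≡ true × b ≡ true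
          both true true _ = refl , refl
          other : (e : E[∂ v ]) → 1 ≤ ins G (U i) (proj₁ e) → U i (otherEnd e) ≡ true
          other (e , inj₁ _) q = proj₂ (both (U i (src G e)) _ q)
          other (e , inj₂ _) q = proj₁ (both (U i (src G e)) _ q)
        decide (no none) = inj₁ λ z eq → trans (sym (c-trivial λ (i , q) → none (i , proper-c⁻ {i} {v} (subst (Proper i) eq (proper-c q)))))
          (trans eq (c-trivial none))

    opaque
      -- The barrier is the support of `y`. An edge inside it would be covered twice. An edge that
      -- avoids it owes its coverage to some `U i`, which then contains both ends and, having an
      -- inner edge, is proper.
      tight-dual⇒barrier : Σ (Barrier G) λ 𝓑 → ∀ v → 1 ≤ y v → Barrier.B 𝓑 v ≡ true
      tight-dual⇒barrier = record
        { B = B ; c = c ; c-idem = idem ; c-on-B = λ v Bv → c-trivial λ (_ , p) → proper⇒y≡0 p (B-true Bv)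
        ; B-c = B-c ; stable = stable ; together = together ; class-cut = class-cut ; alone = alone } ,
        λ v → dec-true (1 ℕ.≤? y v)
        where
        idem : ∀ v → c (c v) ≡ c v
        idem v = decide (proper? v)
          where
          decide : Dec (∃ λ i → Proper i v) → c (c v) ≡ c v
          decide (yes (i , p)) = same-class (proper-c p) p
          decide (no none)     = cong c (c-trivial none)
        B-c : ∀ v → B (c v) ≡ B v
        B-c v with proper? v
        ... | no _ = refl
        ... | yes (i , p) = trans (dec-false (1 ℕ.≤? _) (proper⇒y≡0 (proj₁ p , root-∈ (proj₂ p)))) (sym (dec-false (1 ℕ.≤? _) (proper⇒y≡0 p)))
        stable : ∀ e → B (src G e) ≡ true → B (tgt G e) ≡ true → ∅
        stable e a b = ℕ.<-irrefl (exact e) (ℕ.≤-trans (ℕ.+-mono-≤ (B-true a) (B-true b)) (ℕ.m≤m+n _ _))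
        together : ∀ e → B (src G e) ≡ false → B (tgt G e) ≡ false → c (src G e) ≡ c (tgt G e)
        together e a b =
          let i , p = ∑-positive (λ i → ins G (U i) e) (ℕ.≤-reflexive (trans (exact e) (cong (_+ ∑ (λ i → ins G (U i) e)) (cong₂ _+_ (B-false a) (B-false b)))))
              q , r = both (U i (src G e)) (U i (tgt G e)) p
              h≥1 = ℕ.n≢0⇒n>0 λ z → ℕ.<-irrefl (sym (trans (I≡3h i) (cong (3 *_) z)))
                      (ℕ.≤-trans p (ℕ.≤-trans (ℕ.≤-reflexive (sym (ℕ.+-identityʳ _))) (term≤∑ (λ e → 1 * ins G (U i) e) e)))
          in same-class {i} (h≥1 , q) (h≥1 , r)
          where
          both : ∀ a b → 1 ≤ χ (a ∧ b) → a ≡ true × b ≡ true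
          both true true _ = refl , refl

-- Barriers from missing matchings

χ-not : ∀ b → χ (not b) + χ b ≡ 1
χ-not true  = refl
χ-not false = refl

∑-not : (X : Fin k → Bool) → ∑ (χ ∘ not ∘ X) + ∑ (χ ∘ X) ≡ k
∑-not {k} X = trans (sym (∑-+ _ _)) (trans (∑-cong λ v → χ-not (X v)) (∑-one k))

∨-split : ∀ a {b} → (a ∨ b) ≡ true → a ≡ true ⊎ b ≡ true
∨-split true  p = inj₁ refl
∨-split false p = inj₂ p

∨-introʳ : ∀ a {b} → b ≡ true → (a ∨ b) ≡ true
∨-introʳ true  p = refl
∨-introʳ false p = p

pair : (x z : Fin k) → Fin k → Bool
pair x z v = (x == v) ∨ (z == v)

χ-pair : ∀ {x z : Fin k} → x ≢ z → ∀ v → χ (pair x z v) ≡ χ (x == v) + χ (z == v)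
χ-pair {x = x} {z} ne v with x ≟ v | z ≟ v
... | yes refl | yes refl = ⊥-elim (ne refl)
... | yes _ | no _  = refl
... | no _  | yes _ = refl
... | no _  | no _  = refl

∑-pair : ∀ {x z : Fin k} → x ≢ z → ∑ (χ ∘ pair x z) ≡ 2
∑-pair {x = x} {z} ne = trans (∑-cong (χ-pair ne)) (trans (∑-+ _ _) (cong₂ _+_ (∑-point x) (∑-point z)))

module _ (G : Graph) where
  open Graph G

  IsλMatching : V → (E → ℕ) → Set
  IsλMatching v F = (∀ e → F e ≤ 1) × d G F v ≡ 3 × (∀ z → z ≢ v → d G F z ≡ 1)

  star : V → E → ℕ
  star u e = inc G e u

module _ (G : Graph) (cubic : IsThreeRegular G) (3ec : IsThreeEdgeConnected G) where
  open Graph G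
  open Cubic G cubic
  open ThreeConnected 3ec

  -- The vertices of S are to stay uncovered.  Raising the dual solution by 1 on T
  -- pays for the edges that meet S, and costs at most one more than |S| / 2.
  module _ (S T : V → Bool) (s : ℕ) (∣S∣ : ∑ (χ ∘ S) ≡ 2 * s) (∣T∣ : ∑ (χ ∘ T) ≤ suc s)
           (S⇒T : ∀ e → (S (src G e) ∨ S (tgt G e)) ≡ true → (T (src G e) ∨ T (tgt G e)) ≡ true)
           (none : ¬ ∃ λ F → ∀ v → d G F v ≡ χ (not (S v))) where

    private
      w : E → ℕ
      w e = χ (not (S (src G e) ∨ S (tgt G e)))

      dual : DualityFor G w
      dual = duality G w

      M : E → ℕ
      M = proj₁ dual

      D : Dual G w
      D = proj₁ (proj₂ (proj₂ dual))

      open Dual D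

      avoids : ∀ v → d G M v ≤ χ (not (S v))
      avoids v with S v in eq
      ... | false = proj₁ (proj₁ (proj₂ dual)) v
      ... | true  = ℕ.≤-reflexive (∑-zero zero-term)
        where
        w≡0 : ∀ {e} → Incident e v → w e ≡ 0
        w≡0 (inj₁ refl) rewrite eq = refl
        w≡0 {e} (inj₂ refl) rewrite eq | Bool.∨-zeroʳ (S (src G e)) = refl
        zero-term : ∀ e → M e * inc G e v ≡ 0
        zero-term e with inc G e v ℕ.≟ 0
        ... | yes z = trans (cong (M e *_) z) (ℕ.*-zeroʳ (M e))
        ... | no nz = cong (_* inc G e v) (proj₂ (proj₁ (proj₂ dual)) e (w≡0 (inc⇒Incident G nz)))

      deficient : 2 * (∑ M + s) < n
      deficient = ℕ.≰⇒> λ le → none (M , ∑-rigid avoids (ℕ.+-cancelʳ-≤ (2 * s) _ _ (begin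
        ∑ (χ ∘ not ∘ S) + 2 * s ≡⟨ trans (cong (∑ (χ ∘ not ∘ S) +_) (sym ∣S∣)) (∑-not S) ⟩
        n                       ≤⟨ le ⟩
        2 * (∑ M + s)           ≡⟨ ℕ.*-distribˡ-+ 2 (∑ M) s ⟩
        2 * ∑ M + 2 * s         ≡⟨ cong (_+ 2 * s) (∑-degrees G M) ⟨
        ∑ (d G M) + 2 * s       ∎)))
        where open ℕ.≤-Reasoning

      y′ : V → ℕ
      y′ v = y v + χ (T v)

      covers′ : ∀ e → 1 ≤ y′ (src G e) + y′ (tgt G e) + ∑ (λ i → ins G (U i) e)
      covers′ e with S (src G e) ∨ S (tgt G e) in eq
      ... | true = ℕ.≤-trans (hit (T (src G e)) (T (tgt G e)) (S⇒T e eq)) (ℕ.≤-trans (ℕ.+-mono-≤ (ℕ.m≤n+m _ (y (src G e))) (ℕ.m≤n+m _ (y (tgt G e)))) (ℕ.m≤m+n _ _))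
        where
        hit : ∀ a b → (a ∨ b) ≡ true → 1 ≤ χ a + χ b
        hit true  b    _ = s≤s z≤n
        hit false true _ = s≤s z≤n
      ... | false = ℕ.≤-trans (ℕ.≤-reflexive (cong (χ ∘ not) (sym eq))) (ℕ.≤-trans (covers e)
              (ℕ.+-monoˡ-≤ _ (ℕ.+-mono-≤ (ℕ.m≤m+n (y (src G e)) _) (ℕ.m≤m+n (y (tgt G e)) _))))

      value≤ : 2 * (∑ y′ + ∑ h) ≤ n
      value≤ = let b , n≡2b = even-order in begin
        2 * (∑ y′ + ∑ h)               ≡⟨ cong (λ x → 2 * (x + ∑ h)) (∑-+ y (χ ∘ T)) ⟩
        2 * (∑ y + ∑ (χ ∘ T) + ∑ h)    ≡⟨ cong (2 *_) (move (∑ y) (∑ (χ ∘ T)) (∑ h)) ⟩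
        2 * (value + ∑ (χ ∘ T))        ≤⟨ ℕ.*-monoʳ-≤ 2 (ℕ.+-mono-≤ (ℕ.≤-trans (proj₂ (proj₂ (proj₂ dual))) w≤) ∣T∣) ⟩
        2 * (∑ M + suc s)              ≡⟨ cong (2 *_) (ℕ.+-suc (∑ M) s) ⟩
        -- As `n` is even, the strict inequality of `deficient` leaves a gap of two; after halving
        -- it pays for the extra unit on `T`.
        2 * suc (∑ M + s)              ≤⟨ ℕ.*-monoʳ-≤ 2 (ℕ.*-cancelˡ-< 2 _ b (subst (2 * (∑ M + s) <_) n≡2b deficient)) ⟩
        2 * b                          ≡⟨ n≡2b ⟨
        n                              ∎
        where
        open ℕ.≤-Reasoning
        move : ∀ a b c → a + b + c ≡ a + c + b
        move = solve-∀
        w≤ : ⟨ w , M ⟩ ≤ ∑ M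
        w≤ = ∑-mono λ e → ℕ.≤-trans (ℕ.*-monoˡ-≤ (M e) (χ≤1 (not (S (src G e) ∨ S (tgt G e))))) (ℕ.≤-reflexive (ℕ.+-identityʳ _))

    opaque
      unmatched⇒barrier : ∀ v₀ → T v₀ ≡ true → Σ (Barrier G) λ 𝓑 → ∀ v → T v ≡ true → Barrier.B 𝓑 v ≡ true
      unmatched⇒barrier v₀ Tv₀ =
        let 𝓑 , B⊇ = tight-dual⇒barrier G cubic 3ec D′ value≤ v₀ (y′≥1 Tv₀) in 𝓑 , λ v Tv → B⊇ v (y′≥1 Tv)
        where
        D′ : Dual G one
        D′ = record { y = y′ ; U = U ; h = h ; size = size ; covers = covers′ }
        y′≥1 : ∀ {v} → T v ≡ true → 1 ≤ y′ v
        y′≥1 {v} Tv = ℕ.≤-trans (ℕ.≤-reflexive (cong χ (sym Tv))) (ℕ.m≤n+m _ (y v))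

  unmatched-pair⇒barrier : ∀ {x z} → x ≢ z → ¬ (∃ λ F → ∀ v → d G F v ≡ χ (not (pair x z v))) →
    Σ (Barrier G) λ 𝓑 → Barrier.B 𝓑 x ≡ true × Barrier.B 𝓑 z ≡ true
  unmatched-pair⇒barrier {x} {z} ne none =
    let 𝓑 , B⊇ = unmatched⇒barrier (pair x z) (pair x z) 1 (∑-pair ne) (ℕ.≤-reflexive (∑-pair ne)) (λ _ p → p) none x x∈
    in 𝓑 , B⊇ x x∈ , B⊇ z (∨-introʳ (x == z) (==-refl z))
    where
    x∈ : pair x z x ≡ true
    x∈ = cong (_∨ (z == x)) (==-refl x)

  module _ (u : V) (third : ∀ x → ∃ λ z → z ≢ u × z ≢ x) where

    private
      adj : V → ℕ
      adj = d G (star G u)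

      ∑-star : ∑ (star G u) ≡ 3
      ∑-star = trans (∑-cong λ e → sym (ℕ.+-identityʳ _)) (cubic u)

      idem : ∀ {a} → a ≤ 1 → a * a ≡ a
      idem {zero}  p       = refl
      idem {suc .zero} (s≤s z≤n) = refl

      adj-u : adj u ≡ 3
      adj-u = trans (∑-cong λ e → idem (inc≤1 G e u)) ∑-star

      -- With two parallel edges between `u` and `x`, at most two edges would leave `{u , x}`, and
      -- the third vertex makes this a proper cut. Hence `u` has three distinct neighbours.
      adj≤1 : ∀ {x} → x ≢ u → adj x ≤ 1
      adj≤1 {x} x≢u = ℕ.≤-pred (ℕ.*-cancelˡ-< 2 (adj x) 2 (s≤s (ℕ.≤-trans (ℕ.*-monoʳ-≤ 2 (ℕ.≤-reflexive adj≡ins)) double)))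
        where
        X : V → Bool
        X = pair u x
        pointwise : ∀ e → inc G e u * inc G e x ≡ 1 * ins G X e
        pointwise e with src G e ≟ u | tgt G e ≟ u | src G e ≟ x | tgt G e ≟ x
        ... | yes a | yes b | _ | _ = ⊥-elim (loopless e (trans a (sym b)))
        ... | _ | _ | yes a | yes b = ⊥-elim (loopless e (trans a (sym b)))
        ... | yes a | _ | yes b | _ = ⊥-elim (x≢u (trans (sym b) a))
        ... | _ | yes a | _ | yes b = ⊥-elim (x≢u (trans (sym b) a))
        ... | yes a | no b | no f | yes g rewrite a | g | ==-refl u | ==-refl x | ==-≢ (x≢u ∘ sym) = refl
        ... | no a | yes b | yes f | no g rewrite b | f | ==-refl u | ==-refl x | ==-≢ (x≢u ∘ sym) = refl
        ... | yes a | no b | no f | no g rewrite ==-≢ (b ∘ sym) | ==-≢ (g ∘ sym) | Bool.∧-zeroʳ (X (src G e)) = refl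
        ... | no a | yes b | no f | no g rewrite ==-≢ (a ∘ sym) | ==-≢ (f ∘ sym) = refl
        ... | no a | no b | _ | no g rewrite ==-≢ (b ∘ sym) | ==-≢ (g ∘ sym) | Bool.∧-zeroʳ (X (src G e)) = refl
        ... | no a | no b | no f | yes g rewrite ==-≢ (a ∘ sym) | ==-≢ (f ∘ sym) = refl
        adj≡ins : adj x ≡ ⟨ one , ins G X ⟩
        adj≡ins = ∑-cong pointwise
        out : ∃ λ z → X z ≡ false
        out = let z , z≢u , z≢x = third x in z , cong₂ _∨_ (==-≢ (z≢u ∘ sym)) (==-≢ (z≢x ∘ sym))
        double : 2 * ⟨ one , ins G X ⟩ ≤ 3
        double = ℕ.+-cancelʳ-≤ 3 _ _ (ℕ.≤-trans (ℕ.+-monoʳ-≤ (2 * ⟨ one , ins G X ⟩) (3ec X (u , cong (_∨ (x == u)) (==-refl u)) out))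
          (ℕ.≤-reflexive (trans (sym (cubic-volume X)) (cong (3 *_) (∑-pair (x≢u ∘ sym))))))

      S T : V → Bool
      T v = not (u == v) ∧ does (1 ℕ.≤? adj v)
      S v = (u == v) ∨ T v

      χT : ∀ v → χ (T v) + 3 * χ (u == v) ≡ adj v
      χT v with u ≟ v
      ... | yes refl = sym adj-u
      ... | no ne with adj v | adj≤1 (ne ∘ sym)
      ... | 0 | _ = refl
      ... | 1 | _ = refl
      ... | suc (suc _) | s≤s ()

      χS : ∀ v → χ (S v) ≡ χ (u == v) + χ (T v)
      χS v with u ≟ v
      ... | yes _ = refl
      ... | no _  = refl

      ∑T : ∑ (χ ∘ T) ≡ 3
      ∑T = ℕ.+-cancelʳ-≡ 3 _ _ (trans (cong (∑ (χ ∘ T) +_) (sym (trans (∑-*ˡ 3 _) (cong (3 *_) (∑-point u)))))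
        (trans (sym (∑-+ _ _)) (trans (∑-cong χT) (trans (∑-degrees G (star G u)) (cong (2 *_) ∑-star)))))

      ∑S : ∑ (χ ∘ S) ≡ 2 * 2
      ∑S = trans (∑-cong χS) (trans (∑-+ _ _) (cong₂ _+_ (∑-point u) ∑T))

      neighbour : (e : E[∂ u ]) → T (otherEnd e) ≡ true
      neighbour e = cong₂ _∧_ (cong not (==-≢ (otherEnd≢ e ∘ sym))) (dec-true (1 ℕ.≤? _)
        (ℕ.≤-trans (ℕ.≤-reflexive (sym (Incident⇒inc G (proj₂ e)))) (F≤d G (star G u) (at-other e))))
        where
        at-other : (e : E[∂ u ]) → Incident (proj₁ e) (otherEnd e)
        at-other (e , inj₁ _) = inj₂ refl
        at-other (e , inj₂ _) = inj₁ refl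

      S⇒T : ∀ e → (S (src G e) ∨ S (tgt G e)) ≡ true → (T (src G e) ∨ T (tgt G e)) ≡ true
      S⇒T e p with ∨-split (S (src G e)) p
      ... | inj₁ q with ∨-split (u == src G e) q
      ... | inj₁ r = ∨-introʳ (T (src G e)) (neighbour (e , inj₁ (sym (==-sound r))))
      ... | inj₂ r = cong (_∨ T (tgt G e)) r
      S⇒T e p | inj₂ q with ∨-split (u == tgt G e) q
      ... | inj₁ r = cong (_∨ T (tgt G e)) (neighbour (e , inj₂ (sym (==-sound r))))
      ... | inj₂ r = ∨-introʳ (T (src G e)) r

      -- A λ-matching centred at `u` is the star of `u` together with a perfect matching of the
      -- graph without the closed neighbourhood of `u`.
      complete : (∃ λ F → ∀ v → d G F v ≡ χ (not (S v))) → ∃ (IsλMatching G u)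
      complete (F , dF) = (λ e → F e + star G u e) , small , at-u , off-u
        where
        total : ∀ v → d G (λ e → F e + star G u e) v ≡ χ (not (S v)) + adj v
        total v = trans (d-+ G F (star G u) v) (cong (_+ adj v) (dF v))
        F-u : d G F u ≡ 0
        F-u = trans (dF u) (cong (λ b → χ (not (b ∨ T u))) (==-refl u))
        small : ∀ e → F e + star G u e ≤ 1
        small e with inc G e u ℕ.≟ 0
        ... | yes z rewrite z | ℕ.+-identityʳ (F e) = ℕ.≤-trans (F≤d G F (inj₁ refl)) (ℕ.≤-trans (ℕ.≤-reflexive (dF (src G e))) (χ≤1 _))
        ... | no nz rewrite ℕ.n≤0⇒n≡0 (subst (F e ≤_) F-u (F≤d G F (inc⇒Incident G nz))) = inc≤1 G e u
        at-u : d G (λ e → F e + star G u e) u ≡ 3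
        at-u = trans (total u) (cong₂ _+_ (trans (sym (dF u)) F-u) adj-u)
        off-u : ∀ v → v ≢ u → d G (λ e → F e + star G u e) v ≡ 1
        off-u v ne = trans (total v) (trans (cong (χ (not (S v)) +_) (sym (χT v))) (finish (u ≟ v)))
          where
          finish : (a : Dec (u ≡ v)) → χ (not (does a ∨ T v)) + (χ (T v) + 3 * χ (does a)) ≡ 1
          finish (yes p) = ⊥-elim (ne (sym p))
          finish (no _)  = trans (cong (χ (not (T v)) +_) (ℕ.+-identityʳ _)) (χ-not (T v))

    opaque
      -- The barrier contains all neighbours of `u`. By stability it does not contain `u`, which is
      -- then isolated once the barrier is deleted.
      unmatchable⇒barrier : ¬ ∃ (IsλMatching G u) → Σ (Barrier G) λ 𝓑 → let open Barrier 𝓑 in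
        B u ≡ false × (∀ z → c z ≡ c u → z ≡ u) × ∃₂ λ x z → B x ≡ true × B z ≡ true × x ≢ z
      unmatchable⇒barrier none = 𝓑 , u∉B , single , x , z , T⊆B x Tx , T⊆B z Tz , x≢z
        where
        x : V
        x = otherEnd (edge-at u)
        Tx : T x ≡ true
        Tx = neighbour (edge-at u)
        found : Σ (Barrier G) λ 𝓑 → ∀ v → T v ≡ true → Barrier.B 𝓑 v ≡ true
        found = unmatched⇒barrier S T 2 ∑S (ℕ.≤-reflexive ∑T) S⇒T (none ∘ complete) x Tx
        𝓑 : Barrier G
        𝓑 = proj₁ found
        open Barrier 𝓑
        T⊆B : ∀ v → T v ≡ true → B v ≡ true
        T⊆B = proj₂ found
        two : ∃ λ z → T z ≡ true × x ≢ z
        two = another-member T (subst (2 ≤_) (sym ∑T) (s≤s (s≤s z≤n))) x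
        z : V
        z = proj₁ two
        Tz : T z ≡ true
        Tz = proj₁ (proj₂ two)
        x≢z : x ≢ z
        x≢z = proj₂ (proj₂ two)
        stable∂ : (e : E[∂ u ]) → B u ≡ true → B (otherEnd e) ≡ true → ∅
        stable∂ (e , inj₁ refl) a b = stable e a b
        stable∂ (e , inj₂ refl) a b = stable e b a
        u∉B : B u ≡ false
        u∉B = Bool.¬-not λ p → stable∂ (edge-at u) p (T⊆B x Tx)
        single : ∀ z → c z ≡ c u → z ≡ u
        single = [ id , (λ (e , eq) → ⊥-elim (case trans (sym u∉B) (trans (sym (B-c u)) (trans (cong B (sym eq)) (trans (B-c _) (T⊆B _ (neighbour e))))) of λ ())) ]′ (alone u)

-- Edge cuts and vertex connectivity

card : (p : Subset k) → ∣ p ∣ ≡ ∑ (bits p)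
card []          = sym (∑-[] _)
card (true  ∷ p) = trans (cong suc (card p)) (sym (∑-∷ (bits (true ∷ p))))
card (false ∷ p) = trans (card p) (sym (∑-∷ (bits (false ∷ p))))

lookup-⁅⁆ : (v x : Fin k) → lookup ⁅ v ⁆ x ≡ (v == x)
lookup-⁅⁆ zero    zero    = refl
lookup-⁅⁆ zero    (suc x) = lookup-replicate x false
lookup-⁅⁆ (suc v) zero    = refl
lookup-⁅⁆ (suc v) (suc x) = lookup-⁅⁆ v x

bits-∩ : (p q : Subset k) → ∀ e → bits (p ∩ q) e ≡ bits p e * bits q e
bits-∩ p q e = trans (cong χ (lookup-zipWith _∧_ e p q)) (χ-∧ (lookup p e) _)

card-∩ : (p q : Subset k) → ∣ p ∩ q ∣ ≡ ⟨ bits p , bits q ⟩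
card-∩ p q = trans (card (p ∩ q)) (∑-cong (bits-∩ p q))

two-support : (c : Fin k → ℕ) → ∑ c ≤ 2 → ∀ {e₁ e₂} → e₁ ≢ e₂ → 1 ≤ c e₁ → 1 ≤ c e₂ → ∀ e → 1 ≤ c e → e ≡ e₁ ⊎ e ≡ e₂
two-support c le {e₁} {e₂} ne c₁ c₂ e ce with e ≟ e₁ | e ≟ e₂
... | yes p | _     = inj₁ p
... | no _  | yes p = inj₂ p
... | no p  | no q  = ⊥-elim (ℕ.<-irrefl refl (ℕ.≤-trans (ℕ.≤-reflexive (sym three)) (ℕ.≤-trans (∑-mono below) le)))
  where
  three : ∑ (λ f → δ e₁ f + δ e₂ f + δ e f) ≡ 3
  three = trans (∑-+ _ _) (cong₂ _+_ (trans (∑-+ _ _) (cong₂ _+_ (∑-point e₁) (∑-point e₂))) (∑-point e))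
  below : ∀ f → δ e₁ f + δ e₂ f + δ e f ≤ c f
  below f with e₁ ≟ f | e₂ ≟ f | e ≟ f
  ... | yes a | yes b | _     = ⊥-elim (ne (trans a (sym b)))
  ... | yes a | _     | yes b = ⊥-elim (p (trans b (sym a)))
  ... | _     | yes a | yes b = ⊥-elim (q (trans b (sym a)))
  ... | yes refl | no _ | no _ = c₁
  ... | no _ | yes refl | no _ = c₂
  ... | no _ | no _ | yes refl = ce
  ... | no _ | no _ | no _ = z≤n

∈⇒lookup : {p : Subset k} {v : Fin k} → v ∈ p → lookup p v ≡ true
∈⇒lookup = []=⇒lookup

lookup⇒∈ : {p : Subset k} {v : Fin k} → lookup p v ≡ true → v ∈ p
lookup⇒∈ {p = p} {v} = lookup⇒[]= v p

∉⇒lookup : {p : Subset k} {v : Fin k} → v ∉ p → lookup p v ≡ false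
∉⇒lookup v∉p = Bool.¬-not (v∉p ∘ lookup⇒∈)

lookup⇒∉ : {p : Subset k} {v : Fin k} → lookup p v ≡ false → v ∉ p
lookup⇒∉ eq v∈p = case trans (sym eq) (∈⇒lookup v∈p) of λ ()

module _ (G : Graph) where
  open Graph G

  bits-∂ : ∀ X e → bits (∂ X) e ≡ cut G (lookup X) e
  bits-∂ X e = cong χ (lookup∘tabulate _ e)

  cut-point : ∀ v e → cut G (v ==_) e ≡ inc G e v
  cut-point v e rewrite ==-sym v (src G e) | ==-sym v (tgt G e) with src G e ≟ v | tgt G e ≟ v
  ... | yes a | yes b = ⊥-elim (loopless e (trans a (sym b)))
  ... | yes _ | no _  = refl
  ... | no _  | yes _ = refl
  ... | no _  | no _  = refl

  cut-cong : ∀ {X Y} → (∀ v → X v ≡ Y v) → ∀ e → cut G X e ≡ cut G Y e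
  cut-cong p e = cong₂ (λ a b → χ (a xor b)) (p (src G e)) (p (tgt G e))

  cut-not : ∀ X e → cut G (not ∘ X) e ≡ cut G X e
  cut-not X e with X (src G e) | X (tgt G e)
  ... | true  | true  = refl
  ... | true  | false = refl
  ... | false | true  = refl
  ... | false | false = refl

  insert : (V → Bool) → V → V → Bool
  insert X t v = X v ∨ (t == v)

  -- Inserting `t` toggles the edges at `t`: those of the cut leave it and the others enter. The
  -- equation is written without subtraction.
  cut-insert : ∀ F X t → X t ≡ false → ⟨ F , cut G X ⟩ + d G F t ≡ ⟨ F , cut G (insert X t) ⟩ + 2 * d G (λ e → F e * cut G X e) t
  cut-insert F X t Xt = trans (sym (∑-+ _ _)) (trans (∑-cong λ e → trans (sym (ℕ.*-distribˡ-+ (F e) _ _))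
    (trans (cong (F e *_) (pointwise e)) (factor (F e) _ _ (inc G e t)))) (trans (∑-+ _ _) (cong (⟨ F , cut G (insert X t) ⟩ +_) (∑-*ˡ 2 _))))
    where
    factor : ∀ a b c e → a * (b + 2 * (c * e)) ≡ a * b + 2 * (a * c * e)
    factor = solve-∀
    pointwise : ∀ e → cut G X e + inc G e t ≡ cut G (insert X t) e + 2 * (cut G X e * inc G e t)
    pointwise e with src G e ≟ t | tgt G e ≟ t
    ... | yes a | yes b = ⊥-elim (loopless e (trans a (sym b)))
    ... | yes refl | no b rewrite ==-refl t | ==-≢ (b ∘ sym) | Xt with X (tgt G e)
    ... | true  = refl
    ... | false = refl
    pointwise e | no a | yes refl rewrite ==-refl t | ==-≢ (a ∘ sym) | Xt with X (src G e)
    ... | true  = refl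
    ... | false = refl
    pointwise e | no a | no b rewrite ==-≢ (a ∘ sym) | ==-≢ (b ∘ sym) with X (src G e) | X (tgt G e)
    ... | true  | true  = refl
    ... | true  | false = refl
    ... | false | true  = refl
    ... | false | false = refl

  deg≡d : ∀ F v → deg F v ≡ d G (bits F) v
  deg≡d F v = trans (card-∩ F (∂ ⁅ v ⁆)) (∑-cong λ e → cong (bits F e *_)
    (trans (bits-∂ ⁅ v ⁆ e) (trans (cut-cong (lookup-⁅⁆ v) e) (cut-point v e))))

  ∣∂∩∣ : ∀ X M → ∣ ∂ X ∩ M ∣ ≡ ⟨ cut G (lookup X) , bits M ⟩
  ∣∂∩∣ X M = trans (card-∩ (∂ X) M) (∑-cong λ e → cong (_* bits M e) (bits-∂ X e))

  deg-⊤ : ∀ v → deg ⊤ v ≡ d G one v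
  deg-⊤ v = trans (deg≡d ⊤ v) (d-cong G (λ e → cong χ (lookup-replicate e true)) v)

  cubic⇒regular : IsCubic G → IsThreeRegular G
  cubic⇒regular cubic v = trans (sym (deg-⊤ v)) (cubic v)

  regular⇒cubic : IsThreeRegular G → IsCubic G
  regular⇒cubic cubic v = trans (deg-⊤ v) (cubic v)

  deg-support : ∀ {F} → (∀ e → F e ≤ 1) → ∀ v → deg (support F) v ≡ d G F v
  deg-support {F} F≤1 v = trans (deg≡d (support F) v) (d-cong G (bits-support F≤1) v)

  toλ : ∀ {v} → λ-Matchable G v → ∃ (IsλMatching G v)
  toλ {v} (F , at , off) = bits F , (λ e → χ≤1 _) , trans (sym (deg≡d F v)) at , λ z ne → trans (sym (deg≡d F z)) (off z ne)

  fromλ : ∀ {v} → ∃ (IsλMatching G v) → λ-Matchable G v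
  fromλ {v} (F , F≤1 , at , off) = support F , trans (deg-support F≤1 v) at , λ z ne → trans (deg-support F≤1 z) (off z ne)

  Joins : E → V → V → Set
  Joins e x z = src G e ≡ x × tgt G e ≡ z ⊎ tgt G e ≡ x × src G e ≡ z

  joinsˡ : ∀ {e x z} → Joins e x z → Incident e x
  joinsˡ (inj₁ (p , _)) = inj₁ p
  joinsˡ (inj₂ (p , _)) = inj₂ p

  joinsʳ : ∀ {e x z} → Joins e x z → Incident e z
  joinsʳ (inj₁ (_ , p)) = inj₂ p
  joinsʳ (inj₂ (_ , p)) = inj₁ p

  joins-sym : ∀ {e x z} → Joins e x z → Joins e z x
  joins-sym (inj₁ (p , q)) = inj₂ (q , p)
  joins-sym (inj₂ (p , q)) = inj₁ (q , p)

  cut-ends : ∀ X e → 1 ≤ cut G X e → ∃₂ λ x z → X x ≡ true × X z ≡ false × Joins e x z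
  cut-ends X e p with X (src G e) in a | X (tgt G e) in b
  ... | true  | false = src G e , tgt G e , a , b , inj₁ (refl , refl)
  ... | false | true  = tgt G e , src G e , b , a , inj₂ (refl , refl)

  joins-cut : ∀ {X e x z} → Joins e x z → X x ≡ true → X z ≡ false → cut G X e ≡ 1
  joins-cut (inj₁ (refl , refl)) a b rewrite a | b = refl
  joins-cut (inj₂ (refl , refl)) a b rewrite a | b = refl

  adjacent⇒joins : ∀ {S x z} → AdjacentOff G S x z → x ∉ S × z ∉ S × ∃ λ e → Joins e x z
  adjacent⇒joins (a , b , e , inj₁ refl) = a , b , e , inj₁ (refl , refl)
  adjacent⇒joins (a , b , e , inj₂ refl) = a , b , e , inj₂ (refl , refl)

  joins⇒adjacent : ∀ {S x z e} → x ∉ S → z ∉ S → Joins e x z → AdjacentOff G S x z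
  joins⇒adjacent {e = e} a b (inj₁ (refl , refl)) = a , b , e , inj₁ refl
  joins⇒adjacent {e = e} a b (inj₂ (refl , refl)) = a , b , e , inj₂ refl

  crossing : ∀ {S} (X : V → Bool) {x z} → Star (AdjacentOff G S) x z → X x ≡ true → X z ≡ false →
    ∃ λ e → ∃₂ λ p q → p ∉ S × q ∉ S × Joins e p q × X p ≡ true × X q ≡ false
  crossing X ε Xx Xz = case trans (sym Xx) Xz of λ ()
  crossing X {x} (_◅_ {j = t} r rs) Xx Xz with X t in eq
  ... | true  = crossing X rs eq Xz
  ... | false = let a , b , e , j = adjacent⇒joins r in e , x , t , a , b , j , Xx , eq

module _ (G : Graph) (cubic : IsThreeRegular G) where
  open Graph G
  open Cubic G cubic

  cut-singleton : ∀ X p → (∀ v → X v ≡ (p == v)) → ⟨ one , cut G X ⟩ ≡ 3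
  cut-singleton X p eq = trans (∑-cong λ e → cong (1 *_) (trans (cut-cong G eq e) (cut-point G p e))) (cubic p)

  -- Deleting an inner end of one edge and an outer end of another separates
  -- the two shores of a cut with at most two edges.
  connected⇒3ec : IsConnected[_] G 3 → IsThreeEdgeConnected G
  connected⇒3ec (_ , conn) X (x , Xx) (z , Xz) = ℕ.≮⇒≥ λ lt → separate (ℕ.≤-pred lt)
    where
    hit : ∀ S → ∣ S ∣ < 3 → (∃ λ p → p ∉ S × X p ≡ true) → (∃ λ q → q ∉ S × X q ≡ false) →
      (∀ e p q → Joins G e p q → X p ≡ true → X q ≡ false → p ∈ S ⊎ q ∈ S) → ∅
    hit S le (p , p∉ , Xp) (q , q∉ , Xq) cover =
      let e , a , b , a∉ , b∉ , j , Xa , Xb = crossing G X (conn S le p q p∉ q∉) Xp Xq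
      in [ a∉ , b∉ ]′ (cover e a b j Xa Xb)
    -- A shore with a single vertex has three cut edges. So each shore of a smaller cut retains a
    -- vertex after one is deleted.
    member : ∀ (Y : V → Bool) → ⟨ one , cut G Y ⟩ ≤ 2 → ∀ p → Y p ≡ true → ∃ λ q → Y q ≡ true × p ≢ q
    member Y le p Yp with any? (λ q → (Y q Bool.≟ true) ×-dec ¬? (p ≟ q))
    ... | yes w   = w
    ... | no none = ⊥-elim (ℕ.<-irrefl refl (subst (_≤ 2) (cut-singleton Y p same) le))
      where
      same : ∀ v → Y v ≡ (p == v)
      same v with Y v in eq | p ≟ v
      ... | true  | yes _    = refl
      ... | false | no _     = refl
      ... | false | yes refl = trans (sym eq) Yp
      ... | true  | no ne    = ⊥-elim (none (v , eq , ne))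
    separate : ⟨ one , cut G X ⟩ ≤ 2 → ∅
    separate le = cases (any? λ e → 1 ℕ.≤? cut G X e)
      where
      two : ∀ e₁ e₂ → 1 ≤ cut G X e₁ → 1 ≤ cut G X e₂ → (∀ e → 1 ≤ cut G X e → e ≡ e₁ ⊎ e ≡ e₂) → ∅
      two e₁ e₂ c₁ c₂ only with cut-ends G X e₁ c₁ | cut-ends G X e₂ c₂
      ... | x₁ , z₁ , Xx₁ , Xz₁ , j₁ | x₂ , z₂ , Xx₂ , Xz₂ , j₂ =
        let p , Xp , x₁≢p = member X le x₁ Xx₁
            q , Xq , z₂≢q = member (not ∘ X) (subst (_≤ 2) (∑-cong λ e → cong (1 *_) (sym (cut-not G X e))) le) z₂ (cong not Xz₂)
        in hit S size (p , ∉S x₁≢p (λ eq → case trans (sym Xz₂) (trans (cong X eq) Xp) of λ ()) , Xp)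
               (q , ∉S (λ eq → case trans (sym Xx₁) (trans (cong X eq) (flip Xq)) of λ ()) z₂≢q , flip Xq) cover
        where
        flip : ∀ {b} → not b ≡ true → b ≡ false
        flip {false} _ = refl
        S : Subset n
        S = tabulate (pair x₁ z₂)
        size : ∣ S ∣ < 3
        size = s≤s (ℕ.≤-reflexive (trans (card S) (trans (∑-cong λ v → cong χ (lookup∘tabulate (pair x₁ z₂) v))
          (∑-pair λ eq → case trans (sym Xx₁) (trans (cong X eq) Xz₂) of λ ()))))
        ∉S : ∀ {v} → x₁ ≢ v → z₂ ≢ v → v ∉ S
        ∉S {v} a b = lookup⇒∉ (trans (lookup∘tabulate (pair x₁ z₂) v) (cong₂ _∨_ (==-≢ a) (==-≢ b)))
        ∈S : ∀ {v} → pair x₁ z₂ v ≡ true → v ∈ S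
        ∈S {v} p = lookup⇒∈ (trans (lookup∘tabulate (pair x₁ z₂) v) p)
        joins-unique : ∀ {e x z x′ z′} → Joins G e x z → Joins G e x′ z′ → X x ≡ true → X z ≡ false → X x′ ≡ true → X z′ ≡ false → x ≡ x′ × z ≡ z′
        joins-unique (inj₁ (refl , refl)) (inj₁ (refl , refl)) _ _ _ _ = refl , refl
        joins-unique (inj₂ (refl , refl)) (inj₂ (refl , refl)) _ _ _ _ = refl , refl
        joins-unique (inj₁ (refl , refl)) (inj₂ (refl , refl)) a b c d = case trans (sym a) d of λ ()
        joins-unique (inj₂ (refl , refl)) (inj₁ (refl , refl)) a b c d = case trans (sym a) d of λ ()
        cover : ∀ e p q → Joins G e p q → X p ≡ true → X q ≡ false → p ∈ S ⊎ q ∈ S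
        cover e p q j Xp Xq with only e (ℕ.≤-reflexive (sym (joins-cut G j Xp Xq)))
        ... | inj₁ refl = inj₁ (∈S (cong (_∨ (z₂ == p)) (trans (cong (_== p) (proj₁ (joins-unique j₁ j Xx₁ Xz₁ Xp Xq))) (==-refl p))))
        ... | inj₂ refl = inj₂ (∈S (∨-introʳ (x₁ == q) (trans (cong (_== q) (proj₂ (joins-unique j₂ j Xx₂ Xz₂ Xp Xq))) (==-refl q))))
      second : ∀ e₁ → 1 ≤ cut G X e₁ → Dec (∃ λ e → 1 ≤ cut G X e × e₁ ≢ e) → ∅
      -- A single cut edge plays both roles: its two ends are deleted.
      second e₁ c₁ (no none) = two e₁ e₁ c₁ c₁ λ e c → inj₁ (decidable-stable (e ≟ e₁) λ ne → none (e , c , ne ∘ sym))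
      second e₁ c₁ (yes (e₂ , c₂ , ne)) = two e₁ e₂ c₁ c₂
        (two-support (cut G X) (ℕ.≤-trans (ℕ.≤-reflexive (sym (⟨one,⟩ (cut G X)))) le) ne c₁ c₂)
      cases : Dec (∃ λ e → 1 ≤ cut G X e) → ∅
      cases (no none) = hit ⊥ (subst (_< 3) (sym (trans (card (⊥ {n})) (∑-zero λ v → cong χ (lookup-replicate v false)))) (s≤s z≤n))
        (x , ∉⊥ , Xx) (z , ∉⊥ , Xz) λ e p q j Xp Xq → ⊥-elim (none (e , ℕ.≤-reflexive (sym (joins-cut G j Xp Xq))))
      cases (yes (e₁ , c₁)) = second e₁ c₁ (any? λ e → (1 ℕ.≤? cut G X e) ×-dec ¬? (e₁ ≟ e))

  -- Suppose that at most two vertices `S` separate `x` from `z`. Let `K` be the component of `x` in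
  -- `G − S` and `L` the rest of `G − S`. All edges of both cuts end in `S`, so there are at most
  -- six, and each cut has three. A vertex of `S` sends at most one edge to `K`, since otherwise
  -- adding it to `K` would leave a cut with fewer than three edges. Then the cut of `K` has at most
  -- `|S|` edges, which is too few.
  3ec⇒connected : V → IsThreeEdgeConnected G → IsConnected[_] G 3
  3ec⇒connected v₀ 3ec = ℕ.n≢0⇒n>0 (λ z → case subst Fin z v₀ of λ ()) , path
    where
    module _ (S : Subset n) (small : ∣ S ∣ < 3) (x z : V) (x∉S : x ∉ S) (z∉S : z ∉ S) where

      adjacentOff? : ∀ a b → Dec (AdjacentOff G S a b)
      adjacentOff? a b = ¬? (a ∈? S) ×-dec (¬? (b ∈? S) ×-dec any? λ e → ≡-dec _≟_ _≟_ (ends e) (a , b) ⊎-dec ≡-dec _≟_ _≟_ (ends e) (b , a))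

      module _ (K : V → Bool) (Kx : K x ≡ true) (reach : ∀ v → K v ≡ true → Star (AdjacentOff G S) x v)
               (closed : ∀ a b → K a ≡ true → AdjacentOff G S a b → K b ≡ true) (Kz : K z ≡ false) where

        s L : V → Bool
        s = lookup S
        L v = not (K v) ∧ not (s v)

        K∩S : ∀ v → K v ≡ true → s v ≡ false
        K∩S v Kv = ∉⇒lookup (last (reach v Kv) x∉S)
          where
          last : ∀ {a b} → Star (AdjacentOff G S) a b → a ∉ S → b ∉ S
          last ε       a∉ = a∉
          last (r ◅ rs) _ = last rs (proj₁ (proj₂ r))

        K-edge : ∀ {e a b} → Joins G e a b → K a ≡ true → K b ≡ false → s b ≡ true
        K-edge {e} {a} {b} j Ka Kb = Bool.¬-not λ sb → case trans (sym Kb)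
          (closed a b Ka (joins⇒adjacent G (lookup⇒∉ (K∩S a Ka)) (lookup⇒∉ sb) j)) of λ ()

        module Shore (X : V → Bool) (in-X : V) (X∋ : X in-X ≡ true) (out : V) (out∉X : X out ≡ false) (out∉S : s out ≡ false)
                     (X∩S : ∀ v → s v ≡ true → X v ≡ false)
                     (bound : ∀ e a b → Joins G e a b → X a ≡ true → X b ≡ false → s b ≡ true) where

          cut≤ : ⟨ one , cut G X ⟩ ≤ ∑ (λ v → χ (s v) * d G (cut G X) v)
          cut≤ = ℕ.≤-trans (∑-mono pointwise) (ℕ.≤-reflexive (sym (handshake G (χ ∘ s) (cut G X))))
            where
            pointwise : ∀ e → 1 * cut G X e ≤ cut G X e * (χ (s (src G e)) + χ (s (tgt G e)))
            pointwise e with 1 ℕ.≤? cut G X e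
            ... | no c rewrite ℕ.n≤0⇒n≡0 (ℕ.≮⇒≥ c) = z≤n
            ... | yes c with cut-ends G X e c
            ... | a , b , Xa , Xb , j = ℕ.≤-trans (ℕ.≤-reflexive (ℕ.*-comm 1 (cut G X e))) (ℕ.*-monoʳ-≤ (cut G X e) (end j (bound e a b j Xa Xb)))
              where
              end : ∀ {a b} → Joins G e a b → s b ≡ true → 1 ≤ χ (s (src G e)) + χ (s (tgt G e))
              end (inj₁ (_ , refl)) sb rewrite sb = ℕ.m≤n+m 1 _
              end (inj₂ (_ , refl)) sb rewrite sb = s≤s z≤n

          twice : ∀ t → s t ≡ true → 2 * d G (cut G X) t ≤ ⟨ one , cut G X ⟩
          twice t st = ℕ.+-cancelʳ-≤ 3 _ _ (begin
            2 * d G (cut G X) t + 3                                  ≡⟨ ℕ.+-comm _ 3 ⟩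
            3 + 2 * d G (cut G X) t                                  ≤⟨ ℕ.+-mono-≤ (3ec (insert G X t) (in-X , cong (_∨ (t == in-X)) X∋)
                (out , cong₂ _∨_ out∉X (==-≢ {i = t} {out} λ eq → case trans (sym st) (trans (cong s eq) out∉S) of λ ())))
                (ℕ.≤-reflexive (cong (2 *_) (sym (d-one* G (cut G X) t)))) ⟩
            ⟨ one , cut G (insert G X t) ⟩ + 2 * d G (λ e → 1 * cut G X e) t ≡⟨ cut-insert G one X t (X∩S t st) ⟨
            ⟨ one , cut G X ⟩ + d G one t                            ≡⟨ cong (⟨ one , cut G X ⟩ +_) (cubic t) ⟩
            ⟨ one , cut G X ⟩ + 3                                    ∎)
            where open ℕ.≤-Reasoning

        L-out : ∀ v → L v ≡ false → K v ≡ false → s v ≡ true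
        L-out v Lv Kv with s v
        ... | true = refl
        ... | false rewrite Kv = sym Lv

        L⇒¬K : ∀ v → L v ≡ true → K v ≡ false
        L⇒¬K v p with K v
        ... | false = refl

        L⇒¬s : ∀ v → L v ≡ true → s v ≡ false
        L⇒¬s v p with s v | K v
        ... | false | _    = refl
        ... | true  | false = sym p

        S⇒¬K : ∀ v → s v ≡ true → K v ≡ false
        S⇒¬K v sv = Bool.¬-not λ Kv → case trans (sym sv) (K∩S v Kv) of λ ()

        S⇒¬L : ∀ v → s v ≡ true → L v ≡ false
        S⇒¬L v sv rewrite sv = Bool.∧-zeroʳ (not (K v))

        bound-L : ∀ e a b → Joins G e a b → L a ≡ true → L b ≡ false → s b ≡ true
        bound-L e a b j La Lb = decide (K b) refl
          where
          decide : ∀ k → K b ≡ k → s b ≡ true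
          decide false Kb = L-out b Lb Kb
          decide true  Kb = case trans (sym (L⇒¬s a La)) (K-edge (joins-sym G j) Kb (L⇒¬K a La)) of λ ()

        Lz : L z ≡ true
        Lz = cong₂ (λ a b → not a ∧ not b) Kz (∉⇒lookup z∉S)

        Lx : L x ≡ false
        Lx = cong (λ a → not a ∧ not (s x)) Kx

        module 𝐊 = Shore K x Kx z Kz (∉⇒lookup z∉S) S⇒¬K (λ e a b → K-edge)
        module 𝐋 = Shore L z Lz x Lx (∉⇒lookup x∉S) S⇒¬L bound-L

        ∣S∣≤2 : ∑ (χ ∘ s) ≤ 2
        ∣S∣≤2 = ℕ.≤-pred (subst (_< 3) (card S) small)

        both : ∀ v → χ (s v) * d G (cut G K) v + χ (s v) * d G (cut G L) v ≤ 3 * χ (s v)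
        both v with s v in sv
        ... | false = z≤n
        ... | true  = subst₂ _≤_ (trans (d-+ G (cut G K) (cut G L) v) (sym (cong₂ _+_ (ℕ.+-identityʳ (d G (cut G K) v)) (ℕ.+-identityʳ (d G (cut G L) v)))))
                (cubic v) (∑-mono pointwise)
          where
          disjoint : ∀ a → χ (K a) + χ (L a) ≤ 1
          disjoint a with K a | s a
          ... | true  | _     = s≤s z≤n
          ... | false | true  = z≤n
          ... | false | false = s≤s z≤n
          pointwise : ∀ e → (cut G K e + cut G L e) * inc G e v ≤ 1 * inc G e v
          pointwise e with src G e ≟ v | tgt G e ≟ v
          ... | no _ | no _ = ℕ.≤-reflexive (ℕ.*-zeroʳ (cut G K e + cut G L e))
          ... | yes a | yes b = ⊥-elim (loopless e (trans a (sym b)))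
          ... | yes refl | no _ rewrite S⇒¬K v sv | sv | ℕ.*-identityʳ (χ (K (tgt G e)) + χ (L (tgt G e))) = disjoint (tgt G e)
          ... | no _ | yes refl rewrite S⇒¬K v sv | sv | Bool.xor-identityʳ (K (src G e)) | Bool.xor-identityʳ (L (src G e))
              | ℕ.*-identityʳ (χ (K (src G e)) + χ (L (src G e))) = disjoint (src G e)

        impossible : ∅
        impossible = ℕ.<-irrefl refl (begin-strict
          2                                          <⟨ 3ec K (x , Kx) (z , Kz) ⟩
          ⟨ one , cut G K ⟩                          ≤⟨ 𝐊.cut≤ ⟩
          ∑ (λ v → χ (s v) * d G (cut G K) v)        ≤⟨ ∑-mono few ⟩
          ∑ (χ ∘ s)                                  ≤⟨ ∣S∣≤2 ⟩
          2                                          ∎)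
          where
          open ℕ.≤-Reasoning
          ∂K≤3 : ⟨ one , cut G K ⟩ ≤ 3
          ∂K≤3 = ℕ.+-cancelʳ-≤ 3 _ _ (begin
            ⟨ one , cut G K ⟩ + 3                    ≤⟨ ℕ.+-mono-≤ 𝐊.cut≤ (ℕ.≤-trans (3ec L (z , Lz) (x , Lx)) 𝐋.cut≤) ⟩
            ∑ (λ v → χ (s v) * d G (cut G K) v) + ∑ (λ v → χ (s v) * d G (cut G L) v) ≡⟨ ∑-+ _ _ ⟨
            ∑ (λ v → χ (s v) * d G (cut G K) v + χ (s v) * d G (cut G L) v) ≤⟨ ∑-mono both ⟩
            ∑ (λ v → 3 * χ (s v))                    ≡⟨ ∑-*ˡ 3 _ ⟩
            3 * ∑ (χ ∘ s)                            ≤⟨ ℕ.*-monoʳ-≤ 3 ∣S∣≤2 ⟩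
            6                                        ∎)
          few : ∀ v → χ (s v) * d G (cut G K) v ≤ χ (s v)
          few v with s v in sv
          ... | false = z≤n
          ... | true  = subst (_≤ 1) (sym (ℕ.+-identityʳ _)) (ℕ.≤-pred (ℕ.*-cancelˡ-< 2 (d G (cut G K) v) 2 (s≤s (ℕ.≤-trans (𝐊.twice v sv) ∂K≤3))))

    path : ∀ S → ∣ S ∣ < 3 → ∀ x z → x ∉ S → z ∉ S → Star (AdjacentOff G S) x z
    path S small x z x∉S z∉S with component (adjacentOff? S small x z x∉S z∉S) x
    ... | K , Kx , reach , closed with K z in Kz
    ... | true  = reach z Kz
    ... | false = ⊥-elim (impossible S small x z x∉S z∉S K Kx reach closed Kz)

-- Bricks

≤1-parity : ∀ {a b} q → a ≤ 1 → b ≤ 1 → a + b ≡ 2 * q → a ≡ b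
≤1-parity q p p′ eq with ≤1-cases p | ≤1-cases p′
... | inj₁ refl | inj₁ refl = refl
... | inj₂ refl | inj₂ refl = refl
... | inj₁ refl | inj₂ refl = ⊥-elim (even≢odd q 0 (sym eq))
... | inj₂ refl | inj₁ refl = ⊥-elim (even≢odd q 0 (sym eq))

even-minus : ∀ a b c → 2 * a ≡ 2 * b + c → ∃ λ q → c ≡ 2 * q
even-minus a b c eq with half c
... | q , inj₁ p = q , p
... | q , inj₂ p = ⊥-elim (even≢odd a (b + q) (trans eq (trans (cong (2 * b +_) p) (expand b q))))
  where
  expand : ∀ b q → 2 * b + suc (2 * q) ≡ suc (2 * (b + q))
  expand = solve-∀

size≤1 : (X : Subset k) → ∣ X ∣ ≤ 1 → ∀ {p q} → lookup X p ≡ true → lookup X q ≡ true → p ≡ q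
size≤1 X le {p} {q} Xp Xq = decidable-stable (p ≟ q) λ ne → ℕ.<-irrefl refl
  (ℕ.≤-trans (ℕ.≤-trans (ℕ.≤-reflexive (cong₂ (λ a b → χ a + χ b) (sym Xp) (sym Xq))) (two-terms≤∑ (bits X) ne)) (subst (_≤ 1) (card X) le))

module _ (G : Graph) where
  open Graph G

  IsPerfect : (E → ℕ) → Set
  IsPerfect M = ∀ v → d G M v ≡ 1

  perfect-volume : ∀ (X : V → Bool) (M : E → ℕ) → IsPerfect M → ∑ (χ ∘ X) ≡ 2 * ⟨ M , ins G X ⟩ + ⟨ M , cut G X ⟩
  perfect-volume X M pM = trans (∑-cong λ v → sym (trans (cong (χ (X v) *_) (pM v)) (ℕ.*-identityʳ _))) (volume G X M)

  perfect≤1 : ∀ M → IsPerfect M → ∀ e → M e ≤ 1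
  perfect≤1 M pM e = ℕ.≤-trans (F≤d G M (inj₁ refl)) (ℕ.≤-reflexive (pM (src G e)))

  shared-end : ∀ (F : E → ℕ) {e f v} → Incident e v → Incident f v → e ≢ f → F e + F f ≤ d G F v
  shared-end F {e} {f} {v} i j ne = subst (_≤ d G F v)
    (cong₂ _+_ (trans (cong (F e *_) (Incident⇒inc G i)) (ℕ.*-identityʳ (F e))) (trans (cong (F f *_) (Incident⇒inc G j)) (ℕ.*-identityʳ (F f))))
    (two-terms≤∑ (λ e → F e * inc G e v) ne)

module _ (G : Graph) (cubic : IsThreeRegular G) (brick : IsBrick G) where
  open Graph G
  open Cubic G cubic

  private
    through : ∀ e → ∃ λ M → IsPerfect G M × M e ≡ 1
    through e = let M , pM , e∈M = proj₂ (proj₂ (proj₁ (proj₂ brick))) e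
                in bits M , (λ v → trans (sym (deg≡d G M v)) (pM v)) , cong χ (∈⇒lookup e∈M)

    other-edge : ∀ e {v} → Incident e v → ∃ λ (f : E[∂ v ]) → e ≢ proj₁ f
    other-edge e {v} i = let f , p = d-positive G F v (ℕ.≤-trans (s≤s z≤n) two) in f , distinct p
      where
      F : E → ℕ
      F f = χ (not (e == f))
      two : 2 ≤ d G F v
      two = ℕ.+-cancelʳ-≤ 1 _ _ (ℕ.≤-reflexive (trans (sym (cubic v)) (trans (d-cong G (λ f → sym (χ-not (e == f))) v)
        (trans (d-+ G F (δ e) v) (cong (d G F v +_) (trans (d-δ G e v) (Incident⇒inc G i)))))))
      distinct : ∀ {f} → 1 ≤ F f → e ≢ f
      distinct p refl rewrite ==-refl e = case p of λ ()

    -- The degree sum makes `|X|` odd. A perfect matching through another edge at an end of the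
    -- bridge avoids the bridge, matches `X` within itself and makes `|X|` even.
    no-bridge : ∀ X → ⟨ one , cut G X ⟩ ≡ 1 → ∅
    no-bridge X one-edge with ∑-positive (cut G X) (ℕ.≤-reflexive (trans (sym one-edge) (⟨one,⟩ (cut G X))))
    ... | e , ce with other-edge e (inj₁ refl)
    ... | (f , i) , e≢f with through f
    ... | M , pM , Mf = even≢odd (3 * ⟨ M , ins G X ⟩) ⟨ one , ins G X ⟩ (trans (double ⟨ M , ins G X ⟩)
            (trans (cong (3 *_) (sym ∣X∣)) (trans (cubic-volume X) (trans (cong (2 * ⟨ one , ins G X ⟩ +_) one-edge) (ℕ.+-comm _ 1)))))
      where
      double : ∀ a → 2 * (3 * a) ≡ 3 * (2 * a)
      double = solve-∀
      Me : M e ≡ 0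
      Me = ℕ.n≤0⇒n≡0 (ℕ.+-cancelʳ-≤ 1 _ _ (subst₂ _≤_ (cong (M e +_) Mf) (pM (src G e)) (shared-end G M (inj₁ refl) i e≢f)))
      zero-term : ∀ g → M g * cut G X g ≡ 0
      zero-term g with e ≟ g
      ... | yes refl = cong (_* cut G X g) Me
      ... | no ne = trans (cong (M g *_) (ℕ.n≤0⇒n≡0 (ℕ.+-cancelˡ-≤ 1 _ _ (ℕ.≤-trans (ℕ.+-monoˡ-≤ (cut G X g) ce)
              (ℕ.≤-trans (two-terms≤∑ (cut G X) ne) (ℕ.≤-reflexive (trans (sym (⟨one,⟩ (cut G X))) one-edge)))))) ) (ℕ.*-zeroʳ (M g))
      ∣X∣ : ∑ (χ ∘ X) ≡ 2 * ⟨ M , ins G X ⟩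
      ∣X∣ = trans (perfect-volume G X M pM) (trans (cong (2 * ⟨ M , ins G X ⟩ +_) (∑-zero zero-term)) (ℕ.+-identityʳ _))

    module TwoCut (X : V → Bool) (∣∂X∣ : ⟨ one , cut G X ⟩ ≡ 2) {e f} (e≢f : e ≢ f) {x₁ y₁ x₂ y₂}
                  (e-joins : Joins G e x₁ y₁) (f-joins : Joins G f x₂ y₂)
                  (Xx₁ : X x₁ ≡ true) (Xy₁ : X y₁ ≡ false) (Xx₂ : X x₂ ≡ true) (Xy₂ : X y₂ ≡ false) where

      ce : cut G X e ≡ 1
      ce = joins-cut G {X = X} e-joins Xx₁ Xy₁

      cf : cut G X f ≡ 1
      cf = joins-cut G {X = X} f-joins Xx₂ Xy₂

      only : ∀ g → 1 ≤ cut G X g → g ≡ e ⊎ g ≡ f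
      only = two-support (cut G X) (ℕ.≤-reflexive (trans (sym (⟨one,⟩ (cut G X))) ∣∂X∣)) e≢f (ℕ.≤-reflexive (sym ce)) (ℕ.≤-reflexive (sym cf))

      -- A perfect matching contains both or none of e and f, which makes ∂ Z tight.
      Z : V → Bool
      Z = insert G X y₁

      -- If the two cut edges shared their outer end, adding it to `X` would leave one cut edge: the
      -- two edges drop out and only the third edge at `y₁` enters.
      y₁≢y₂ : y₁ ≢ y₂
      y₁≢y₂ refl = no-bridge Z (arith (d G (λ g → 1 * cut G X g) y₁) ⟨ one , cut G Z ⟩
        (trans (sym (cong₂ _+_ ∣∂X∣ (cubic y₁))) (cut-insert G one X y₁ Xy₁))
        (ℕ.≤-trans (ℕ.≤-reflexive (cong₂ _+_ (cong (1 *_) (sym ce)) (cong (1 *_) (sym cf))))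
          (shared-end G (λ g → 1 * cut G X g) (joinsʳ G e-joins) (joinsʳ G f-joins) e≢f)))
        where
        arith : ∀ k c → 5 ≡ c + 2 * k → 2 ≤ k → c ≡ 1
        arith (suc (suc zero)) c eq _ = sym (ℕ.+-cancelʳ-≡ 4 1 c eq)
        arith (suc (suc (suc k))) c eq _ = ⊥-elim (ℕ.<-irrefl refl (ℕ.≤-trans (ℕ.≤-trans (ℕ.m≤m+n 6 (2 * k))
          (ℕ.≤-reflexive (sym (ℕ.*-distribˡ-+ 2 3 k)))) (ℕ.≤-trans (ℕ.m≤n+m _ c) (ℕ.≤-reflexive (sym eq)))))
        arith (suc zero) c eq (s≤s ())

      on-cut : (M : E → ℕ) → (∀ g → M g * cut G X g ≡ M g * δ e g + M g * δ f g)
      on-cut M g with e ≟ g | f ≟ g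
      ... | yes p | yes q = ⊥-elim (e≢f (trans p (sym q)))
      ... | yes refl | no _ rewrite ce | ℕ.*-zeroʳ (M g) = sym (ℕ.+-identityʳ _)
      ... | no _ | yes refl rewrite cf | ℕ.*-zeroʳ (M g) = refl
      ... | no p | no q with 1 ℕ.≤? cut G X g
      ... | yes c = ⊥-elim ([ (λ eq → p (sym eq)) , (λ eq → q (sym eq)) ]′ (only g c))
      ... | no  c rewrite ℕ.n≤0⇒n≡0 (ℕ.≮⇒≥ c) | ℕ.*-zeroʳ (M g) = refl

      ⟨M,cut⟩ : (M : E → ℕ) → ⟨ M , cut G X ⟩ ≡ M e + M f
      ⟨M,cut⟩ M = trans (∑-cong (on-cut M)) (trans (∑-+ _ _) (cong₂ _+_ (∑-at M e) (∑-at M f)))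

      at-y₁ : (M : E → ℕ) → d G (λ g → M g * cut G X g) y₁ ≡ M e
      at-y₁ M = trans (∑-cong pointwise) (∑-at M e)
        where
        inc-f : inc G f y₁ ≡ 0
        inc-f = ℕ.n≤0⇒n≡0 (ℕ.≮⇒≥ λ p → [ (λ eq → case trans (sym Xy₁) (trans (cong X eq) Xx₂) of λ ()) , y₁≢y₂ ]′ (which f-joins (inc⇒Incident G (ℕ.>⇒≢ p))))
          where
          which : ∀ {x y} → Joins G f x y → Incident f y₁ → y₁ ≡ x ⊎ y₁ ≡ y
          which (inj₁ (a , b)) (inj₁ c) = inj₁ (trans (sym c) a)
          which (inj₁ (a , b)) (inj₂ c) = inj₂ (trans (sym c) b)
          which (inj₂ (a , b)) (inj₁ c) = inj₂ (trans (sym c) b)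
          which (inj₂ (a , b)) (inj₂ c) = inj₁ (trans (sym c) a)
        pointwise : ∀ g → M g * cut G X g * inc G g y₁ ≡ M g * δ e g
        pointwise g rewrite on-cut M g with e ≟ g | f ≟ g
        ... | yes p | yes q = ⊥-elim (e≢f (trans p (sym q)))
        ... | yes refl | no _ rewrite Incident⇒inc G (joinsʳ G e-joins) | ℕ.*-zeroʳ (M g) | ℕ.+-identityʳ (M g * 1) = ℕ.*-identityʳ _
        ... | no _ | yes refl rewrite inc-f = trans (ℕ.*-zeroʳ (M g * 0 + M g * 1)) (sym (ℕ.*-zeroʳ (M g)))
        ... | no _ | no _ rewrite ℕ.*-zeroʳ (M g) = refl

      tight : IsTight G (tabulate Z)
      tight M pM = trans (∣∂∩∣ G (tabulate Z) M) (trans (∑-cong λ g → cong (_* bits M g) (cut-cong G (lookup∘tabulate Z) g))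
        (trans (⟨,⟩-comm (cut G Z) (bits M)) (ℕ.+-cancelʳ-≡ (2 * bits M e) _ _ crossing-number)))
        where
        perfect : IsPerfect G (bits M)
        perfect v = trans (sym (deg≡d G M v)) (pM v)
        even-X : ∃ λ q → ∑ (χ ∘ X) ≡ 2 * q
        even-X = even-minus (⟨ one , ins G X ⟩ + 1) (∑ (χ ∘ X)) (∑ (χ ∘ X)) (trans (ℕ.*-distribˡ-+ 2 ⟨ one , ins G X ⟩ 1)
          (trans (sym (trans (cubic-volume X) (cong (2 * ⟨ one , ins G X ⟩ +_) ∣∂X∣))) (ℕ.+-comm (∑ (χ ∘ X)) (2 * ∑ (χ ∘ X)))))
        Me≡Mf : bits M e ≡ bits M f
        Me≡Mf = let q , eq = even-X
                    r , eq′ = even-minus q ⟨ bits M , ins G X ⟩ (bits M e + bits M f) (trans (sym eq)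
                                (trans (perfect-volume G X (bits M) perfect) (cong (2 * ⟨ bits M , ins G X ⟩ +_) (⟨M,cut⟩ (bits M)))))
                in ≤1-parity r (χ≤1 _) (χ≤1 _) eq′
        crossing-number : ⟨ bits M , cut G Z ⟩ + 2 * bits M e ≡ 1 + 2 * bits M e
        crossing-number = trans (cong (λ x → ⟨ bits M , cut G Z ⟩ + 2 * x) (sym (at-y₁ (bits M)))) (trans (sym (cut-insert G (bits M) X y₁ Xy₁))
          (trans (cong₂ _+_ (trans (⟨M,cut⟩ (bits M)) (cong (bits M e +_) (sym Me≡Mf))) (perfect y₁)) (move (bits M e))))
          where
          move : ∀ a → a + a + 1 ≡ 1 + 2 * a
          move = solve-∀

      -- The tight cut of `Z` is trivial, and `Z` contains both `x₁` and `y₁`. So at most one vertex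
      -- lies outside `Z`, and `y₂` does.
      outer : ∀ v → X v ≡ false → v ≡ y₁ ⊎ v ≡ y₂
      outer v Xv with v ≟ y₁
      ... | yes p = inj₁ p
      ... | no  p with v ≟ y₂
      ... | yes q = inj₂ q
      ... | no  q with proj₂ (proj₂ brick) (tabulate Z) tight
      ... | inj₁ small = ⊥-elim (case trans (sym Xx₁) (trans (cong X (size≤1 (tabulate Z) small
              (trans (lookup∘tabulate Z x₁) (cong (_∨ (y₁ == x₁)) Xx₁)) (trans (lookup∘tabulate Z y₁) (∨-introʳ (X y₁) (==-refl y₁))))) Xy₁) of λ ())
      ... | inj₂ small = ⊥-elim (q (size≤1 (∁ (tabulate Z)) small (outside p Xv) (outside (y₁≢y₂ ∘ sym) Xy₂)))
        where
        outside : ∀ {v} → v ≢ y₁ → X v ≡ false → lookup (∁ (tabulate Z)) v ≡ true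
        outside {v} ne Xv = trans (lookup-map v not (tabulate Z)) (cong not (trans (lookup∘tabulate Z v) (cong₂ _∨_ Xv (==-≢ (ne ∘ sym)))))

    -- Applied to both shores, `outer` leaves only the vertices `x₁`, `x₂`, `y₁`, `y₂`. Edges within
    -- a shore join its two vertices, so `{x₁ , y₂}` is a colour class, contrary to
    -- nonbipartiteness.
    no-two-cut : ∀ X → ⟨ one , cut G X ⟩ ≡ 2 → ∅
    no-two-cut X ∣∂X∣ with ∑-positive (cut G X) (subst (1 ≤_) (trans (sym ∣∂X∣) (⟨one,⟩ (cut G X))) (s≤s z≤n))
    ... | e , ce with another-member (λ g → X (src G g) xor X (tgt G g)) (ℕ.≤-reflexive (trans (sym ∣∂X∣) (⟨one,⟩ (cut G X)))) e
    ... | f , cf , e≢f with cut-ends G X e ce | cut-ends G X f (ℕ.≤-reflexive (cong χ (sym cf)))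
    ... | x₁ , y₁ , Xx₁ , Xy₁ , je | x₂ , y₂ , Xx₂ , Xy₂ , jf = proj₁ brick (tabulate A , bipartition)
      where
      module In = TwoCut X ∣∂X∣ e≢f je jf Xx₁ Xy₁ Xx₂ Xy₂
      module Out = TwoCut (not ∘ X) (trans (∑-cong λ g → cong (1 *_) (cut-not G X g)) ∣∂X∣) e≢f (joins-sym G je) (joins-sym G jf)
                     (cong not Xy₁) (cong not Xx₁) (cong not Xy₂) (cong not Xx₂)
      A : V → Bool
      A = pair x₁ y₂
      x≢y : ∀ {a b} → X a ≡ true → X b ≡ false → a ≢ b
      x≢y p q refl = case trans (sym p) q of λ ()
      Ax₁ : A x₁ ≡ true
      Ax₁ = cong (_∨ (y₂ == x₁)) (==-refl x₁)
      Ay₂ : A y₂ ≡ true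
      Ay₂ = ∨-introʳ (x₁ == y₂) (==-refl y₂)
      Ax₂ : A x₂ ≡ false
      Ax₂ = cong₂ _∨_ (==-≢ Out.y₁≢y₂) (==-≢ (x≢y Xx₂ Xy₂ ∘ sym))
      Ay₁ : A y₁ ≡ false
      Ay₁ = cong₂ _∨_ (==-≢ (x≢y Xx₁ Xy₁)) (==-≢ (In.y₁≢y₂ ∘ sym))
      value : ∀ v → (X v ≡ true × (v ≡ x₁ ⊎ v ≡ x₂)) ⊎ (X v ≡ false × (v ≡ y₁ ⊎ v ≡ y₂))
      value v with X v in eq
      ... | true  = inj₁ (refl , Out.outer v (cong not eq))
      ... | false = inj₂ (refl , In.outer v eq)
      differ : ∀ {a b} → A a ≡ true → A b ≡ false → (A a xor A b) ≡ true
      differ p q rewrite p | q = refl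
      differ′ : ∀ {a b} → A a ≡ false → A b ≡ true → (A a xor A b) ≡ true
      differ′ p q rewrite p | q = refl
      joins-differ : ∀ {g a b} → Joins G g a b → (A a xor A b) ≡ true → (A (src G g) xor A (tgt G g)) ≡ true
      joins-differ (inj₁ (refl , refl)) p = p
      joins-differ {g} (inj₂ (refl , refl)) p = trans (Bool.xor-comm (A (src G g)) _) p
      crosses : ∀ {a b} g → src G g ≡ a → tgt G g ≡ b → X a ≡ true → X b ≡ false → (A (src G g) xor A (tgt G g)) ≡ true
      crosses {a} {b} g p q Xa Xb with In.only g (ℕ.≤-reflexive (sym (joins-cut G {X = X} (inj₁ (p , q)) Xa Xb)))
      ... | inj₁ refl = joins-differ je (differ Ax₁ Ay₁)
      ... | inj₂ refl = joins-differ jf (differ′ Ax₂ Ay₂)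
      crosses′ : ∀ {a b} g → src G g ≡ a → tgt G g ≡ b → X a ≡ false → X b ≡ true → (A (src G g) xor A (tgt G g)) ≡ true
      crosses′ {a} {b} g p q Xa Xb with In.only g (ℕ.≤-reflexive (sym (joins-cut G {X = X} (inj₂ (q , p)) Xb Xa)))
      ... | inj₁ refl = joins-differ je (differ Ax₁ Ay₁)
      ... | inj₂ refl = joins-differ jf (differ′ Ax₂ Ay₂)
      crossing-edge : ∀ g → (A (src G g) xor A (tgt G g)) ≡ true
      crossing-edge g with value (src G g) | value (tgt G g)
      ... | inj₁ (a , _) | inj₂ (b , _) = crosses g refl refl a b
      ... | inj₂ (a , _) | inj₁ (b , _) = crosses′ g refl refl a b
      ... | inj₁ (_ , inj₁ p) | inj₁ (_ , inj₁ q) = ⊥-elim (loopless g (trans p (sym q)))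
      ... | inj₁ (_ , inj₂ p) | inj₁ (_ , inj₂ q) = ⊥-elim (loopless g (trans p (sym q)))
      ... | inj₂ (_ , inj₁ p) | inj₂ (_ , inj₁ q) = ⊥-elim (loopless g (trans p (sym q)))
      ... | inj₂ (_ , inj₂ p) | inj₂ (_ , inj₂ q) = ⊥-elim (loopless g (trans p (sym q)))
      ... | inj₁ (_ , inj₁ p) | inj₁ (_ , inj₂ q) = differ (trans (cong A p) Ax₁) (trans (cong A q) Ax₂)
      ... | inj₁ (_ , inj₂ p) | inj₁ (_ , inj₁ q) = differ′ (trans (cong A p) Ax₂) (trans (cong A q) Ax₁)
      ... | inj₂ (_ , inj₁ p) | inj₂ (_ , inj₂ q) = differ′ (trans (cong A p) Ay₁) (trans (cong A q) Ay₂)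
      ... | inj₂ (_ , inj₂ p) | inj₂ (_ , inj₁ q) = differ (trans (cong A p) Ay₂) (trans (cong A q) Ay₁)
      bipartition : IsBipartition G (tabulate A)
      bipartition g = lookup⇒∈ (trans (lookup∘tabulate _ g) (trans (cong₂ _xor_ (lookup∘tabulate A (src G g)) (lookup∘tabulate A (tgt G g))) (crossing-edge g)))

  brick⇒3ec : IsThreeEdgeConnected G
  brick⇒3ec X (x , Xx) (z , Xz) = at-least-3 _ refl
    where
    at-least-3 : ∀ c → ⟨ one , cut G X ⟩ ≡ c → 3 ≤ c
    at-least-3 1 eq = ⊥-elim (no-bridge X eq)
    at-least-3 2 eq = ⊥-elim (no-two-cut X eq)
    at-least-3 (suc (suc (suc _))) eq = s≤s (s≤s (s≤s z≤n))
    at-least-3 0 eq =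
      let e , p , q , _ , _ , j , Xp , Xq = crossing G X (proj₂ (proj₁ (proj₂ (proj₁ (proj₂ brick)))) ⊥
            (subst (_< 1) (sym (trans (card (⊥ {n})) (∑-zero λ v → cong χ (lookup-replicate v false)))) (s≤s z≤n)) x z ∉⊥ ∉⊥) Xx Xz
      in ⊥-elim (ℕ.<-irrefl (sym (trans (sym (⟨one,⟩ (cut G X))) eq))
           (ℕ.≤-trans (ℕ.≤-reflexive (sym (joins-cut G {X = X} j Xp Xq))) (term≤∑ (cut G X) e)))

-- Degree sums over the colour classes

module _ (G : Graph) (A : Graph.V G → Bool) (bip : ∀ e → cut G A e ≡ 1) where
  open Graph G

  colour-sum : ∀ F → ∑ (λ v → χ (A v) * d G F v) ≡ ∑ F
  colour-sum F = trans (handshake G (χ ∘ A) F) (∑-cong λ e → trans (cong (F e *_) (one-end (A (src G e)) (A (tgt G e)) (bip e))) (ℕ.*-identityʳ _))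
    where
    one-end : ∀ a b → χ (a xor b) ≡ 1 → χ a + χ b ≡ 1
    one-end true  false _ = refl
    one-end false true  _ = refl

  colour-sum′ : ∀ F → ∑ (λ v → χ (not (A v)) * d G F v) ≡ ∑ F
  colour-sum′ F = trans (handshake G (χ ∘ not ∘ A) F) (∑-cong λ e → trans (cong (F e *_) (one-end (A (src G e)) (A (tgt G e)) (bip e))) (ℕ.*-identityʳ _))
    where
    one-end : ∀ a b → χ (a xor b) ≡ 1 → χ (not a) + χ (not b) ≡ 1
    one-end true  false _ = refl
    one-end false true  _ = refl

  balanced : IsThreeRegular G → ∑ (χ ∘ A) ≡ ∑ (χ ∘ not ∘ A)
  balanced cubic = ℕ.*-cancelˡ-≡ _ _ 3 (trans (sym (Cubic.cubic-weight G cubic (χ ∘ A))) (trans (colour-sum one)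
    (trans (sym (colour-sum′ one)) (Cubic.cubic-weight G cubic (χ ∘ not ∘ A)))))

module _ (G : Graph) (cubic : IsThreeRegular G) where
  open Graph G

  -- The colour classes have equal sizes and equal degree sums, but the surplus of two at the centre
  -- would fall on one class only.
  bipartite⇒unmatchable : IsBipartite G → ∀ v → ¬ ∃ (IsλMatching G v)
  bipartite⇒unmatchable (A′ , bip) v (F , _ , at , off) = absurd (A v) refl
    (ℕ.+-cancelˡ-≡ (∑ (χ ∘ A)) _ _ (trans (sym (weight A)) (trans (colour-sum G A cut≡1 F)
      (trans (sym (colour-sum′ G A cut≡1 F)) (trans (weight (not ∘ A)) (cong (_+ 2 * χ (not (A v))) (sym (balanced G A cut≡1 cubic))))))))
    where
    A : V → Bool
    A = lookup A′
    cut≡1 : ∀ e → cut G A e ≡ 1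
    cut≡1 e = trans (sym (bits-∂ G A′ e)) (cong χ (∈⇒lookup (bip e)))
    degree : ∀ z → d G F z ≡ 1 + 2 * χ (v == z)
    degree z with v ≟ z
    ... | yes refl = at
    ... | no ne    = off z (ne ∘ sym)
    weight : ∀ X → ∑ (λ z → χ (X z) * d G F z) ≡ ∑ (χ ∘ X) + 2 * χ (X v)
    weight X = trans (∑-cong λ z → trans (cong (χ (X z) *_) (degree z)) (expand (χ (X z)) (χ (v == z))))
      (trans (∑-+ _ _) (cong (∑ (χ ∘ X) +_) (trans (∑-*ˡ 2 _) (cong (2 *_) (∑-at (χ ∘ X) v)))))
      where
      expand : ∀ a b → a * (1 + 2 * b) ≡ a + 2 * (a * b)
      expand = solve-∀
    absurd : ∀ b → A v ≡ b → 2 * χ (A v) ≡ 2 * χ (not (A v)) → ∅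
    absurd true  p rewrite p = λ ()
    absurd false p rewrite p = λ ()

-- Bicritical graphs are bricks

module _ (G : Graph) (cubic : IsThreeRegular G) (3ec : IsThreeEdgeConnected G) where
  open Graph G
  open Cubic G cubic
  open ThreeConnected 3ec

  covered-by-perfect : ∀ e → ∃ λ M → IsPerfect G M × 1 ≤ M e
  covered-by-perfect e with perfect-matching (δ e) (λ f → χ≤1 (e == f))
  ... | M , pM , le = M , pM , ℕ.n≢0⇒n>0 λ z →
    case subst₂ _≤_ (∑-point e) (cong (3 *_) (trans (trans (⟨,⟩-comm (δ e) M) (⟨,⟩-δ M e)) z)) le of λ ()

  matching-covered : V → IsMatchingCovered G
  matching-covered v₀ = two-vertices n (src G e₀) (tgt G e₀) (loopless e₀) , connected , covered
    where
    e₀ : E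
    e₀ = proj₁ (edge-at v₀)
    two-vertices : ∀ k → (x z : Fin k) → x ≢ z → 2 ≤ k
    two-vertices 1 zero zero ne = ⊥-elim (ne refl)
    two-vertices (suc (suc k)) _ _ _ = s≤s (s≤s z≤n)
    connected : IsConnected[_] G 1
    connected = let a , b = 3ec⇒connected G cubic v₀ 3ec in a , λ S lt → b S (ℕ.<-≤-trans lt (s≤s z≤n))
    covered : ∀ e → ∃ λ M → IsPerfectMatching G M × e ∈ M
    covered e = let M , pM , Me = covered-by-perfect e in
      support M , (λ v → trans (deg-support G (perfect≤1 G M pM) v) (pM v)) ,
      lookup⇒∈ (χ-true (subst (1 ≤_) (sym (bits-support (perfect≤1 G M pM) e)) Me))

  module _ (bicritical : ∀ {x z} → x ≢ z → ∃ λ F → ∀ v → d G F v ≡ χ (not (pair x z v))) where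

    private
      -- A perfect matching of G − x₁ − x₂ has to use the third edge of the cut, so
      -- adding e₁ and e₂ gives M, which covers X and uses all three.
      module Half (X : V → Bool) (∣∂X∣ : ⟨ one , cut G X ⟩ ≡ 3) (two : ∀ p → ∃ λ q → X q ≡ true × p ≢ q)
                  {e₁ e₂ : E} (e₁≢e₂ : e₁ ≢ e₂) {x₁ x₂ : V} (i₁ : Incident e₁ x₁) (i₂ : Incident e₂ x₂)
                  (c₁ : cut G X e₁ ≡ 1) (c₂ : cut G X e₂ ≡ 1) (Xx₁ : X x₁ ≡ true) (Xx₂ : X x₂ ≡ true) where

        x₁≢x₂ : x₁ ≢ x₂
        x₁≢x₂ refl = let q , Xq , ne = two x₁ in ℕ.<-irrefl refl (ℕ.≤-trans
          (ℕ.≤-trans (ℕ.≤-reflexive (cong₂ _+_ (sym c₁) (sym c₂))) (shared-end G (cut G X) i₁ i₂ e₁≢e₂))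
          (cut-degree≤1 G cubic 3ec {X} ∣∂X∣ Xx₁ Xq ne))

        F M : E → ℕ
        F = proj₁ (bicritical x₁≢x₂)
        M e = F e + (δ e₁ e + δ e₂ e)

        dF : ∀ v → d G F v ≡ χ (not (pair x₁ x₂ v))
        dF = proj₂ (bicritical x₁≢x₂)

        cut-inc : ∀ {e x v} → Incident e x → cut G X e ≡ 1 → X x ≡ true → X v ≡ true → inc G e v ≡ χ (x == v)
        cut-inc {e} {v = v} (inj₁ refl) c Xx Xv = trans (cong (χ (src G e == v) +_) (cong χ (==-≢ {i = tgt G e} {v} other))) (ℕ.+-identityʳ _)
          where
          other : tgt G e ≢ v
          other eq rewrite Xx | eq | Xv = case c of λ ()
        cut-inc {e} {v = v} (inj₂ refl) c Xx Xv = cong (_+ χ (tgt G e == v)) (cong χ (==-≢ {i = src G e} {v} other))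
          where
          other : src G e ≢ v
          other eq rewrite Xx | eq | Xv = case c of λ ()

        dM : ∀ v → X v ≡ true → d G M v ≡ 1
        dM v Xv = trans (d-+ G F _ v) (trans (cong₂ _+_ (dF v) (trans (d-+ G (δ e₁) (δ e₂) v)
          (trans (cong₂ _+_ (trans (d-δ G e₁ v) (cut-inc i₁ c₁ Xx₁ Xv)) (trans (d-δ G e₂ v) (cut-inc i₂ c₂ Xx₂ Xv))) (sym (χ-pair x₁≢x₂ v)))))
          (χ-not (pair x₁ x₂ v)))

        M≤1 : ∀ e → cut G X e ≡ 1 → M e ≤ 1
        M≤1 e c = let x , _ , Xx , _ , j = cut-ends G X e (ℕ.≤-reflexive (sym c))
                  in ℕ.≤-trans (F≤d G M (joinsˡ G j)) (ℕ.≤-reflexive (dM x Xx))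

        M≥1 : ∀ e → e ≡ e₁ ⊎ e ≡ e₂ → 1 ≤ M e
        M≥1 e (inj₁ refl) rewrite ==-refl e = ℕ.≤-trans (s≤s z≤n) (ℕ.m≤n+m (suc (δ e₂ e)) (F e))
        M≥1 e (inj₂ refl) rewrite ==-refl e = ℕ.≤-trans (ℕ.m≤n+m 1 (δ e₁ e)) (ℕ.m≤n+m _ (F e))

        ⟨M,cut⟩≤ : ∀ e → M e * cut G X e ≤ 1 * cut G X e
        ⟨M,cut⟩≤ e with ≤1-cases (χ≤1 (X (src G e) xor X (tgt G e)))
        ... | inj₁ z rewrite z | ℕ.*-zeroʳ (M e) = z≤n
        ... | inj₂ c = ℕ.*-monoˡ-≤ (cut G X e) (M≤1 e c)

        ⟨M,cut⟩≥2 : 2 ≤ ⟨ M , cut G X ⟩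
        ⟨M,cut⟩≥2 = ℕ.≤-trans (ℕ.+-mono-≤ (term c₁ (inj₁ refl)) (term c₂ (inj₂ refl))) (two-terms≤∑ (λ e → M e * cut G X e) e₁≢e₂)
          where
          term : ∀ {e} → cut G X e ≡ 1 → e ≡ e₁ ⊎ e ≡ e₂ → 1 ≤ M e * cut G X e
          term {e} c p rewrite c | ℕ.*-identityʳ (M e) = M≥1 e p

        volume-M : ∑ (χ ∘ X) ≡ 2 * ⟨ M , ins G X ⟩ + ⟨ M , cut G X ⟩
        volume-M = trans (∑-cong λ v → pointwise v (X v) refl) (volume G X M)
          where
          pointwise : ∀ v b → X v ≡ b → χ (X v) ≡ χ (X v) * d G M v
          pointwise v true  p rewrite p = sym (trans (ℕ.+-identityʳ _) (dM v p))
          pointwise v false p rewrite p = refl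

        -- A three-edge cut makes `|X|` odd, and `M` covers every vertex of `X` once, so it crosses
        -- the cut an odd number of times.
        ⟨M,cut⟩≢2 : ⟨ M , cut G X ⟩ ≢ 2
        ⟨M,cut⟩≢2 eq = even≢odd (3 * (⟨ M , ins G X ⟩ + 1)) (⟨ one , ins G X ⟩ + 1) (trans (expand ⟨ M , ins G X ⟩)
          (trans (cong (3 *_) (sym (trans volume-M (cong (2 * ⟨ M , ins G X ⟩ +_) eq)))) (trans (cubic-volume X)
            (trans (cong (2 * ⟨ one , ins G X ⟩ +_) ∣∂X∣) (expand′ ⟨ one , ins G X ⟩)))))
          where
          expand : ∀ a → 2 * (3 * (a + 1)) ≡ 3 * (2 * a + 2)
          expand = solve-∀
          expand′ : ∀ a → 2 * a + 3 ≡ suc (2 * (a + 1))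
          expand′ = solve-∀

        on-cut : ∀ e → cut G X e ≡ 1 → M e ≡ 1
        on-cut e c = trans (sym (trans (cong (M e *_) c) (ℕ.*-identityʳ _))) (trans (∑-rigid ⟨M,cut⟩≤
          (subst (_≤ ⟨ M , cut G X ⟩) (sym ∣∂X∣) (ℕ.≤∧≢⇒< ⟨M,cut⟩≥2 (⟨M,cut⟩≢2 ∘ sym))) e) (cong (1 *_) c))

      -- Each shore has a matching that uses all three cut edges. The two agree on the cut and
      -- combine into a perfect matching.
      three-cut-not-tight : ∀ X → ⟨ one , cut G X ⟩ ≡ 3 → (∀ p → ∃ λ q → X q ≡ true × p ≢ q) → (∀ p → ∃ λ q → not (X q) ≡ true × p ≢ q) →
        ∃ λ M → IsPerfect G M × ⟨ cut G X , M ⟩ ≡ 3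
      three-cut-not-tight X ∣∂X∣ two two′ with ∑-positive (cut G X) (subst (1 ≤_) (trans (sym ∣∂X∣) (⟨one,⟩ (cut G X))) (s≤s z≤n))
      ... | e₁ , c₁ with another-member (λ g → X (src G g) xor X (tgt G g)) (subst (2 ≤_) (trans (sym ∣∂X∣) (⟨one,⟩ (cut G X))) (s≤s (s≤s z≤n))) e₁
      ... | e₂ , c₂ , e₁≢e₂ with cut-ends G X e₁ c₁ | cut-ends G X e₂ (ℕ.≤-reflexive (cong χ (sym c₂)))
      ... | x₁ , y₁ , Xx₁ , Xy₁ , j₁ | x₂ , y₂ , Xx₂ , Xy₂ , j₂ = M , perfect , cut≡3
        where
        cut≡1 : ∀ {e} → 1 ≤ cut G X e → cut G X e ≡ 1
        cut≡1 = ℕ.≤-antisym (χ≤1 _)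
        not-cut : ∀ {e} → cut G X e ≡ 1 → cut G (not ∘ X) e ≡ 1
        not-cut {e} = trans (cut-not G X e)
        module In = Half X ∣∂X∣ two e₁≢e₂ (joinsˡ G j₁) (joinsˡ G j₂) (cut≡1 c₁) (cong χ c₂) Xx₁ Xx₂
        module Out = Half (not ∘ X) (trans (∑-cong λ e → cong (1 *_) (cut-not G X e)) ∣∂X∣) two′ e₁≢e₂ (joinsʳ G j₁) (joinsʳ G j₂)
                       (not-cut (cut≡1 c₁)) (not-cut (cong χ c₂)) (cong not Xy₁) (cong not Xy₂)
        choose : Bool → Bool → ℕ → ℕ → ℕ
        choose false false a b = b
        choose _     _     a b = a
        M : E → ℕ
        M e = choose (X (src G e)) (X (tgt G e)) (In.M e) (Out.M e)
        cut-value : ∀ {e} → cut G X e ≡ 1 → M e ≡ 1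
        cut-value {e} c = chosen (X (src G e)) (X (tgt G e)) c
          where
          chosen : ∀ a b → χ (a xor b) ≡ 1 → choose a b (In.M e) (Out.M e) ≡ 1
          chosen true  false _ = In.on-cut e c
          chosen false true  _ = In.on-cut e c
        cut≡3 : ⟨ cut G X , M ⟩ ≡ 3
        cut≡3 = trans (∑-cong pointwise) ∣∂X∣
          where
          pointwise : ∀ e → cut G X e * M e ≡ 1 * cut G X e
          pointwise e with ≤1-cases (χ≤1 (X (src G e) xor X (tgt G e)))
          ... | inj₁ z rewrite z = refl
          ... | inj₂ c = trans (cong₂ _*_ c (cut-value c)) (cong (1 *_) (sym c))
        inside : ∀ {e v} → Incident e v → X v ≡ true → M e ≡ In.M e
        inside {e} (inj₁ refl) Xv rewrite Xv = refl
        inside {e} (inj₂ refl) Xv rewrite Xv with X (src G e)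
        ... | true  = refl
        ... | false = refl
        outside : ∀ {e v} → Incident e v → X v ≡ false → M e ≡ Out.M e
        outside {e} {v} i Xv = decide (≤1-cases (χ≤1 (X (src G e) xor X (tgt G e))))
          where
          both-out : ∀ {a b} → χ (a xor b) ≡ 0 → a ≡ false ⊎ b ≡ false → a ≡ false × b ≡ false
          both-out {false} {false} _ _ = refl , refl
          both-out {true}  {true}  _ (inj₁ ())
          both-out {true}  {true}  _ (inj₂ ())
          decide : cut G X e ≡ 0 ⊎ cut G X e ≡ 1 → M e ≡ Out.M e
          decide (inj₂ c) = trans (cut-value c) (sym (Out.on-cut e (not-cut c)))
          decide (inj₁ z) = let p , q = both-out {X (src G e)} {X (tgt G e)} z (end i) in cong₂ (λ a b → choose a b (In.M e) (Out.M e)) p q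
            where
            end : Incident e v → X (src G e) ≡ false ⊎ X (tgt G e) ≡ false
            end (inj₁ p) = inj₁ (trans (cong X p) Xv)
            end (inj₂ p) = inj₂ (trans (cong X p) Xv)
        local : ∀ {F v} → (∀ {e} → Incident e v → M e ≡ F e) → d G M v ≡ d G F v
        local {F} {v} p = ∑-cong pointwise
          where
          pointwise : ∀ e → M e * inc G e v ≡ F e * inc G e v
          pointwise e with inc G e v ℕ.≟ 0
          ... | yes z rewrite z = trans (ℕ.*-zeroʳ (M e)) (sym (ℕ.*-zeroʳ (F e)))
          ... | no nz = cong (_* inc G e v) (p (inc⇒Incident G nz))
        perfect : IsPerfect G M
        perfect v = decide (X v) refl
          where
          decide : ∀ b → X v ≡ b → d G M v ≡ 1
          decide true  Xv = trans (local λ i → inside i Xv) (In.dM v Xv)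
          decide false Xv = trans (local λ i → outside i Xv) (Out.dM v (cong not Xv))

    bicritical⇒brick : V → ¬ IsBipartite G → IsBrick G
    bicritical⇒brick v₀ nonbip = nonbip , matching-covered v₀ , trivial
      where
      trivial : ∀ X → IsTight G X → IsTrivial G X
      trivial X tight with ∣ X ∣ ℕ.≤? 1 | ∣ ∁ X ∣ ℕ.≤? 1
      ... | yes p | _     = inj₁ p
      ... | no _  | yes p = inj₂ p
      ... | no p  | no q  = ⊥-elim (not-tight (three-cut-not-tight (lookup X) (ℕ.≤-antisym cut≤3 cut≥3) two two′))
        where
        two : ∀ p → ∃ λ q → lookup X q ≡ true × p ≢ q
        two = another-member (lookup X) (subst (2 ≤_) (card X) (ℕ.≰⇒> p))
        two′ : ∀ p → ∃ λ q → not (lookup X q) ≡ true × p ≢ q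
        two′ = another-member (not ∘ lookup X) (subst (2 ≤_) (trans (card (∁ X)) (∑-cong λ v → cong χ (lookup-map v not X))) (ℕ.≰⇒> q))
        crossings : ∀ M → IsPerfect G M → ⟨ cut G (lookup X) , M ⟩ ≡ 1
        crossings M pM = trans (sym (trans (∣∂∩∣ G X (support M)) (⟨,⟩-congʳ (cut G (lookup X)) (bits-support (perfect≤1 G M pM)))))
          (tight (support M) λ v → trans (deg-support G (perfect≤1 G M pM) v) (pM v))
        not-tight : (∃ λ M → IsPerfect G M × ⟨ cut G (lookup X) , M ⟩ ≡ 3) → ∅
        not-tight (M , pM , eq) = case trans (sym (crossings M pM)) eq of λ ()
        cut≤3 : ⟨ one , cut G (lookup X) ⟩ ≤ 3
        cut≤3 with perfect-matching (cut G (lookup X)) (λ e → χ≤1 _)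
        ... | M , pM , le = subst₂ _≤_ (sym (⟨one,⟩ _)) (cong (3 *_) (crossings M pM)) le
        flip : ∀ {b} → not b ≡ true → b ≡ false
        flip {false} _ = refl
        cut≥3 : 3 ≤ ⟨ one , cut G (lookup X) ⟩
        cut≥3 = 3ec (lookup X) (let z , Xz , _ = two v₀ in z , Xz) (let z , Xz , _ = two′ v₀ in z , flip Xz)

-- Contraction along a barrier

-- Enumerates a subset in order, so that the vertices and edges that survive a contraction again
-- form types `Fin k`, as `Graph` demands.
element : (p : Subset k) → Fin ∣ p ∣ → Fin k
element (true  ∷ p) zero    = zero
element (true  ∷ p) (suc i) = suc (element p i)
element (false ∷ p) i       = suc (element p i)

index : (p : Subset k) (x : Fin k) → lookup p x ≡ true → Fin ∣ p ∣
index (true  ∷ p) zero    _ = zero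
index (true  ∷ p) (suc x) q = suc (index p x q)
index (false ∷ p) (suc x) q = index p x q

element-∈ : (p : Subset k) (i : Fin ∣ p ∣) → lookup p (element p i) ≡ true
element-∈ (true  ∷ p) zero    = refl
element-∈ (true  ∷ p) (suc i) = element-∈ p i
element-∈ (false ∷ p) i       = element-∈ p i

element-index : (p : Subset k) (x : Fin k) (q : lookup p x ≡ true) → element p (index p x q) ≡ x
element-index (true  ∷ p) zero    _ = refl
element-index (true  ∷ p) (suc x) q = cong suc (element-index p x q)
element-index (false ∷ p) (suc x) q = cong suc (element-index p x q)

element-injective : (p : Subset k) {i j : Fin ∣ p ∣} → element p i ≡ element p j → i ≡ j
element-injective (true  ∷ p) {zero}  {zero}  _ = refl
element-injective (true  ∷ p) {suc i} {suc j} q = cong suc (element-injective p (Fin.suc-injective q))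
element-injective (false ∷ p) q = element-injective p (Fin.suc-injective q)

∑-element : (p : Subset k) (f : Fin k → ℕ) → (∀ x → lookup p x ≡ false → f x ≡ 0) → ∑ (f ∘ element p) ≡ ∑ f
∑-element []          f z = trans (∑-[] _) (sym (∑-[] f))
∑-element (true  ∷ p) f z = trans (∑-∷ _) (trans (cong (f zero +_) (∑-element p (f ∘ suc) (z ∘ suc))) (sym (∑-∷ f)))
∑-element (false ∷ p) f z = trans (∑-element p (f ∘ suc) (z ∘ suc)) (sym (trans (∑-∷ f) (cong (_+ ∑ (f ∘ suc)) (z zero refl))))

-- G with every class of the idempotent map c contracted to a single vertex.
module Quotient (G : Graph) (c : Graph.V G → Graph.V G) (c-idem : ∀ v → c (c v) ≡ c v) where
  open Graph G

  opaque

    reps : Subset n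
    reps = tabulate λ v → c v == v

    kept : Subset m
    kept = tabulate λ e → not (c (src G e) == c (tgt G e))

    rep : Fin ∣ reps ∣ → V
    rep = element reps

    cls : V → Fin ∣ reps ∣
    cls v = index reps (c v) (trans (lookup∘tabulate _ (c v)) (trans (cong (_== c v) (c-idem v)) (==-refl (c v))))

    rep-cls : ∀ v → rep (cls v) ≡ c v
    rep-cls v = element-index reps (c v) _

    c-rep : ∀ p → c (rep p) ≡ rep p
    c-rep p = ==-sound (trans (sym (lookup∘tabulate _ (rep p))) (element-∈ reps p))

    rep-injective : ∀ {p q} → rep p ≡ rep q → p ≡ q
    rep-injective = element-injective reps

    order< : ∀ v → c v ≢ v → ∣ reps ∣ < n
    order< v ne = subst₂ _<_ (sym (card reps)) (∑-one n) (∑-< (λ v → χ≤1 (lookup reps v)) v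
      (s≤s (ℕ.≤-reflexive (cong χ (trans (lookup∘tabulate _ v) (==-≢ ne))))))

    edge : Fin ∣ kept ∣ → E
    edge = element kept

    edge-kept : ∀ i → c (src G (edge i)) ≢ c (tgt G (edge i))
    edge-kept i eq = case trans (sym (trans (sym (lookup∘tabulate _ (edge i))) (element-∈ kept i)))
      (cong not (trans (cong (_== c (tgt G (edge i))) eq) (==-refl (c (tgt G (edge i)))))) of λ ()

    edge⁻ : ∀ e → c (src G e) ≢ c (tgt G e) → Fin ∣ kept ∣
    edge⁻ e ne = index kept e (trans (lookup∘tabulate _ e) (cong not (==-≢ ne)))

    edge-edge⁻ : ∀ e ne → edge (edge⁻ e ne) ≡ e
    edge-edge⁻ e ne = element-index kept e _

    edge-injective : ∀ {i j} → edge i ≡ edge j → i ≡ j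
    edge-injective = element-injective kept

    ∑-edge : ∀ f → (∀ e → c (src G e) ≡ c (tgt G e) → f e ≡ 0) → ∑ (f ∘ edge) ≡ ∑ f
    ∑-edge f z = ∑-element kept f λ e p → z e (==-sound (Bool.not-injective (trans (sym (lookup∘tabulate _ e)) p)))

  cls-rep : ∀ p → cls (rep p) ≡ p
  cls-rep p = rep-injective (trans (rep-cls (rep p)) (c-rep p))

  cls-≡ : ∀ {u v} → c u ≡ c v → cls u ≡ cls v
  cls-≡ {u} {v} eq = rep-injective (trans (rep-cls u) (trans eq (sym (rep-cls v))))

  cls-≡⁻ : ∀ {u v} → cls u ≡ cls v → c u ≡ c v
  cls-≡⁻ {u} {v} eq = trans (sym (rep-cls u)) (trans (cong rep eq) (rep-cls v))

  Q : Graph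
  Q = record { n = ∣ reps ∣ ; m = ∣ kept ∣ ; ends = λ i → cls (src G (edge i)) , cls (tgt G (edge i))
             ; loopless = λ i eq → edge-kept i (cls-≡⁻ eq) }

  cut-Q : ∀ F X → ⟨ F ∘ edge , cut Q X ⟩ ≡ ⟨ F , cut G (X ∘ cls) ⟩
  cut-Q F X = ∑-edge (λ e → F e * cut G (X ∘ cls) e) λ e eq → trans (cong (F e *_)
    (trans (cong (λ x → χ (X x xor X (cls (tgt G e)))) (cls-≡ eq)) (cong χ (Bool.xor-same (X (cls (tgt G e))))))) (ℕ.*-zeroʳ (F e))

  d-Q : ∀ F p → d Q (F ∘ edge) p ≡ ⟨ F , cut G (λ v → c v == rep p) ⟩
  d-Q F p = trans (∑-cong λ i → cong (F (edge i) *_) (sym (cut-point Q p i))) (trans (cut-Q F (p ==_))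
    (∑-cong λ e → cong (F e *_) (cut-cong G same e)))
    where
    same : ∀ v → (p == cls v) ≡ (c v == rep p)
    same v with p ≟ cls v | c v ≟ rep p
    ... | yes _ | yes _ = refl
    ... | no _  | no _  = refl
    ... | yes a | no b  = ⊥-elim (b (trans (sym (rep-cls v)) (cong rep (sym a))))
    ... | no a  | yes b = ⊥-elim (a (rep-injective (trans (sym b) (sym (rep-cls v)))))

  regular-Q : (∀ p → c p ≡ p → ⟨ one , cut G (λ v → c v == p) ⟩ ≡ 3) → IsThreeRegular Q
  regular-Q cut3 p = trans (d-Q one p) (cut3 (rep p) (c-rep p))

  3ec-Q : IsThreeEdgeConnected G → IsThreeEdgeConnected Q
  3ec-Q 3ec X (x , Xx) (z , Xz) = subst (3 ≤_) (sym (cut-Q one X))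
    (3ec (X ∘ cls) (rep x , trans (cong X (cls-rep x)) Xx) (rep z , trans (cong X (cls-rep z)) Xz))

module _ (G : Graph) (A : Graph.V G → Bool) (bip : ∀ e → cut G A e ≡ 1) (cubic : IsThreeRegular G) (F : Graph.E G → ℕ) where
  open Graph G

  opaque
    -- Both classes have the same size and the same degree sum `∑ F`, so the degrees on `A` average
    -- one; being at least one, they equal one.
    bipartite-ones : (∀ v → A v ≡ false → d G F v ≡ 1) → (∀ v → A v ≡ true → 1 ≤ d G F v) → ∀ v → A v ≡ true → d G F v ≡ 1
    bipartite-ones off on v Av = sym (trans (sym (trans (cong χ Av) refl)) (trans (∑-rigid le total v) (trans (cong (λ b → χ b * d G F v) Av) (ℕ.+-identityʳ _))))
      where
      le : ∀ v → χ (A v) ≤ χ (A v) * d G F v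
      le v with A v in eq
      ... | false = z≤n
      ... | true  = subst (1 ≤_) (sym (ℕ.+-identityʳ _)) (on v eq)
      off-sum : ∑ (λ v → χ (not (A v)) * d G F v) ≡ ∑ (χ ∘ not ∘ A)
      off-sum = ∑-cong pointwise
        where
        pointwise : ∀ v → χ (not (A v)) * d G F v ≡ χ (not (A v))
        pointwise v with A v in eq
        ... | true  = refl
        ... | false = trans (ℕ.+-identityʳ _) (off v eq)
      total : ∑ (λ v → χ (A v) * d G F v) ≤ ∑ (χ ∘ A)
      total = ℕ.≤-reflexive (trans (colour-sum G A bip F) (trans (sym (colour-sum′ G A bip F)) (trans off-sum (sym (balanced G A bip cubic)))))

  opaque
    -- On `A` write each degree as `1 + 2 g`. The other class has a surplus of two at `b`, so the
    -- values `g` sum to 1 and a single vertex of `A` takes the whole surplus.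
    bipartite-pair : ∀ {b} → A b ≡ false → d G F b ≡ 3 → (∀ v → A v ≡ false → v ≢ b → d G F v ≡ 1) →
      (∀ v → A v ≡ true → ∃ λ g → d G F v ≡ suc (2 * g)) →
      ∃ λ a → A a ≡ true × d G F a ≡ 3 × (∀ v → A v ≡ true → v ≢ a → d G F v ≡ 1)
    bipartite-pair {b} Ab at off odd = a , Aa , dist Aa gA≡1 , λ v Av ne → dist Av (others v Av ne)
      where
      pick : ∀ v x → A v ≡ x → ∃ λ g → A v ≡ true → d G F v ≡ suc (2 * g)
      pick v true  p = proj₁ (odd v p) , λ _ → proj₂ (odd v p)
      pick v false p = 0 , λ q → case trans (sym p) q of λ ()
      g : V → ℕ
      g v = proj₁ (pick v (A v) refl)
      degree : ∀ v → A v ≡ true → d G F v ≡ suc (2 * g v)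
      degree v = proj₂ (pick v (A v) refl)
      degree-on : ∀ v → χ (A v) * d G F v ≡ χ (A v) + 2 * (χ (A v) * g v)
      degree-on v = aux (A v) refl
        where
        aux : ∀ x → A v ≡ x → χ x * d G F v ≡ χ x + 2 * (χ x * g v)
        aux false _ = refl
        aux true  p = trans (ℕ.+-identityʳ _) (trans (degree v p) (cong (λ x → suc (2 * x)) (sym (ℕ.+-identityʳ (g v)))))
      degree-off : ∀ v → χ (not (A v)) * d G F v ≡ χ (not (A v)) + 2 * χ (b == v)
      degree-off v with b ≟ v
      ... | yes refl rewrite Ab | at = refl
      ... | no ne with A v in eq
      ... | true  = refl
      ... | false = trans (ℕ.+-identityʳ _) (off v eq (ne ∘ sym))
      ∑g : ∑ (λ v → χ (A v) * g v) ≡ 1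
      ∑g = ℕ.*-cancelˡ-≡ _ _ 2 (ℕ.+-cancelˡ-≡ (∑ (χ ∘ A)) _ _ (begin
        ∑ (χ ∘ A) + 2 * ∑ (λ v → χ (A v) * g v)    ≡⟨ cong (∑ (χ ∘ A) +_) (∑-*ˡ 2 _) ⟨
        ∑ (χ ∘ A) + ∑ (λ v → 2 * (χ (A v) * g v))  ≡⟨ ∑-+ _ _ ⟨
        ∑ (λ v → χ (A v) + 2 * (χ (A v) * g v))    ≡⟨ ∑-cong degree-on ⟨
        ∑ (λ v → χ (A v) * d G F v)                ≡⟨ colour-sum G A bip F ⟩
        ∑ F                                        ≡⟨ colour-sum′ G A bip F ⟨
        ∑ (λ v → χ (not (A v)) * d G F v)          ≡⟨ ∑-cong degree-off ⟩
        ∑ (λ v → χ (not (A v)) + 2 * χ (b == v))   ≡⟨ ∑-+ _ _ ⟩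
        ∑ (χ ∘ not ∘ A) + ∑ (λ v → 2 * χ (b == v)) ≡⟨ cong₂ _+_ (sym (balanced G A bip cubic)) (trans (∑-*ˡ 2 _) (cong (2 *_) (∑-point b))) ⟩
        ∑ (χ ∘ A) + 2                              ∎))
        where open ≡-Reasoning
      found : ∃ λ a → 1 ≤ χ (A a) * g a
      found = ∑-positive (λ v → χ (A v) * g v) (ℕ.≤-reflexive (sym ∑g))
      a : V
      a = proj₁ found
      Aa : A a ≡ true
      Aa = χ-true (proj₁ (1≤* {χ (A a)} (proj₂ found)))
      gA≡1 : χ (A a) * g a ≡ 1
      gA≡1 = ℕ.≤-antisym (subst (χ (A a) * g a ≤_) ∑g (term≤∑ (λ v → χ (A v) * g v) a)) (proj₂ found)
      others : ∀ v → A v ≡ true → v ≢ a → χ (A v) * g v ≡ 0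
      others v Av ne = ℕ.n≤0⇒n≡0 (ℕ.+-cancelʳ-≤ 1 _ _ (subst₂ _≤_ (cong (χ (A v) * g v +_) gA≡1) ∑g (two-terms≤∑ (λ v → χ (A v) * g v) ne)))
      dist : ∀ {v x} → A v ≡ true → χ (A v) * g v ≡ x → d G F v ≡ suc (2 * x)
      dist {v} Av eq = trans (degree v Av) (cong (λ x → suc (2 * x)) (trans (sym (ℕ.+-identityʳ (g v))) (trans (cong (λ b → χ b * g v) (sym Av)) eq)))

module BarrierQuotient (G : Graph) (cubic : IsThreeRegular G) (3ec : IsThreeEdgeConnected G) (𝓑 : Barrier G) where
  open Graph G
  open Barrier 𝓑
  open Cubic G cubic
  open Quotient G c c-idem public renaming (Q to H)

  A : Graph.V H → Bool
  A p = not (B (rep p))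

  H-regular : IsThreeRegular H
  H-regular = regular-Q class-cut

  A-cls : ∀ v → A (cls v) ≡ not (B v)
  A-cls v = cong not (trans (cong B (rep-cls v)) (B-c v))

  H-bipartite : ∀ i → cut H A i ≡ 1
  H-bipartite i = trans (cong₂ (λ a b → χ (a xor b)) (A-cls (src G (edge i))) (A-cls (tgt G (edge i)))) (ends-differ _ _ refl refl)
    where
    ends-differ : ∀ a b → B (src G (edge i)) ≡ a → B (tgt G (edge i)) ≡ b → χ (not a xor not b) ≡ 1
    ends-differ true  false _ _ = refl
    ends-differ false true  _ _ = refl
    ends-differ true  true  p q = ⊥-elim (stable (edge i) p q)
    ends-differ false false p q = ⊥-elim (edge-kept i (together (edge i) p q))

  d-singleton : ∀ F p → (∀ v → c v ≡ rep p → v ≡ rep p) → d H (F ∘ edge) p ≡ d G F (rep p)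
  d-singleton F p single = trans (d-Q F p) (∑-cong λ e → cong (F e *_) (trans (cut-cong G same e) (cut-point G (rep p) e)))
    where
    same : ∀ v → (c v == rep p) ≡ (rep p == v)
    same v with c v ≟ rep p | rep p ≟ v
    ... | yes _ | yes _ = refl
    ... | no _  | no _  = refl
    ... | no x  | yes refl = ⊥-elim (x (c-rep p))
    ... | yes x | no y  = ⊥-elim (y (sym (single v x)))

  d-at-B : ∀ F p → A p ≡ false → d H (F ∘ edge) p ≡ d G F (rep p)
  d-at-B F p Ap = d-singleton F p λ v eq → trans (sym (c-on-B v (trans (sym (B-c v)) (trans (cong B eq) (Bool.not-injective Ap))))) eq

  -- Classes have odd size because their cuts have three edges.
  opaque
    class-odd : ∀ F p → (∀ v → c v ≡ rep p → ∃ λ g → d G F v ≡ suc (2 * g)) → ∃ λ g → d H (F ∘ edge) p ≡ suc (2 * g)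
    class-odd F p odd with half (d H (F ∘ edge) p)
    ... | q , inj₂ eq = q , eq
    -- Everything is tripled so that `cubic-volume` can express the size of the class by edge
    -- counts, whose parity is known.
    ... | q , inj₁ eq = ⊥-elim (even≢odd (3 * (φ + q)) (3 * Γ + (ι + 1)) (begin
      2 * (3 * (φ + q))                         ≡⟨ expand φ q ⟩
      3 * (2 * φ + 2 * q)                       ≡⟨ cong (λ x → 3 * (2 * φ + x)) (trans (sym eq) (d-Q F p)) ⟩
      3 * (2 * φ + κ)                           ≡⟨ cong (3 *_) (sym (volume G K F)) ⟩
      3 * ∑ (λ v → χ (K v) * d G F v)           ≡⟨ cong (3 *_) (trans (∑-cong degree) (trans (∑-+ _ _) (cong (∑ (χ ∘ K) +_) (∑-*ˡ 2 _)))) ⟩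
      3 * (∑ (χ ∘ K) + 2 * Γ)                   ≡⟨ ℕ.*-distribˡ-+ 3 (∑ (χ ∘ K)) (2 * Γ) ⟩
      3 * ∑ (χ ∘ K) + 3 * (2 * Γ)               ≡⟨ cong (_+ 3 * (2 * Γ)) (trans (cubic-volume K) (cong (2 * ι +_) (class-cut (rep p) (c-rep p)))) ⟩
      2 * ι + 3 + 3 * (2 * Γ)                   ≡⟨ collect ι Γ ⟩
      suc (2 * (3 * Γ + (ι + 1)))               ∎))
      where
      open ≡-Reasoning
      K : V → Bool
      K v = c v == rep p
      φ κ ι : ℕ
      φ = ⟨ F , ins G K ⟩
      κ = ⟨ F , cut G K ⟩
      ι = ⟨ one , ins G K ⟩
      g : V → ℕ
      g v with c v ≟ rep p
      ... | yes eq = proj₁ (odd v eq)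
      ... | no _   = 0
      Γ : ℕ
      Γ = ∑ (λ v → χ (K v) * g v)
      degree : ∀ v → χ (K v) * d G F v ≡ χ (K v) + 2 * (χ (K v) * g v)
      degree v with c v ≟ rep p
      ... | no _   = refl
      ... | yes eq = trans (ℕ.+-identityʳ _) (trans (proj₂ (odd v eq)) (cong (λ x → suc (2 * x)) (sym (ℕ.+-identityʳ (proj₁ (odd v eq))))))
      expand : ∀ a q → 2 * (3 * (a + q)) ≡ 3 * (2 * a + 2 * q)
      expand = solve-∀
      collect : ∀ a g → 2 * a + 3 + 3 * (2 * g) ≡ suc (2 * (3 * g + (a + 1)))
      collect = solve-∀

  opaque
    -- Parity makes the degree at a contracted component odd, hence positive, and the balance of the
    -- colour classes then leaves only the value one. The hypotheses fit perfect matchings and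
    -- λ-matchings centred outside the barrier alike.
    class-ones : ∀ F → (∀ v → B v ≡ true → d G F v ≡ 1) → (∀ v → ∃ λ g → d G F v ≡ suc (2 * g)) → ∀ p → d H (F ∘ edge) p ≡ 1
    class-ones F on-B odd p = decide (A p) refl
      where
      off : ∀ p → A p ≡ false → d H (F ∘ edge) p ≡ 1
      off p Ap = trans (d-at-B F p Ap) (on-B (rep p) (Bool.not-injective Ap))
      decide : ∀ b → A p ≡ b → d H (F ∘ edge) p ≡ 1
      decide false Ap = off p Ap
      decide true  Ap = bipartite-ones H A H-bipartite H-regular (F ∘ edge) off
        (λ v _ → let q , eq = class-odd F v (λ z _ → odd z) in subst (1 ≤_) (sym eq) (s≤s z≤n)) p Ap

module _ (G : Graph) where
  open Graph G

  -- Without a third vertex each edge would join `u` to `x`, and `{u}` would be a colour class.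
  third-vertex : ¬ IsBipartite G → ∀ u x → ∃ λ z → z ≢ u × z ≢ x
  third-vertex nonbip u x with any? (λ z → ¬? (z ≟ u) ×-dec ¬? (z ≟ x))
  ... | yes w   = w
  ... | no none = ⊥-elim (nonbip (⁅ u ⁆ , λ e → lookup⇒∈ (trans (lookup∘tabulate _ e)
          (trans (cong₂ _xor_ (lookup-⁅⁆ u (src G e)) (lookup-⁅⁆ u (tgt G e))) (crosses e)))))
    where
    only : ∀ z → z ≢ u → z ≡ x
    only z ne = decidable-stable (z ≟ x) λ p → none (z , ne , p)
    crosses : ∀ e → ((u == src G e) xor (u == tgt G e)) ≡ true
    crosses e with u ≟ src G e | u ≟ tgt G e
    ... | yes a | yes b = ⊥-elim (loopless e (trans (sym a) b))
    ... | yes _ | no _  = refl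
    ... | no _  | yes _ = refl
    ... | no a  | no b  = ⊥-elim (loopless e (trans (only _ (a ∘ sym)) (sym (only _ (b ∘ sym)))))

module _ (G : Graph) (cubic : IsThreeRegular G) (brick : IsBrick G) where
  open Graph G

  -- By `class-ones` the cut of each class is tight. Outside the class of a vertex off the barrier
  -- there are the two barrier vertices, so the class itself is a single vertex. Then the barrier
  -- and its complement are both stable, and the brick would be bipartite.
  brick⇒no-barrier : (𝓑 : Barrier G) → let open Barrier 𝓑 in ∀ {x z} → B x ≡ true → B z ≡ true → x ≢ z → ∅
  brick⇒no-barrier 𝓑 {x} {z} Bx Bz x≢z = proj₁ brick (tabulate B , bipartition)
    where
    open Barrier 𝓑
    open BarrierQuotient G cubic (brick⇒3ec G cubic brick) 𝓑
    class : V → V → Bool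
    class v w = c w == c v
    tight : ∀ v → IsTight G (tabulate (class v))
    tight v M pM = trans (∣∂∩∣ G (tabulate (class v)) M) (trans (∑-cong λ g → cong (_* bits M g) (cut-cong G (lookup∘tabulate (class v)) g))
      (trans (⟨,⟩-comm _ (bits M)) (trans (∑-cong λ g → cong (bits M g *_) (cut-cong G (λ w → cong (c w ==_) (sym (rep-cls v))) g))
        (trans (sym (d-Q (bits M) (cls v))) (class-ones (bits M) (λ v _ → perfect v) (λ v → 0 , perfect v) (cls v))))))
      where
      perfect : IsPerfect G (bits M)
      perfect v = trans (sym (deg≡d G M v)) (pM v)
    discrete : ∀ v → B v ≡ false → ∀ w → c w ≡ c v → w ≡ v
    discrete v Bv w eq with proj₂ (proj₂ brick) (tabulate (class v)) (tight v)
    ... | inj₁ small = size≤1 (tabulate (class v)) small (trans (lookup∘tabulate _ w) (trans (cong (_== c v) eq) (==-refl (c v))))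
            (trans (lookup∘tabulate _ v) (==-refl (c v)))
    ... | inj₂ small = ⊥-elim (x≢z (size≤1 (∁ (tabulate (class v))) small (outside Bx) (outside Bz)))
      where
      outside : ∀ {b} → B b ≡ true → lookup (∁ (tabulate (class v))) b ≡ true
      outside {b} Bb = trans (lookup-map b not (tabulate (class v))) (cong not (trans (lookup∘tabulate (class v) b)
        (==-≢ λ eq → case trans (sym Bb) (trans (sym (B-c b)) (trans (cong B eq) (trans (B-c v) Bv))) of λ ())))
    bipartition : IsBipartition G (tabulate B)
    bipartition e = lookup⇒∈ (trans (lookup∘tabulate _ e) (trans (cong₂ _xor_ (lookup∘tabulate B (src G e)) (lookup∘tabulate B (tgt G e))) (differ _ _ refl refl)))
      where
      differ : ∀ a b → B (src G e) ≡ a → B (tgt G e) ≡ b → (a xor b) ≡ true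
      differ true  false _ _ = refl
      differ false true  _ _ = refl
      differ true  true  p q = ⊥-elim (stable e p q)
      differ false false p q = ⊥-elim (loopless e (discrete (tgt G e) q (src G e) (together e p q)))

  brick⇒matchable : ∀ v → λ-Matchable G v
  brick⇒matchable v = decidable-stable (λ-matchable? G v) λ none →
    let 𝓑 , _ , _ , x , z , Bx , Bz , ne = unmatchable⇒barrier G cubic (brick⇒3ec G cubic brick) v (third-vertex G (proj₁ brick) v) (none ∘ fromλ G)
    in brick⇒no-barrier 𝓑 Bx Bz ne

-- Splicing

∈-irrelevant : {p : Subset k} {x : Fin k} (s t : x ∈ p) → s ≡ t
∈-irrelevant here      here      = refl
∈-irrelevant (there s) (there t) = cong there (∈-irrelevant s t)

∈─⇒∉ : {p q : Subset k} {x : Fin k} → x ∈ p ─ q → x ∉ q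
∈─⇒∉ {p = _ ∷ _} {true  ∷ _} {zero}  ()
∈─⇒∉ {p = _ ∷ _} {false ∷ _} {zero}  _ ()
∈─⇒∉ {p = _ ∷ p} {_ ∷ q}     {suc x} (there s) (there t) = ∈─⇒∉ {p = p} s t

module _ (G : Graph) where
  open Graph G

  Incident-irrelevant : ∀ {e v} (i j : Incident e v) → i ≡ j
  Incident-irrelevant (inj₁ refl) (inj₁ refl) = refl
  Incident-irrelevant (inj₂ refl) (inj₂ refl) = refl
  Incident-irrelevant {e} (inj₁ p) (inj₂ q) = ⊥-elim (loopless e (trans p (sym q)))
  Incident-irrelevant {e} (inj₂ p) (inj₁ q) = ⊥-elim (loopless e (trans q (sym p)))

  ∂-≡ : ∀ {v} {e f : E[∂ v ]} → proj₁ e ≡ proj₁ f → e ≡ f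
  ∂-≡ {e = e , i} {f = .e , j} refl = cong (e ,_) (Incident-irrelevant i j)

  incident? : ∀ e v → Dec (Incident e v)
  incident? e v = (src G e ≟ v) ⊎-dec (tgt G e ≟ v)

  at-other : ∀ {v} (e : E[∂ v ]) → Incident (proj₁ e) (otherEnd e)
  at-other (e , inj₁ _) = inj₂ refl
  at-other (e , inj₂ _) = inj₁ refl

  other-unique : ∀ {v y} (e : E[∂ v ]) → Incident (proj₁ e) y → y ≢ v → otherEnd e ≡ y
  other-unique (e , inj₁ p) (inj₁ q) ne = ⊥-elim (ne (trans (sym q) p))
  other-unique (e , inj₁ p) (inj₂ q) ne = q
  other-unique (e , inj₂ p) (inj₁ q) ne = q
  other-unique (e , inj₂ p) (inj₂ q) ne = ⊥-elim (ne (trans (sym q) p))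

  one-hot : ∀ F {v} (e₀ : E[∂ v ]) → d G F v ≡ 1 → 1 ≤ F (proj₁ e₀) → ∀ (e : E[∂ v ]) → F (proj₁ e) ≡ χ (proj₁ e₀ == proj₁ e)
  one-hot F {v} (e₀ , i₀) dF F₀ (e , i) with e₀ ≟ e
  ... | yes refl = ℕ.≤-antisym (subst (F e ≤_) dF (F≤d G F i)) F₀
  ... | no ne    = ℕ.n≤0⇒n≡0 (ℕ.+-cancelˡ-≤ 1 _ _ (ℕ.≤-trans (ℕ.+-monoˡ-≤ (F e) F₀) (subst (F e₀ + F e ≤_) dF (shared-end G F i₀ i ne))))

  all-hot : IsThreeRegular G → ∀ F {v} → (∀ e → F e ≤ 1) → d G F v ≡ 3 → ∀ (e : E[∂ v ]) → F (proj₁ e) ≡ 1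
  all-hot cubic F {v} F≤1 dF (e , i) = trans (sym (trans (cong (F e *_) (Incident⇒inc G i)) (ℕ.*-identityʳ (F e))))
    (trans (∑-rigid {f = λ e → F e * inc G e v} {λ e → 1 * inc G e v} (λ e → ℕ.*-monoˡ-≤ (inc G e v) (F≤1 e)) (ℕ.≤-reflexive (trans (cubic v) (sym dF))) e)
      (trans (ℕ.+-identityʳ _) (Incident⇒inc G i)))

  -- `n` is even; if the degree at `v` were 0, the degree sum would be the odd number `n − 1`.
  odd-star : IsThreeRegular G → ∀ F v → (∀ z → z ≢ v → d G F z ≡ 1) → 1 ≤ d G F v
  odd-star cubic F v off = ℕ.n≢0⇒n>0 λ at → let b , n≡2b = Cubic.even-order G cubic in
    even≢odd b (∑ F) (trans (sym n≡2b) (trans (sym (∑-one n)) (trans (∑-cong (degree at)) (trans (∑-+ _ _)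
      (trans (cong₂ _+_ (∑-degrees G F) (∑-point v)) (ℕ.+-comm _ 1))))))
    where
    degree : d G F v ≡ 0 → ∀ z → 1 ≡ d G F z + χ (v == z)
    degree at z with v ≟ z
    ... | yes refl = sym (cong (_+ 1) at)
    ... | no ne    = sym (trans (ℕ.+-identityʳ _) (off z (ne ∘ sym)))

  -- The bound on the single values of `F` comes from the degrees: every edge has an end other than
  -- `u`, where the degree is one.
  target⇒λ : ∀ {u} F → (∀ v → d G F v ≡ 1 + 2 * χ (u == v)) → IsλMatching G u F
  target⇒λ {u} F dF = small , trans (dF u) (cong (λ b → 1 + 2 * χ b) (==-refl u)) , off
    where
    off : ∀ z → z ≢ u → d G F z ≡ 1
    off z ne = trans (dF z) (cong (λ b → 1 + 2 * χ b) (==-≢ (ne ∘ sym)))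
    small : ∀ e → F e ≤ 1
    small e with src G e ≟ u
    ... | no ne = ℕ.≤-trans (F≤d G F (inj₁ refl)) (ℕ.≤-reflexive (off _ ne))
    ... | yes p = ℕ.≤-trans (F≤d G F (inj₂ refl)) (ℕ.≤-reflexive (off _ λ q → loopless e (trans p (sym q))))

-- Degrees in different graphs are compared through an injection of the incident edges. Used in both
-- directions, it shows that splicing preserves degrees.
d-≤ : (G G′ : Graph) → let module G = Graph G ; module G′ = Graph G′ in
  ∀ F F′ {v x} (k : G.E[∂ v ] → G′.E[∂ x ]) → (∀ p → F (proj₁ p) ≤ F′ (proj₁ (k p))) →
  (∀ p q → proj₁ (k p) ≡ proj₁ (k q) → proj₁ p ≡ proj₁ q) → d G F v ≤ d G′ F′ x
d-≤ G G′ F F′ {v} {x} k le inj = ∑-≤-injection (λ e → F e * inc G e v) (λ e → F′ e * inc G′ e x)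
  (λ e nz → proj₁ (k (e , i e nz)))
  (λ e nz → ℕ.*-mono-≤ (le (e , i e nz)) (ℕ.≤-trans (inc≤1 G e v) (ℕ.≤-reflexive (sym (Incident⇒inc G′ (proj₂ (k (e , i e nz))))))))
  (λ e p f q → inj (e , i e p) (f , i f q))
  where
  i : ∀ e → F e * inc G e v ≢ 0 → Graph.Incident G e v
  i e nz = inc⇒Incident G λ z → nz (trans (cong (F e *_) z) (ℕ.*-zeroʳ (F e)))

module Splicing (G H : Graph) (S : Subset (Graph.n H)) (plug : ∀ a → a ∈ S → Plug H a) (φ : ⟦ G ⟧ ≅ splice H S plug) where
  private
    module G = Graph G
    module H = Graph H

  guestGraph : ∀ a → a ∈ S → Graph
  guestGraph a s = Plug.graph (plug a s)

  at : ∀ a s → Graph.V (guestGraph a s)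
  at a s = Plug.at (plug a s)

  SV SE : Set
  SV = SpliceV H S plug
  SE = SpliceE H S plug

  toV : G.V → SV
  toV = _≅_.toV φ

  fromV : SV → G.V
  fromV = Inverse.from (_≅_.onV φ)

  toV-fromV : ∀ w → toV (fromV w) ≡ w
  toV-fromV w = Inverse.inverseˡ (_≅_.onV φ) refl

  toV-injective : ∀ {u v} → toV u ≡ toV v → u ≡ v
  toV-injective {u} {v} eq = trans (sym (Inverse.inverseʳ (_≅_.onV φ) refl)) (Inverse.inverseʳ (_≅_.onV φ) eq)

  toE : G.E → SE
  toE = Inverse.to (_≅_.onE φ)

  fromE : SE → G.E
  fromE = Inverse.from (_≅_.onE φ)

  toE-fromE : ∀ x → toE (fromE x) ≡ x
  toE-fromE x = Inverse.inverseˡ (_≅_.onE φ) refl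

  fromE-toE : ∀ e → fromE (toE e) ≡ e
  fromE-toE e = Inverse.inverseʳ (_≅_.onE φ) refl

  toE-injective : ∀ {e f} → toE e ≡ toE f → e ≡ f
  toE-injective {e} {f} eq = trans (sym (fromE-toE e)) (trans (cong fromE eq) (fromE-toE f))

  fromE-injective : ∀ {x y} → fromE x ≡ fromE y → x ≡ y
  fromE-injective {x} {y} eq = trans (sym (toE-fromE x)) (trans (cong toE eq) (toE-fromE y))

  On : SE → SV → Set
  On x w = proj₁ (spliceEnds H S plug x) ≡ w ⊎ proj₂ (spliceEnds H S plug x) ≡ w

  incident⇒On : ∀ {e v} → G.Incident e v → On (toE e) (toV v)
  incident⇒On {e} i with _≅_.preserves φ e
  incident⇒On {e} (inj₁ refl) | inj₁ eq = inj₁ (cong proj₁ eq)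
  incident⇒On {e} (inj₂ refl) | inj₁ eq = inj₂ (cong proj₂ eq)
  incident⇒On {e} (inj₁ refl) | inj₂ eq = inj₂ (cong proj₂ eq)
  incident⇒On {e} (inj₂ refl) | inj₂ eq = inj₁ (cong proj₁ eq)

  On⇒incident : ∀ {e v} → On (toE e) (toV v) → G.Incident e v
  On⇒incident {e} o with _≅_.preserves φ e
  On⇒incident {e} (inj₁ p) | inj₁ eq = inj₁ (toV-injective (trans (sym (cong proj₁ eq)) p))
  On⇒incident {e} (inj₂ p) | inj₁ eq = inj₂ (toV-injective (trans (sym (cong proj₂ eq)) p))
  On⇒incident {e} (inj₁ p) | inj₂ eq = inj₂ (toV-injective (trans (sym (cong proj₁ eq)) p))
  On⇒incident {e} (inj₂ p) | inj₂ eq = inj₁ (toV-injective (trans (sym (cong proj₂ eq)) p))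

  On⇒incident′ : ∀ {x v} → On x (toV v) → G.Incident (fromE x) v
  On⇒incident′ {x} {v} o = On⇒incident (subst (λ x → On x (toV v)) (sym (toE-fromE x)) o)

  hostEnd-host⁻ : ∀ {u w p} .{q} → hostEnd H S plug u p ≡ host w q → u ≡ w
  hostEnd-host⁻ {u} eq with u ∈? S
  hostEnd-host⁻ refl | no _ = refl

  hostEnd-host : ∀ w p .(q : w ∉ S) → hostEnd H S plug w p ≡ host w q
  hostEnd-host w p q with w ∈? S
  ... | no _  = refl
  ... | yes s = ⊥-elim-irr (q s)

  On-host⁻ : ∀ {x w} .{q} → On x (host w q) → ∃ λ e → x ≡ host e × H.Incident e w
  On-host⁻ {host e} (inj₁ p) = e , refl , inj₁ (hostEnd-host⁻ p)
  On-host⁻ {host e} (inj₂ p) = e , refl , inj₂ (hostEnd-host⁻ p)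
  On-host⁻ {guest _ _ _ _} (inj₁ ())
  On-host⁻ {guest _ _ _ _} (inj₂ ())

  On-host : ∀ {e w} .{q : w ∉ S} → H.Incident e w → On (host e) (host w q)
  On-host {q = q} (inj₁ refl) = inj₁ (hostEnd-host _ _ q)
  On-host {q = q} (inj₂ refl) = inj₂ (hostEnd-host _ _ q)

  module _ (a : H.V) (s : a ∈ S) where
    private
      K : Graph
      K = guestGraph a s
      module K = Graph K
      ⋆ : K.V
      ⋆ = at a s

    π : H.E[∂ a ] → K.E[∂ ⋆ ]
    π = Inverse.to (Plug.π (plug a s))

    π⁻ : K.E[∂ ⋆ ] → H.E[∂ a ]
    π⁻ = Inverse.from (Plug.π (plug a s))

    π-π⁻ : ∀ f → π (π⁻ f) ≡ f
    π-π⁻ f = Inverse.inverseˡ (Plug.π (plug a s)) refl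

    π⁻-π : ∀ e → π⁻ (π e) ≡ e
    π⁻-π e = Inverse.inverseʳ (Plug.π (plug a s)) refl

    private
      view : ∀ f → Dec (K.Incident f ⋆) → SE
      view f (yes i) = host (proj₁ (π⁻ (f , i)))
      view f (no ni) = guest a s f ni

      view-host : ∀ (e : H.E[∂ a ]) (D : Dec (K.Incident (proj₁ (π e)) ⋆)) → view (proj₁ (π e)) D ≡ host (proj₁ e)
      view-host e (yes i) = cong (λ f → host (proj₁ f)) (trans (cong π⁻ (∂-≡ K refl)) (π⁻-π e))
      view-host e (no ni) = ⊥-elim (ni (proj₂ (π e)))

      view-guest : ∀ f .(nf : ¬ K.Incident f ⋆) D → view f D ≡ guest a s f nf
      view-guest f nf (no _)  = refl
      view-guest f nf (yes i) = ⊥-elim-irr (nf i)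

      view-injective : ∀ {f g} D D′ → view f D ≡ view g D′ → f ≡ g
      view-injective {f} {g} (yes i) (yes j) eq = cong proj₁ (trans (sym (π-π⁻ (f , i))) (trans (cong π (∂-≡ H (host-injective eq))) (π-π⁻ (g , j))))
        where
        host-injective : ∀ {e e′ : H.E} → _≡_ {A = SE} (host e) (host e′) → e ≡ e′
        host-injective refl = refl
      view-injective (no _) (no _) refl = refl
      view-injective (yes _) (no _) ()
      view-injective (no _) (yes _) ()

    -- The edge of the spliced graph that an edge of the guest becomes.
    ψ : K.E → SE
    ψ f = view f (incident? K f ⋆)

    ψ-host : ∀ e → ψ (proj₁ (π e)) ≡ host (proj₁ e)
    ψ-host e = view-host e (incident? K _ ⋆)

    ψ-guest : ∀ f .(nf : ¬ K.Incident f ⋆) → ψ f ≡ guest a s f nf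
    ψ-guest f nf = view-guest f nf (incident? K f ⋆)

    ψ-injective : ∀ {f g} → ψ f ≡ ψ g → f ≡ g
    ψ-injective {f} {g} = view-injective (incident? K f ⋆) (incident? K g ⋆)

    hostEnd-guest⁻ : ∀ {u p y} .{ne} → hostEnd H S plug u p ≡ guest a s y ne →
      Σ (u ≡ a) λ eq → y ≡ K.otherEnd (π (subst H.E[∂_] eq p))
    hostEnd-guest⁻ {u} eq with u ∈? S
    hostEnd-guest⁻ refl | yes _ = refl , refl

    hostEnd-guest : ∀ p .{ne} → hostEnd H S plug a p ≡ guest a s (K.otherEnd (π p)) ne
    hostEnd-guest p with a ∈? S
    ... | no a∉ = ⊥-elim (a∉ s)
    ... | yes t with ∈-irrelevant t s
    ... | refl = refl

    private
      on-host⁻ : ∀ {e u y} .{ne : y ≢ ⋆} (i : H.Incident e u) → hostEnd H S plug u (e , i) ≡ guest a s y ne → ∃ λ f → ψ f ≡ host e × K.Incident f y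
      on-host⁻ {e} {u} i eq with hostEnd-guest⁻ {p = e , i} eq
      ... | refl , refl = proj₁ (π (e , i)) , ψ-host (e , i) , at-other K (π (e , i))

    On-guest⁻ : ∀ {x y} .{ne} → On x (guest a s y ne) → ∃ λ f → ψ f ≡ x × K.Incident f y
    On-guest⁻ {host e} (inj₁ p) = on-host⁻ (inj₁ refl) p
    On-guest⁻ {host e} (inj₂ p) = on-host⁻ (inj₂ refl) p
    On-guest⁻ {guest _ _ f nf} (inj₁ refl) = f , ψ-guest f nf , inj₁ refl
    On-guest⁻ {guest _ _ f nf} (inj₂ refl) = f , ψ-guest f nf , inj₂ refl

    private
      on-host : ∀ (p : H.E[∂ a ]) {y} .{ne : y ≢ ⋆} → K.otherEnd (π p) ≡ y → On (host (proj₁ p)) (guest a s y ne)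
      on-host (e , inj₁ refl) refl = inj₁ (hostEnd-guest (e , inj₁ refl))
      on-host (e , inj₂ refl) refl = inj₂ (hostEnd-guest (e , inj₂ refl))

      on-view : ∀ {f y} .{ne : y ≢ ⋆} D → y ≢ ⋆ → K.Incident f y → On (view f D) (guest a s y ne)
      on-view {f} (yes i) ne j = on-host (π⁻ (f , i)) (trans (cong K.otherEnd (π-π⁻ (f , i))) (other-unique K (f , i) j ne))
      on-view (no _) ne (inj₁ refl) = inj₁ refl
      on-view (no _) ne (inj₂ refl) = inj₂ refl

    On-guest : ∀ {f y} (ne : y ≢ ⋆) → K.Incident f y → On (ψ f) (guest a s y ne)
    On-guest {f} ne = on-view (incident? K f ⋆) ne

  module _ (F : SE → ℕ) where

    d-host : ∀ {v w} .{q : w ∉ S} → toV v ≡ host w q → d G (F ∘ toE) v ≡ d H (F ∘ host) w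
    d-host {v} {w} {q} eq = ℕ.≤-antisym
      (d-≤ G H (F ∘ toE) (F ∘ host) (λ p → proj₁ (down p) , proj₂ (proj₂ (down p)))
        (λ p → ℕ.≤-reflexive (cong F (proj₁ (proj₂ (down p)))))
        (λ p p′ r → toE-injective (trans (proj₁ (proj₂ (down p))) (trans (cong host r) (sym (proj₁ (proj₂ (down p′))))))))
      (d-≤ H G (F ∘ host) (F ∘ toE) (λ (e , i) → fromE (host e) , On⇒incident′ (subst (On (host e)) (sym eq) (On-host {q = q} i)))
        (λ (e , _) → ℕ.≤-reflexive (cong F (sym (toE-fromE (host e)))))
        (λ (e , _) (f , _) r → host-injective (fromE-injective r)))
      where
      down : (p : G.E[∂ v ]) → ∃ λ e → toE (proj₁ p) ≡ host e × H.Incident e w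
      down (e , i) = On-host⁻ {q = q} (subst (On (toE e)) eq (incident⇒On i))
      host-injective : ∀ {e e′ : H.E} → _≡_ {A = SE} (host e) (host e′) → e ≡ e′
      host-injective refl = refl

    d-guest : ∀ {v a s y} .{ne : y ≢ at a s} → toV v ≡ guest a s y ne → d G (F ∘ toE) v ≡ d (guestGraph a s) (F ∘ ψ a s) y
    d-guest {v} {a} {s} {y} {ne} eq = ℕ.≤-antisym
      (d-≤ G K (F ∘ toE) (F ∘ ψ a s) (λ p → proj₁ (down p) , proj₂ (proj₂ (down p)))
        (λ p → ℕ.≤-reflexive (cong F (sym (proj₁ (proj₂ (down p))))))
        (λ p p′ r → toE-injective (trans (sym (proj₁ (proj₂ (down p)))) (trans (cong (ψ a s) r) (proj₁ (proj₂ (down p′)))))))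
      (d-≤ K G (F ∘ ψ a s) (F ∘ toE) (λ (f , i) → fromE (ψ a s f) , On⇒incident′ (subst (On (ψ a s f)) (sym eq) (On-guest a s (λ p → ⊥-elim-irr (ne p)) i)))
        (λ (f , _) → ℕ.≤-reflexive (cong F (sym (toE-fromE (ψ a s f)))))
        (λ (f , _) (g , _) r → ψ-injective a s (fromE-injective r)))
      where
      K : Graph
      K = guestGraph a s
      down : (p : G.E[∂ v ]) → ∃ λ f → ψ a s f ≡ toE (proj₁ p) × Graph.Incident K f y
      down (e , i) = On-guest⁻ a s {ne = ne} (subst (On (toE e)) eq (incident⇒On i))

    d-at : ∀ a s → d H (F ∘ host) a ≡ d (guestGraph a s) (F ∘ ψ a s) (at a s)
    d-at a s = ℕ.≤-antisym
      (d-≤ H K (F ∘ host) (F ∘ ψ a s) (π a s) (λ p → ℕ.≤-reflexive (cong F (sym (ψ-host a s p))))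
        (λ p q r → cong proj₁ (trans (sym (π⁻-π a s p)) (trans (cong (π⁻ a s) (∂-≡ K r)) (π⁻-π a s q)))))
      (d-≤ K H (F ∘ ψ a s) (F ∘ host) (π⁻ a s) (λ p → ℕ.≤-reflexive (cong F (trans (cong (λ q → ψ a s (proj₁ q)) (sym (π-π⁻ a s p))) (ψ-host a s (π⁻ a s p)))))
        (λ p q r → cong proj₁ (trans (sym (π-π⁻ a s p)) (trans (cong (π a s) (∂-≡ H r)) (π-π⁻ a s q)))))
      where
      K : Graph
      K = guestGraph a s

  Compatible : (H.E → ℕ) → ∀ a s → (Graph.E (guestGraph a s) → ℕ) → Set
  Compatible F a s Fₐ = ∀ e → Fₐ (proj₁ (π a s e)) ≡ F (proj₁ e)

  module _ (F : H.E → ℕ) (Fₐ : ∀ a s → Graph.E (guestGraph a s) → ℕ) (compatible : ∀ a s → Compatible F a s (Fₐ a s)) where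

    glue : SE → ℕ
    glue (host e)        = F e
    glue (guest a s f _) = Fₐ a s f

    glue-ψ : ∀ a s f → glue (ψ a s f) ≡ Fₐ a s f
    glue-ψ a s f = decide (incident? (guestGraph a s) f (at a s))
      where
      decide : Dec (Graph.Incident (guestGraph a s) f (at a s)) → glue (ψ a s f) ≡ Fₐ a s f
      decide (no nf) = cong glue (ψ-guest a s f nf)
      decide (yes i) = trans (cong (λ p → glue (ψ a s (proj₁ p))) (sym (π-π⁻ a s (f , i)))) (trans (cong glue (ψ-host a s (π⁻ a s (f , i))))
        (trans (sym (compatible a s (π⁻ a s (f , i)))) (cong (λ p → Fₐ a s (proj₁ p)) (π-π⁻ a s (f , i)))))

    d-glue-guest : ∀ {v a s y} .{ne : y ≢ at a s} → toV v ≡ guest a s y ne → d G (glue ∘ toE) v ≡ d (guestGraph a s) (Fₐ a s) y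
    d-glue-guest {a = a} {s} {y} {ne} eq = trans (d-guest glue {ne = ne} eq) (d-cong (guestGraph a s) (glue-ψ a s) y)

-- Soundness: matchability in the members of the family

record Sound (G : Graph) (X : Subset (Graph.n G)) : Set where
  field
    regular : IsThreeRegular G
    -- Strengthens the induction: when a matching of the host uses one edge at a spliced vertex,
    -- `fill` continues it by a perfect matching of the guest through the corresponding edge.
    covered : ∀ e → ∃ λ M → IsPerfect G M × 1 ≤ M e
    -- The alternatives exclude each other, as a cubic graph has more than one vertex, so `X` alone
    -- tells which of them holds.
    verdict : (X ≡ ⊤ × ∀ v → ∃ (IsλMatching G v))
            ⊎ ∃ λ u → X ≡ ⁅ u ⁆ × ¬ ∃ (IsλMatching G u) × ∀ v → v ≢ u → ∃ (IsλMatching G v)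

module _ (G : Graph) (cubic : IsThreeRegular G) where
  open Graph G

  ⊤≢⁅_⁆ : ∀ u → ⊤ ≢ ⁅ u ⁆
  ⊤≢⁅ u ⁆ eq = let e = Cubic.edge-at G cubic u in otherEnd≢ e (x∈⁅y⁆⇒x≡y u (subst (otherEnd e ∈_) eq ∈⊤))

sound-⊤ : ∀ {G} → Sound G ⊤ → ∀ v → ∃ (IsλMatching G v)
sound-⊤ {G} S with Sound.verdict S
... | inj₁ (_ , all)    = all
... | inj₂ (u , eq , _) = ⊥-elim (⊤≢⁅_⁆ G (Sound.regular S) u eq)

sound-⁅⁆ : ∀ {G u} → Sound G ⁅ u ⁆ → ¬ ∃ (IsλMatching G u) × ∀ v → v ≢ u → ∃ (IsλMatching G v)
sound-⁅⁆ {G} {u} S with Sound.verdict S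
... | inj₁ (eq , _) = ⊥-elim (⊤≢⁅_⁆ G (Sound.regular S) u (sym eq))
... | inj₂ (w , eq , unmatchable , rest) with x∈⁅y⁆⇒x≡y w (subst (u ∈_) eq (x∈⁅x⁆ u))
... | refl = unmatchable , rest

module SoundSplice (G H : Graph) (A A₀ A₁ : Subset (Graph.n H))
  (conn : IsConnected[_] H 3) (bip : IsBipartition H A) (H-cubic : IsCubic H)
  (A₀⊆A : ∀ {a} → a ∈ A₀ → a ∈ A) (A₀-pairs : ∀ b → b ∉ A → ∃ λ a → a ∈ A₀ × λ-MatchablePair H a b)
  (A₁⊆ : ∀ {a} → a ∈ A₁ → a ∈ A ─ A₀) (∣A₁∣ : ∣ A₁ ∣ ≤ 1)
  (plug : ∀ a → a ∈ A ─ A₁ → Plug H a) (φ : ⟦ G ⟧ ≅ splice H (A ─ A₁) plug)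
  (regularₐ : ∀ a s → IsThreeRegular (Plug.graph (plug a s)))
  (coveredₐ : ∀ a s e → ∃ λ M → IsPerfect (Plug.graph (plug a s)) M × 1 ≤ M e)
  (matchableₐ : ∀ a s v → v ≢ Plug.at (plug a s) → ∃ (IsλMatching (Plug.graph (plug a s)) v))
  (matchable₀ : ∀ a s → a ∈ A₀ → ∃ (IsλMatching (Plug.graph (plug a s)) (Plug.at (plug a s)))) where

  open Splicing G H (A ─ A₁) plug φ
  private
    module G = Graph G
    module H = Graph H
    S : Subset H.n
    S = A ─ A₁

  H-regular : IsThreeRegular H
  H-regular = cubic⇒regular H H-cubic

  H-covered : ∀ e → ∃ λ M → IsPerfect H M × 1 ≤ M e
  H-covered = covered-by-perfect H H-regular (connected⇒3ec H H-regular conn)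

  H-cut : ∀ e → cut H (lookup A) e ≡ 1
  H-cut e = trans (sym (bits-∂ H A e)) (cong χ (∈⇒lookup (bip e)))

  A₁-unique : ∀ {a b} → a ∈ A₁ → b ∈ A₁ → a ≡ b
  A₁-unique p q = size≤1 A₁ ∣A₁∣ (∈⇒lookup p) (∈⇒lookup q)

  regular : IsThreeRegular G
  regular v with toV v in eq
  ... | host w q       = trans (d-host (λ _ → 1) eq) (H-regular w)
  ... | guest a s y ne = trans (d-guest (λ _ → 1) {ne = ne} eq) (regularₐ a s y)

  same-choice : ∀ F a s Fₐ (e₀ : H.E[∂ a ]) → d H F a ≡ 1 → d (guestGraph a s) Fₐ (at a s) ≡ 1 →
    1 ≤ F (proj₁ e₀) → 1 ≤ Fₐ (proj₁ (π a s e₀)) → Compatible F a s Fₐ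
  same-choice F a s Fₐ e₀ dF dFₐ p q e = trans (one-hot (guestGraph a s) Fₐ (π a s e₀) dFₐ q (π a s e))
    (trans (cong χ same) (sym (one-hot H F e₀ dF p e)))
    where
    same : (proj₁ (π a s e₀) == proj₁ (π a s e)) ≡ (proj₁ e₀ == proj₁ e)
    same with proj₁ (π a s e₀) ≟ proj₁ (π a s e) | proj₁ e₀ ≟ proj₁ e
    ... | yes _ | yes _ = refl
    ... | no _  | no _  = refl
    ... | no x  | yes y = ⊥-elim (x (cong (λ e → proj₁ (π a s e)) (∂-≡ H y)))
    ... | yes x | no y  = ⊥-elim (y (cong proj₁ (trans (sym (π⁻-π a s e₀)) (trans (cong (π⁻ a s) (∂-≡ (guestGraph a s) x)) (π⁻-π a s e)))))

  fill : ∀ F a s → d H F a ≡ 1 → ∃ λ Fₐ → IsPerfect (guestGraph a s) Fₐ × Compatible F a s Fₐ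
  fill F a s dF =
    let e₀ , p = d-positive H F a (ℕ.≤-reflexive (sym dF))
        M , pM , q = coveredₐ a s (proj₁ (π a s e₀))
    in M , pM , same-choice F a s M e₀ dF (pM (at a s)) p q

  -- T prescribes the degrees; L serves to force an edge into the result.
  assemble : (T : G.V → ℕ) (L : G.E → ℕ) (F : H.E → ℕ) →
    (∀ v w .(q : w ∉ S) → toV v ≡ host w q → d H F w ≡ T v) → (∀ x e → toE x ≡ host e → L x ≤ F e) →
    (∀ a s → ∃ λ Fₐ → Compatible F a s Fₐ ×
      (∀ v y .(ne : y ≢ at a s) → toV v ≡ guest a s y ne → d (guestGraph a s) Fₐ y ≡ T v) ×
      (∀ x f .(nf : ¬ Graph.Incident (guestGraph a s) f (at a s)) → toE x ≡ guest a s f nf → L x ≤ Fₐ f)) →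
    ∃ λ F → (∀ v → d G F v ≡ T v) × (∀ x → L x ≤ F x)
  assemble T L F on-hosts L-hosts family = glued ∘ toE , degrees , bound
    where
    glued : SE → ℕ
    glued = glue F (λ a s → proj₁ (family a s)) (λ a s → proj₁ (proj₂ (family a s)))
    degrees : ∀ v → d G (glued ∘ toE) v ≡ T v
    degrees v with toV v in eq
    ... | host w q       = trans (d-host glued eq) (on-hosts v w q eq)
    ... | guest a s y ne = trans (d-glue-guest F (λ a s → proj₁ (family a s)) (λ a s → proj₁ (proj₂ (family a s))) {ne = ne} eq)
                             (proj₁ (proj₂ (proj₂ (family a s))) v y ne eq)
    bound : ∀ x → L x ≤ glued (toE x)
    bound x with toE x in eq
    ... | host e         = L-hosts x e eq
    ... | guest a s f nf = proj₂ (proj₂ (proj₂ (family a s))) x f nf eq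

  -- One guest is prescribed, and a perfect matching of H is fitted around it.
  around : (T : G.V → ℕ) (L : G.E → ℕ) (a₀ : H.V) (s₀ : a₀ ∈ S) (F₀ : Graph.E (guestGraph a₀ s₀) → ℕ) →
    d (guestGraph a₀ s₀) F₀ (at a₀ s₀) ≡ 1 →
    (∀ v y .(ne : y ≢ at a₀ s₀) → toV v ≡ guest a₀ s₀ y ne → d (guestGraph a₀ s₀) F₀ y ≡ T v) →
    (∀ x f .(nf : ¬ Graph.Incident (guestGraph a₀ s₀) f (at a₀ s₀)) → toE x ≡ guest a₀ s₀ f nf → L x ≤ F₀ f) →
    (∀ v w .(q : w ∉ S) → toV v ≡ host w q → T v ≡ 1) → (∀ x e → toE x ≡ host e → L x ≡ 0) →
    (∀ v a s y .(ne : y ≢ at a s) → a ≢ a₀ → toV v ≡ guest a s y ne → T v ≡ 1) →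
    (∀ x a s f .(nf : ¬ Graph.Incident (guestGraph a s) f (at a s)) → a ≢ a₀ → toE x ≡ guest a s f nf → L x ≡ 0) →
    ∃ λ F → (∀ v → d G F v ≡ T v) × (∀ x → L x ≤ F x)
  around T L a₀ s₀ F₀ at≡1 T₀ L₀ T-host L-host T-guest L-guest
    with d-positive (guestGraph a₀ s₀) F₀ (at a₀ s₀) (ℕ.≤-reflexive (sym at≡1))
  ... | f₀ , F₀f₀ with H-covered (proj₁ (π⁻ a₀ s₀ f₀))
  ... | M , pM , Me = assemble T L M (λ v w q eq → trans (pM w) (sym (T-host v w q eq))) (λ x e eq → subst (_≤ M e) (sym (L-host x e eq)) z≤n) family
    where
    family : ∀ a s → ∃ λ Fₐ → Compatible M a s Fₐ ×
      (∀ v y .(ne : y ≢ at a s) → toV v ≡ guest a s y ne → d (guestGraph a s) Fₐ y ≡ T v) ×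
      (∀ x f .(nf : ¬ Graph.Incident (guestGraph a s) f (at a s)) → toE x ≡ guest a s f nf → L x ≤ Fₐ f)
    family a s with a ≟ a₀
    ... | no a≢a₀ = let Fₐ , perfect , compatible = fill M a s (pM a) in
            Fₐ , compatible , (λ v y ne eq → trans (perfect y) (sym (T-guest v a s y ne a≢a₀ eq))) ,
            λ x f nf eq → subst (_≤ Fₐ f) (sym (L-guest x a s f nf a≢a₀ eq)) z≤n
    ... | yes refl with ∈-irrelevant s s₀
    ... | refl = F₀ , same-choice M a s F₀ (π⁻ a s f₀) (pM a) at≡1 Me (subst (λ f → 1 ≤ F₀ (proj₁ f)) (sym (π-π⁻ a s f₀)) F₀f₀) , T₀ , L₀

  covered : ∀ e → ∃ λ M → IsPerfect G M × 1 ≤ M e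
  covered e with toE e in eq
  ... | host e′ =
    let M , pM , p = H-covered e′
        F , dF , L≤ = assemble (λ _ → 1) (δ e) M (λ v w q _ → pM w) (λ x f r → on-host M p x f r)
          (λ a s → let Fₐ , perfect , compatible = fill M a s (pM a) in Fₐ , compatible , (λ v y ne _ → perfect y) , λ x f nf r → not-guest Fₐ x f nf r)
    in F , dF , subst (_≤ F e) (cong χ (==-refl e)) (L≤ e)
    where
    on-host : ∀ M → 1 ≤ M e′ → ∀ x f → toE x ≡ host f → δ e x ≤ M f
    on-host M p x f r with e ≟ x
    ... | no _     = z≤n
    ... | yes refl with trans (sym eq) r
    ... | refl = p
    not-guest : ∀ {a s} Fₐ x f .(nf : ¬ Graph.Incident (guestGraph a s) f (at a s)) → toE x ≡ guest a s f nf → δ e x ≤ Fₐ f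
    not-guest Fₐ x f nf r with e ≟ x
    ... | no _     = z≤n
    ... | yes refl = case trans (sym eq) r of λ ()
  ... | guest a₀ s₀ f₀ nf₀ =
    let M , pM , p = coveredₐ a₀ s₀ f₀
        F , dF , L≤ = around (λ _ → 1) (δ e) a₀ s₀ M (pM (at a₀ s₀)) (λ v y ne _ → pM y) (here-edge M p)
          (λ _ _ _ _ → refl) (λ x f r → off x λ { refl → case trans (sym eq) r of λ () })
          (λ _ _ _ _ _ _ _ → refl) (λ x a s f nf ne r → off x λ { refl → ne (index-≡ nf (trans (sym r) eq)) })
    in F , dF , subst (_≤ F e) (cong χ (==-refl e)) (L≤ e)
    where
    off : ∀ x → e ≢ x → δ e x ≡ 0
    off x ne = cong χ (==-≢ ne)
    index-≡ : ∀ {a s f} .(nf : ¬ Graph.Incident (guestGraph a s) f (at a s)) → _≡_ {A = SE} (guest a s f nf) (guest a₀ s₀ f₀ nf₀) → a ≡ a₀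
    index-≡ nf refl = refl
    here-edge : ∀ M → 1 ≤ M f₀ → ∀ x f .(nf : ¬ Graph.Incident (guestGraph a₀ s₀) f (at a₀ s₀)) → toE x ≡ guest a₀ s₀ f nf → δ e x ≤ M f
    here-edge M p x f nf r with e ≟ x
    ... | no _     = z≤n
    ... | yes refl with trans (sym eq) r
    ... | refl = p

  private
    Target : G.V → G.V → ℕ
    Target u v = 1 + 2 * χ (u == v)

    Target≡1 : ∀ u v → u ≢ v → Target u v ≡ 1
    Target≡1 u v ne = cong (λ b → 1 + 2 * χ b) (==-≢ ne)

    Target≡3 : ∀ u → Target u u ≡ 3
    Target≡3 u = cong (λ b → 1 + 2 * χ b) (==-refl u)

  -- A λ-matching of the guest centred away from the splicing vertex has degree one there, and so it
  -- extends to the rest just as a perfect matching does.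
  matchable-guest : ∀ {u a s y} .{ne : y ≢ at a s} → toV u ≡ guest a s y ne → ∃ (IsλMatching G u)
  matchable-guest {u} {a₀} {s₀} {y₀} {ne₀} eq with matchableₐ a₀ s₀ y₀ (λ p → ⊥-elim-irr (ne₀ p))
  ... | F₀ , _ , at-y₀ , off-y₀ =
    let F , dF , _ = around (Target u) (λ _ → 0) a₀ s₀ F₀ (off-y₀ _ λ p → ⊥-elim-irr (ne₀ (sym p))) T₀ (λ _ _ _ _ → z≤n)
          (λ v w q r → Target≡1 u v λ { refl → case trans (sym eq) r of λ () }) (λ _ _ _ → refl)
          (λ v a s y ne a≢a₀ r → Target≡1 u v λ { refl → a≢a₀ (index-≡ ne (trans (sym r) eq)) }) (λ _ _ _ _ _ _ _ → refl)
    in F , target⇒λ G F dF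
    where
    index-≡ : ∀ {a s y} .(ne : y ≢ at a s) → _≡_ {A = SV} (guest a s y ne) (guest a₀ s₀ y₀ ne₀) → a ≡ a₀
    index-≡ ne refl = refl
    vertex-≡ : ∀ {y} .(ne : y ≢ at a₀ s₀) → _≡_ {A = SV} (guest a₀ s₀ y ne) (guest a₀ s₀ y₀ ne₀) → y ≡ y₀
    vertex-≡ ne refl = refl
    T₀ : ∀ v y .(ne : y ≢ at a₀ s₀) → toV v ≡ guest a₀ s₀ y ne → d (guestGraph a₀ s₀) F₀ y ≡ Target u v
    T₀ v y ne r with y ≟ y₀
    ... | yes refl = trans at-y₀ (sym (trans (cong (Target u) (toV-injective (trans r (sym eq)))) (Target≡3 u)))
    ... | no y≢y₀  = trans (off-y₀ y y≢y₀) (sym (Target≡1 u v λ { refl → y≢y₀ (vertex-≡ ne (trans (sym r) eq)) }))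

  -- The λ-matchable pair `a₀`, `b` of the host uses all three edges at `a₀`. The guest there
  -- supplies a λ-matching centred at its splicing vertex, every other guest a perfect matching, and
  -- after splicing only `b` has degree three.
  matchable-host : ∀ {u b} .{q : b ∉ S} → toV u ≡ host b q → b ∉ A → ∃ (IsλMatching G u)
  matchable-host {u} {b} {q₀} eq b∉A with A₀-pairs b b∉A
  ... | a₀ , a₀∈A₀ , P , P-a₀ , P-b , P-off = F , target⇒λ G F (proj₁ (proj₂ assembled))
    where
    F₁ : H.E → ℕ
    F₁ = bits P
    dF₁ : ∀ w → H.deg P w ≡ d H F₁ w
    dF₁ = deg≡d H P
    a₀∉A₁ : a₀ ∉ A₁
    a₀∉A₁ p = ∈─⇒∉ {p = A} (A₁⊆ p) a₀∈A₀
    s₀ : a₀ ∈ S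
    s₀ = x∈p∧x∉q⇒x∈p─q (A₀⊆A a₀∈A₀) a₀∉A₁
    b≢ : ∀ {a} → a ∈ S → b ≢ a
    b≢ s refl = b∉A (p─q⊆p A A₁ s)
    Family : ∀ a s → Set
    Family a s = ∃ λ Fₐ → Compatible F₁ a s Fₐ ×
      (∀ v y .(ne : y ≢ at a s) → toV v ≡ guest a s y ne → d (guestGraph a s) Fₐ y ≡ Target u v) ×
      (∀ x f .(nf : ¬ Graph.Incident (guestGraph a s) f (at a s)) → toE x ≡ guest a s f nf → 0 ≤ Fₐ f)
    guest-target : ∀ {a s v y} .(ne : y ≢ at a s) → toV v ≡ guest a s y ne → 1 ≡ Target u v
    guest-target {v = v} ne r = sym (Target≡1 u v λ { refl → case trans (sym eq) r of λ () })
    family : ∀ a s → Family a s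
    family a s with a ≟ a₀
    ... | no a≢a₀ =
      let Fₐ , perfect , compatible = fill F₁ a s (trans (sym (dF₁ a)) (P-off a a≢a₀ (b≢ s ∘ sym)))
      in Fₐ , compatible , (λ v y ne r → trans (perfect y) (guest-target ne r)) , λ _ _ _ _ → z≤n
    ... | yes refl =
      let Fₐ , small , at≡3 , off = matchable₀ a s a₀∈A₀
      in Fₐ , (λ e → trans (all-hot (guestGraph a s) (regularₐ a s) Fₐ small at≡3 (π a s e))
                (sym (all-hot H H-regular F₁ (λ e → χ≤1 (lookup P e)) (trans (sym (dF₁ a)) P-a₀) e))) ,
         (λ v y ne r → trans (off y λ p → ⊥-elim-irr (ne p)) (guest-target ne r)) , λ _ _ _ _ → z≤n
    hosts : ∀ v w .(q : w ∉ S) → toV v ≡ host w q → d H F₁ w ≡ Target u v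
    hosts v w q r with w ≟ b
    ... | yes refl = trans (sym (dF₁ w)) (trans P-b (sym (trans (cong (Target u) (toV-injective (trans r (sym eq)))) (Target≡3 u))))
    ... | no w≢b   = trans (sym (dF₁ w)) (trans (P-off w (λ { refl → ⊥-elim-irr (q s₀) }) w≢b) (sym (Target≡1 u v λ { refl → w≢b (vertex-≡ q (trans (sym r) eq)) })))
      where
      vertex-≡ : ∀ {w} .(q : w ∉ S) → _≡_ {A = SV} (host w q) (host b q₀) → w ≡ b
      vertex-≡ q refl = refl
    assembled : ∃ λ F → (∀ v → d G F v ≡ Target u v) × (∀ x → 0 ≤ F x)
    assembled = assemble (Target u) (λ _ → 0) F₁ hosts (λ _ _ _ → z≤n) family
    F : G.E → ℕ
    F = proj₁ assembled

  -- Restricted to the host, the supposed λ-matching has degree one off `A` and, by parity in the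
  -- guests, at least one at each spliced vertex. The balance of the host then forces degree one at
  -- `a₁` too, where it should be three.
  unmatchable-A₁ : ∀ {u a₁} .{q : a₁ ∉ S} → toV u ≡ host a₁ q → a₁ ∈ A₁ → ¬ ∃ (IsλMatching G u)
  unmatchable-A₁ {u} {a₁} {q₁} eq a₁∈A₁ (F , _ , at-u , off-u) =
    case trans (sym (trans (d-H u a₁ q₁ eq) at-u)) (bipartite-ones H (lookup A) H-cut H-regular (F′ ∘ host) off on a₁ (∈⇒lookup a₁∈A)) of λ ()
    where
    F′ : SE → ℕ
    F′ = F ∘ fromE
    F≡ : ∀ e → F e ≡ F′ (toE e)
    F≡ e = cong F (sym (fromE-toE e))
    a₁∈A : a₁ ∈ A
    a₁∈A = p─q⊆p A A₀ (A₁⊆ a₁∈A₁)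
    d-H : ∀ v w .(q : w ∉ S) → toV v ≡ host w q → d H (F′ ∘ host) w ≡ d G F v
    d-H v w q r = sym (trans (d-cong G F≡ v) (d-host F′ r))
    vertex-≡ : ∀ {w} .(q : w ∉ S) → _≡_ {A = SV} (host w q) (host a₁ q₁) → w ≡ a₁
    vertex-≡ q refl = refl
    host-1 : ∀ w (q : w ∉ S) → w ≢ a₁ → d H (F′ ∘ host) w ≡ 1
    host-1 w q ne = trans (d-H (fromV (host w q)) w q (toV-fromV _)) (off-u _ λ p → ne (vertex-≡ q (trans (sym (toV-fromV (host w q))) (trans (cong toV p) eq))))
    off : ∀ w → lookup A w ≡ false → d H (F′ ∘ host) w ≡ 1
    off w w∉A = host-1 w (lookup⇒∉ w∉A ∘ p─q⊆p A A₁) λ { refl → lookup⇒∉ w∉A a₁∈A }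
    on : ∀ w → lookup A w ≡ true → 1 ≤ d H (F′ ∘ host) w
    on w w∈A with w ∈? A₁
    ... | yes w∈A₁ with A₁-unique w∈A₁ a₁∈A₁
    ... | refl = subst (1 ≤_) (sym (trans (d-H u w q₁ eq) at-u)) (s≤s z≤n)
    on w w∈A | no w∉A₁ = subst (1 ≤_) (sym (d-at F′ w s)) (odd-star (guestGraph w s) (regularₐ w s) (F′ ∘ ψ w s) (at w s) guests)
      where
      s : w ∈ S
      s = x∈p∧x∉q⇒x∈p─q (lookup⇒∈ w∈A) w∉A₁
      guests : ∀ y → y ≢ at w s → d (guestGraph w s) (F′ ∘ ψ w s) y ≡ 1
      guests y ne = trans (sym (trans (d-cong G F≡ v) (d-guest F′ {ne = ne} (toV-fromV _)))) (off-u v λ p →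
        case trans (sym (toV-fromV (guest w s y ne))) (trans (cong toV p) eq) of λ ())
        where
        v : G.V
        v = fromV (guest w s y ne)

sound : ∀ {G X} → 𝒩 G X → Sound G X
sound {G} (brick cubic isBrick refl) = record
  { regular = regular
  ; covered = λ e → let M , pM , e∈M = proj₂ (proj₂ (proj₁ (proj₂ isBrick))) e
                    in bits M , (λ v → trans (sym (deg≡d G M v)) (pM v)) , ℕ.≤-reflexive (cong χ (sym (∈⇒lookup e∈M)))
  ; verdict = inj₁ (refl , λ v → toλ G (brick⇒matchable G regular isBrick v)) }
  where
  regular : IsThreeRegular G
  regular = cubic⇒regular G cubic
sound {G} {X} (spliced H A A₀ A₁ conn bip H-cubic _ A₀⊆A pairs A₁⊆ ∣A₁∣ plug guests₀ guests₁ φ X-empty X-nonempty) =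
  record { regular = regular ; covered = covered ; verdict = verdict }
  where
  regularₐ : ∀ a s → IsThreeRegular (Plug.graph (plug a s))
  regularₐ a s with a ∈? A₀
  ... | yes p = Sound.regular (sound (guests₀ a s p))
  ... | no  p = Sound.regular (sound (guests₁ a s p))
  coveredₐ : ∀ a s e → ∃ λ M → IsPerfect (Plug.graph (plug a s)) M × 1 ≤ M e
  coveredₐ a s with a ∈? A₀
  ... | yes p = Sound.covered (sound (guests₀ a s p))
  ... | no  p = Sound.covered (sound (guests₁ a s p))
  matchableₐ : ∀ a s v → v ≢ Plug.at (plug a s) → ∃ (IsλMatching (Plug.graph (plug a s)) v)
  matchableₐ a s v ne with a ∈? A₀
  ... | yes p = sound-⊤ (sound (guests₀ a s p)) v
  ... | no  p = proj₂ (sound-⁅⁆ (sound (guests₁ a s p))) v ne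
  matchable₀ : ∀ a s → a ∈ A₀ → ∃ (IsλMatching (Plug.graph (plug a s)) (Plug.at (plug a s)))
  matchable₀ a s p = sound-⊤ (sound (guests₀ a s p)) _
  open SoundSplice G H A A₀ A₁ conn bip H-cubic A₀⊆A pairs A₁⊆ ∣A₁∣ plug φ regularₐ coveredₐ matchableₐ matchable₀
  open Splicing G H (A ─ A₁) plug φ
  matchable : ∀ v → (∀ a .(q : a ∉ A ─ A₁) → a ∈ A₁ → toV v ≢ host a q) → ∃ (IsλMatching G v)
  matchable v notA₁ with toV v in eq
  ... | guest a s y ne = matchable-guest {ne = ne} eq
  ... | host b q with b ∈? A₁
  ... | yes p = ⊥-elim (notA₁ b q p refl)
  ... | no  p = matchable-host {q = q} eq λ b∈A → ⊥-elim-irr (q (x∈p∧x∉q⇒x∈p─q b∈A p))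
  verdict : (X ≡ ⊤ × ∀ v → ∃ (IsλMatching G v))
          ⊎ ∃ λ u → X ≡ ⁅ u ⁆ × ¬ ∃ (IsλMatching G u) × ∀ v → v ≢ u → ∃ (IsλMatching G v)
  verdict with nonempty? A₁
  ... | no empty = inj₁ (X-empty (Empty-unique empty) , λ v → matchable v λ a q p _ → empty (a , p))
  ... | yes (a₁ , a₁∈A₁) = inj₂ (u , ⊆-antisym X⊆ ⊆X , unmatchable-A₁ {q = a₁∉S} toV-u a₁∈A₁ ,
          λ v v≢u → matchable v λ a q p r → v≢u (toV-injective (trans r (trans (same q p) (sym toV-u)))))
    where
    a₁∉S : a₁ ∉ A ─ A₁
    a₁∉S p = ∈─⇒∉ {p = A} p a₁∈A₁
    u : Graph.V G
    u = fromV (host a₁ a₁∉S)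
    toV-u : toV u ≡ host a₁ a₁∉S
    toV-u = toV-fromV _
    same : ∀ {a} .(q : a ∉ A ─ A₁) → a ∈ A₁ → _≡_ {A = SV} (host a q) (host a₁ a₁∉S)
    same q p with A₁-unique p a₁∈A₁
    ... | refl = refl
    member : ∀ w → _∈Host_ H (A ─ A₁) plug w A₁ → w ≡ host a₁ a₁∉S
    member (host a q) p = same q p
    X⊆ : ∀ {x} → x ∈ X → x ∈ ⁅ u ⁆
    X⊆ {x} p = subst (λ z → x ∈ ⁅ z ⁆) (toV-injective (trans (member _ (Equivalence.to (X-nonempty (a₁ , a₁∈A₁) x) p)) (sym toV-u))) (x∈⁅x⁆ x)
    ⊆X : ∀ {x} → x ∈ ⁅ u ⁆ → x ∈ X
    ⊆X {x} p with x∈⁅y⁆⇒x≡y u p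
    ... | refl = Equivalence.from (X-nonempty (a₁ , a₁∈A₁) u) (subst (λ w → _∈Host_ H (A ─ A₁) plug w A₁) (sym toV-u) a₁∈A₁)

-- Decomposition along a barrier

module Decomposition (G : Graph) (cubic : IsThreeRegular G) (3ec : IsThreeEdgeConnected G) (𝓑 : Barrier G)
  (b₀ : Graph.V G) (Bb₀ : Barrier.B 𝓑 b₀ ≡ true) where
  open Graph G
  open Barrier 𝓑
  open BarrierQuotient G cubic 3ec 𝓑

  private
    module H = Graph H

  cls≡⇒ : ∀ {v a} → cls v ≡ a → c v ≡ rep a
  cls≡⇒ {v} refl = sym (rep-cls v)

  ⇒cls≡ : ∀ {v a} → c v ≡ rep a → cls v ≡ a
  ⇒cls≡ {v} {a} eq = trans (cls-≡ (trans eq (sym (c-rep a)))) (cls-rep a)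

  -- The guest at a: everything outside the class of a is contracted to b₀.
  module Guest (a : H.V) (Ba : B (rep a) ≡ false) where

    b₀-out : c b₀ ≢ rep a
    b₀-out eq = case trans (sym Bb₀) (trans (cong B (trans (sym (c-on-B b₀ Bb₀)) eq)) Ba) of λ ()

    cₐ : V → V
    cₐ v with c v ≟ rep a
    ... | yes _ = v
    ... | no  _ = b₀

    cₐ-in : ∀ {v} → c v ≡ rep a → cₐ v ≡ v
    cₐ-in {v} p with c v ≟ rep a
    ... | yes _ = refl
    ... | no q  = ⊥-elim (q p)

    cₐ-out : ∀ {v} → c v ≢ rep a → cₐ v ≡ b₀
    cₐ-out {v} p with c v ≟ rep a
    ... | yes q = ⊥-elim (p q)
    ... | no _  = refl

    cₐ-idem : ∀ v → cₐ (cₐ v) ≡ cₐ v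
    cₐ-idem v = decide (c v ≟ rep a)
      where
      decide : Dec (c v ≡ rep a) → cₐ (cₐ v) ≡ cₐ v
      decide (yes p) = cong cₐ (cₐ-in p)
      decide (no  p) = trans (cong cₐ (cₐ-out p)) (trans (cₐ-out b₀-out) (sym (cₐ-out p)))

    open Quotient G cₐ cₐ-idem public renaming
      ( Q to K ; cls to clsₐ ; rep to repₐ ; edge to edgeₐ ; edge⁻ to edgeₐ⁻ ; rep-cls to repₐ-clsₐ ; cls-rep to clsₐ-repₐ
      ; c-rep to cₐ-repₐ ; cls-≡ to clsₐ-≡ ; cls-≡⁻ to clsₐ-≡⁻ ; edge-kept to edgeₐ-kept ; edge-edge⁻ to edgeₐ-edgeₐ⁻
      ; edge-injective to edgeₐ-injective ; d-Q to d-K ; 3ec-Q to 3ec-K ; order< to orderₐ< ) hiding ( reps ; kept ; rep-injective ; ∑-edge ; cut-Q ; regular-Q )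
    private
      module K = Graph K

    ⋆ : K.V
    ⋆ = clsₐ b₀

    out⇒⋆ : ∀ {v} → c v ≢ rep a → clsₐ v ≡ ⋆
    out⇒⋆ p = clsₐ-≡ (trans (cₐ-out p) (sym (cₐ-out b₀-out)))

    in⇒≢⋆ : ∀ {v} → c v ≡ rep a → clsₐ v ≢ ⋆
    in⇒≢⋆ p eq = b₀-out (trans (cong c (sym (trans (sym (cₐ-in p)) (trans (clsₐ-≡⁻ eq) (cₐ-out b₀-out))))) p)

    ⋆⇒out : ∀ {v} → clsₐ v ≡ ⋆ → c v ≢ rep a
    ⋆⇒out eq p = in⇒≢⋆ p eq

    ≢⋆⇒in : ∀ {v} → clsₐ v ≢ ⋆ → c v ≡ rep a
    ≢⋆⇒in {v} ne = decidable-stable (c v ≟ rep a) λ p → ne (out⇒⋆ p)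

    repₐ-in : ∀ {p} → p ≢ ⋆ → c (repₐ p) ≡ rep a
    repₐ-in {p} ne = ≢⋆⇒in λ eq → ne (trans (sym (clsₐ-repₐ p)) eq)

    repₐ-injective : ∀ {p q} → repₐ p ≡ repₐ q → p ≡ q
    repₐ-injective {p} {q} eq = trans (sym (clsₐ-repₐ p)) (trans (cong clsₐ eq) (clsₐ-repₐ q))

    d-in : ∀ F {p} → p ≢ ⋆ → d K (F ∘ edgeₐ) p ≡ d G F (repₐ p)
    d-in F {p} ne = trans (d-K F p) (∑-cong λ e → cong (F e *_) (trans (cut-cong G same e) (cut-point G (repₐ p) e)))
      where
      same : ∀ v → (cₐ v == repₐ p) ≡ (repₐ p == v)
      same v with cₐ v ≟ repₐ p | repₐ p ≟ v
      ... | yes _ | yes _ = refl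
      ... | no _  | no _  = refl
      ... | no x  | yes refl = ⊥-elim (x (cₐ-repₐ p))
      ... | yes x | no y = ⊥-elim (y (trans (sym x) (cₐ-in (≢⋆⇒in λ eq → ne (trans (sym (clsₐ-repₐ p))
              (trans (clsₐ-≡ (trans (cₐ-repₐ p) (sym x))) eq))))))

    -- The cut of a class is also the cut of its complement; the class is the vertex `a` of the
    -- host, the complement the vertex `⋆` of the guest.
    d-⋆ : ∀ F → d K (F ∘ edgeₐ) ⋆ ≡ d H (F ∘ edge) a
    d-⋆ F = trans (d-K F ⋆) (trans (∑-cong λ e → cong (F e *_) (trans (cut-cong G same e) (cut-not G (λ v → c v == rep a) e))) (sym (d-Q F a)))
      where
      rep⋆ : repₐ ⋆ ≡ b₀
      rep⋆ = trans (repₐ-clsₐ b₀) (cₐ-out b₀-out)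
      same : ∀ v → (cₐ v == repₐ ⋆) ≡ not (c v == rep a)
      same v with c v ≟ rep a
      ... | no _ rewrite rep⋆ = ==-refl b₀
      ... | yes p rewrite rep⋆ = ==-≢ λ eq → b₀-out (trans (cong c (sym eq)) p)

    K-regular : IsThreeRegular K
    K-regular p with p ≟ ⋆
    ... | yes refl = trans (d-⋆ one) (H-regular a)
    ... | no ne    = trans (d-in one ne) (cubic (repₐ p))

    private
      cross : ∀ {u v} → c u ≡ rep a → c v ≢ rep a → cₐ u ≢ cₐ v
      cross {u} {v} p q eq = in⇒≢⋆ p (trans (clsₐ-≡ eq) (out⇒⋆ q))

      mixed : ∀ {u v} → c u ≢ c v → c u ≡ rep a → c v ≢ rep a
      mixed ne p q = ne (trans p (sym q))

      mixed⁻ : ∀ {u v} → cₐ u ≢ cₐ v → c u ≢ rep a → c v ≡ rep a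
      mixed⁻ {u} {v} ne p = decidable-stable (c v ≟ rep a) λ q → ne (trans (cₐ-out p) (sym (cₐ-out q)))

    to : H.E[∂ a ] → K.E[∂ ⋆ ]
    to (i , inj₁ p) = f , inj₂ (out⇒⋆ (subst (λ e → c (tgt G e) ≢ rep a) (sym (edgeₐ-edgeₐ⁻ _ _)) (mixed (edge-kept i) (cls≡⇒ p))))
      where
      f : K.E
      f = edgeₐ⁻ (edge i) (cross (cls≡⇒ p) (mixed (edge-kept i) (cls≡⇒ p)))
    to (i , inj₂ p) = f , inj₁ (out⇒⋆ (subst (λ e → c (src G e) ≢ rep a) (sym (edgeₐ-edgeₐ⁻ _ _)) (mixed (edge-kept i ∘ sym) (cls≡⇒ p))))
      where
      f : K.E
      f = edgeₐ⁻ (edge i) (cross (cls≡⇒ p) (mixed (edge-kept i ∘ sym) (cls≡⇒ p)) ∘ sym)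

    to-edge : ∀ p → edgeₐ (proj₁ (to p)) ≡ edge (proj₁ p)
    to-edge (i , inj₁ _) = edgeₐ-edgeₐ⁻ _ _
    to-edge (i , inj₂ _) = edgeₐ-edgeₐ⁻ _ _

    to-other₁ : ∀ i p → K.otherEnd (to (i , inj₁ p)) ≡ clsₐ (src G (edge i))
    to-other₁ i p = cong (λ e → clsₐ (src G e)) (edgeₐ-edgeₐ⁻ _ _)

    to-other₂ : ∀ i p → K.otherEnd (to (i , inj₂ p)) ≡ clsₐ (tgt G (edge i))
    to-other₂ i p = cong (λ e → clsₐ (tgt G e)) (edgeₐ-edgeₐ⁻ _ _)

    private
      apart : ∀ {u v} → c u ≡ rep a → c v ≢ rep a → c u ≢ c v
      apart p q eq = q (trans (sym eq) p)

    from : K.E[∂ ⋆ ] → H.E[∂ a ]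
    from (f , inj₂ p) = i , inj₁ (⇒cls≡ (subst (λ e → c (src G e) ≡ rep a) (sym (edge-edge⁻ _ _)) in-src))
      where
      in-src : c (src G (edgeₐ f)) ≡ rep a
      in-src = mixed⁻ (edgeₐ-kept f ∘ sym) (⋆⇒out p)
      i : H.E
      i = edge⁻ (edgeₐ f) (apart in-src (⋆⇒out p))
    from (f , inj₁ p) = i , inj₂ (⇒cls≡ (subst (λ e → c (tgt G e) ≡ rep a) (sym (edge-edge⁻ _ _)) in-tgt))
      where
      in-tgt : c (tgt G (edgeₐ f)) ≡ rep a
      in-tgt = mixed⁻ (edgeₐ-kept f) (⋆⇒out p)
      i : H.E
      i = edge⁻ (edgeₐ f) (apart in-tgt (⋆⇒out p) ∘ sym)

    from-edge : ∀ q → edge (proj₁ (from q)) ≡ edgeₐ (proj₁ q)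
    from-edge (f , inj₁ _) = edge-edge⁻ _ _
    from-edge (f , inj₂ _) = edge-edge⁻ _ _

    guestPlug : Plug H a
    guestPlug = record { graph = K ; at = ⋆ ; π = mk↔ₛ′ to from
      (λ q → ∂-≡ K (edgeₐ-injective (trans (to-edge (from q)) (from-edge q))))
      (λ p → ∂-≡ H (edge-injective (trans (from-edge (to p)) (to-edge p)))) }

  A′ : Subset H.n
  A′ = tabulate A

  ∈A′ : ∀ {a} → a ∈ A′ → B (rep a) ≡ false
  ∈A′ {a} s = Bool.not-injective (trans (sym (lookup∘tabulate A a)) (∈⇒lookup s))

  ∈A′⁻ : ∀ {a} → B (rep a) ≡ false → a ∈ A′
  ∈A′⁻ {a} p = lookup⇒∈ (trans (lookup∘tabulate A a) (cong not p))

  module _ (A₁ : Subset H.n) (A₁-single : ∀ {a} → a ∈ A₁ → ∀ v → c v ≡ rep a → v ≡ rep a) where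

    S : Subset H.n
    S = A′ ─ A₁

    module At (a : H.V) (s : a ∈ S) = Guest a (∈A′ (p─q⊆p A′ A₁ s))

    plug : ∀ a → a ∈ S → Plug H a
    plug a s = At.guestPlug a s

    SV SE : Set
    SV = SpliceV H S plug
    SE = SpliceE H S plug

    place : ∀ v → Dec (cls v ∈ S) → SV
    place v (yes s) = guest (cls v) s (At.clsₐ (cls v) s v) (At.in⇒≢⋆ (cls v) s (cls≡⇒ refl))
    place v (no q)  = host (cls v) q

    toV : V → SV
    toV v = place v (cls v ∈? S)

    fromV : SV → V
    fromV (host w _)      = rep w
    fromV (guest a s x _) = At.repₐ a s x

    toV-host : ∀ v {w} → cls v ≡ w → .(q : w ∉ S) → toV v ≡ host w q
    toV-host v refl q with cls v ∈? S
    ... | yes s = ⊥-elim-irr (q s)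
    ... | no _  = refl

    toV-guest : ∀ v {a} → cls v ≡ a → (s : a ∈ S) → ∀ {x} → At.clsₐ a s v ≡ x → .(ne : x ≢ At.⋆ a s) → toV v ≡ guest a s x ne
    toV-guest v refl s refl ne with cls v ∈? S
    ... | no q  = ⊥-elim (q s)
    ... | yes t with ∈-irrelevant t s
    ... | refl = refl

    fixed : ∀ v → cls v ∉ S → c v ≡ v
    fixed v q = decide (B v) refl
      where
      decide : ∀ b → B v ≡ b → c v ≡ v
      decide true  p = c-on-B v p
      decide false p with cls v ∈? A₁
      ... | yes s = trans (sym (rep-cls v)) (sym (A₁-single s v (sym (rep-cls v))))
      ... | no  r = ⊥-elim (q (x∈p∧x∉q⇒x∈p─q (∈A′⁻ (trans (cong B (rep-cls v)) (trans (B-c v) p))) r))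

    fromV-toV : ∀ v → fromV (toV v) ≡ v
    fromV-toV v with cls v ∈? S
    ... | yes s = trans (At.repₐ-clsₐ (cls v) s v) (At.cₐ-in (cls v) s (cls≡⇒ refl))
    ... | no q  = trans (rep-cls v) (fixed v q)

    toV-fromV : ∀ w → toV (fromV w) ≡ w
    toV-fromV (host w q) = toV-host (rep w) (cls-rep w) q
    toV-fromV (guest a s x ne) = toV-guest (repₐ x) (⇒cls≡ (repₐ-in λ p → ⊥-elim-irr (ne p))) s (clsₐ-repₐ x) ne
      where open At a s

    -- A class that contains an edge has two vertices, whereas barrier vertices and the members of
    -- `A₁` are classes of one vertex.
    class-in-S : ∀ e → c (src G e) ≡ c (tgt G e) → cls (src G e) ∈ S
    class-in-S e eq = x∈p∧x∉q⇒x∈p─q (∈A′⁻ (trans (cong B (rep-cls (src G e))) (trans (B-c (src G e)) not-B)))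
      λ s → loopless e (trans (A₁-single s _ (sym (rep-cls (src G e)))) (sym (A₁-single s _ (trans (sym eq) (sym (rep-cls (src G e)))))))
      where
      not-B : B (src G e) ≡ false
      not-B = Bool.¬-not λ p → loopless e (trans (sym (c-on-B _ p)) (trans eq (c-on-B _ (trans (sym (B-c _)) (trans (cong B (sym eq)) (trans (B-c _) p))))))

    module Inner (e : E) {a} (s : a ∈ S) (in-src : c (src G e) ≡ rep a) (in-tgt : c (tgt G e) ≡ rep a) where
      open At a s

      inner : Graph.E K
      inner = edgeₐ⁻ e λ eq → loopless e (trans (sym (cₐ-in in-src)) (trans eq (cₐ-in in-tgt)))

      inner-edge : edgeₐ inner ≡ e
      inner-edge = edgeₐ-edgeₐ⁻ e _

      inner-avoids : ¬ Graph.Incident K inner ⋆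
      inner-avoids (inj₁ p) = ⋆⇒out p (trans (cong (λ e → c (src G e)) inner-edge) in-src)
      inner-avoids (inj₂ p) = ⋆⇒out p (trans (cong (λ e → c (tgt G e)) inner-edge) in-tgt)

    innerE : ∀ e {a} (s : a ∈ S) → c (src G e) ≡ rep a → c (tgt G e) ≡ rep a → SE
    innerE e s p q = guest _ s (Inner.inner e s p q) (Inner.inner-avoids e s p q)

    placeE : ∀ e → Dec (c (src G e) ≡ c (tgt G e)) → SE
    placeE e (no ne)  = host (edge⁻ e ne)
    placeE e (yes eq) = innerE e (class-in-S e eq) (cls≡⇒ refl) (trans (sym eq) (cls≡⇒ refl))

    toE : E → SE
    toE e = placeE e (c (src G e) ≟ c (tgt G e))

    fromE : SE → E
    fromE (host i)        = edge i
    fromE (guest a s f _) = At.edgeₐ a s f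

    edge-≡ : ∀ {a s f g} .{p : ¬ Graph.Incident (At.K a s) f (At.⋆ a s)} .{q : ¬ Graph.Incident (At.K a s) g (At.⋆ a s)} →
      f ≡ g → _≡_ {A = SE} (guest a s f p) (guest a s g q)
    edge-≡ refl = refl

    innerE-guest : ∀ e {a b} (s : a ∈ S) p q → a ≡ b → (t : b ∈ S) (f : Graph.E (At.K b t)) .(nf : ¬ Graph.Incident (At.K b t) f (At.⋆ b t)) →
      At.edgeₐ b t f ≡ e → innerE e s p q ≡ guest b t f nf
    innerE-guest e {a} s p q refl t f nf fe = same-proof (∈-irrelevant s t) f nf fe
      where
      same-proof : ∀ {t} → s ≡ t → (f : Graph.E (At.K a t)) .(nf : ¬ Graph.Incident (At.K a t) f (At.⋆ a t)) →
        At.edgeₐ a t f ≡ e → innerE e s p q ≡ guest a t f nf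
      same-proof refl f nf fe = edge-≡ (At.edgeₐ-injective a s (trans (Inner.inner-edge e s p q) (sym fe)))

    placeE-guest : ∀ e {a} → cls (src G e) ≡ a → (s : a ∈ S) (f : Graph.E (At.K a s)) .(nf : ¬ Graph.Incident (At.K a s) f (At.⋆ a s)) →
      At.edgeₐ a s f ≡ e → c (src G e) ≡ c (tgt G e) → ∀ D → placeE e D ≡ guest a s f nf
    placeE-guest e p s f nf fe eq (no ne)  = ⊥-elim (ne eq)
    placeE-guest e p s f nf fe eq (yes eq′) = innerE-guest e (class-in-S e eq′) (cls≡⇒ refl) (trans (sym eq′) (cls≡⇒ refl)) p s f nf fe

    toE-fromE : ∀ x → toE (fromE x) ≡ x
    toE-fromE (host i) with c (src G (edge i)) ≟ c (tgt G (edge i))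
    ... | yes eq = ⊥-elim (edge-kept i eq)
    ... | no ne  = cong host (edge-injective (edge-edge⁻ (edge i) ne))
    toE-fromE (guest a s f nf) = placeE-guest (edgeₐ f) (⇒cls≡ in-src) s f nf refl (trans in-src (sym in-tgt)) _
      where
      open At a s
      in-src : c (src G (edgeₐ f)) ≡ rep a
      in-src = ≢⋆⇒in λ p → ⊥-elim-irr (nf (inj₁ p))
      in-tgt : c (tgt G (edgeₐ f)) ≡ rep a
      in-tgt = ≢⋆⇒in λ p → ⊥-elim-irr (nf (inj₂ p))

    fromE-toE : ∀ e → fromE (toE e) ≡ e
    fromE-toE e with c (src G e) ≟ c (tgt G e)
    ... | no ne  = edge-edge⁻ e ne
    ... | yes eq = Inner.inner-edge e (class-in-S e eq) (cls≡⇒ refl) (trans (sym eq) (cls≡⇒ refl))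

    guest-≡ : ∀ {a s x y} .{p : x ≢ At.⋆ a s} .{q : y ≢ At.⋆ a s} → x ≡ y → _≡_ {A = SV} (guest a s x p) (guest a s y q)
    guest-≡ refl = refl

    hostEnd₁ : ∀ i → hostEnd H S plug (cls (src G (edge i))) (i , inj₁ refl) ≡ toV (src G (edge i))
    hostEnd₁ i with cls (src G (edge i)) ∈? S
    ... | no _  = refl
    ... | yes s = guest-≡ (At.to-other₁ _ s i refl)

    hostEnd₂ : ∀ i → hostEnd H S plug (cls (tgt G (edge i))) (i , inj₂ refl) ≡ toV (tgt G (edge i))
    hostEnd₂ i with cls (tgt G (edge i)) ∈? S
    ... | no _  = refl
    ... | yes s = guest-≡ (At.to-other₂ _ s i refl)

    preserves : ∀ e → spliceEnds H S plug (toE e) ≡ map× toV toV (ends e)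
    preserves e with c (src G e) ≟ c (tgt G e)
    ... | no ne  = trans (cong₂ _,_ (hostEnd₁ (edge⁻ e ne)) (hostEnd₂ (edge⁻ e ne))) (cong (λ e → map× toV toV (ends e)) (edge-edge⁻ e ne))
    ... | yes eq = cong₂ _,_ (sym (toV-guest (src G e) refl s (cong (λ e → clsₐ (src G e)) (sym inner-edge)) _))
                             (sym (toV-guest (tgt G e) (cls-≡ (sym eq)) s (cong (λ e → clsₐ (tgt G e)) (sym inner-edge)) _))
      where
      s : cls (src G e) ∈ S
      s = class-in-S e eq
      open At (cls (src G e)) s
      open Inner e s (cls≡⇒ refl) (trans (sym eq) (cls≡⇒ refl))

    φ : ⟦ G ⟧ ≅ splice H S plug
    φ = record { onV = mk↔ₛ′ toV fromV toV-fromV fromV-toV ; onE = mk↔ₛ′ toE fromE toE-fromE fromE-toE ; preserves = λ e → inj₁ (preserves e) }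

-- Completeness by induction on the number of vertices

Complete : Graph → Set
Complete G = ((∀ v → λ-Matchable G v) → 𝒩 G ⊤)
           × (∀ u → ¬ λ-Matchable G u → (∀ v → v ≢ u → λ-Matchable G v) → 𝒩 G ⁅ u ⁆)

module _ (G : Graph) (cubic : IsThreeRegular G) (3ec : IsThreeEdgeConnected G) (𝓑 : Barrier G)
  (b₀ b₁ : Graph.V G) (Bb₀ : Barrier.B 𝓑 b₀ ≡ true) (Bb₁ : Barrier.B 𝓑 b₁ ≡ true) (b₀≢b₁ : b₀ ≢ b₁)
  (smaller : ∀ K → Graph.n K < Graph.n G → Graph.V K → IsThreeRegular K → IsThreeEdgeConnected K → Complete K) where
  open Graph G
  open Barrier 𝓑
  open BarrierQuotient G cubic 3ec 𝓑
  open Decomposition G cubic 3ec 𝓑 b₀ Bb₀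
  private
    module H = Graph H

  -- Two barrier vertices and a neighbour of one of them lie in three different classes.
  H≇Θ : ¬ (⟦ H ⟧ ≅ ⟦ Θ ⟧)
  H≇Θ iso = [ distinct₁ , [ distinct₂ , distinct₃ ]′ ]′ (pigeon (f (cls b₀)) (f (cls b₁)) (f (cls x)))
    where
    pigeon : ∀ (p q r : Fin 2) → p ≡ q ⊎ p ≡ r ⊎ q ≡ r
    pigeon zero       zero       _          = inj₁ refl
    pigeon (suc zero) (suc zero) _          = inj₁ refl
    pigeon zero       (suc zero) zero       = inj₂ (inj₁ refl)
    pigeon zero       (suc zero) (suc zero) = inj₂ (inj₂ refl)
    pigeon (suc zero) zero       zero       = inj₂ (inj₂ refl)
    pigeon (suc zero) zero       (suc zero) = inj₂ (inj₁ refl)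
    f : H.V → Fin 2
    f = _≅_.toV iso
    f-injective : ∀ {p q} → f p ≡ f q → p ≡ q
    f-injective eq = trans (sym (Inverse.inverseʳ (_≅_.onV iso) refl)) (Inverse.inverseʳ (_≅_.onV iso) eq)
    e₀ : E[∂ b₀ ]
    e₀ = Cubic.edge-at G cubic b₀
    x : V
    x = otherEnd e₀
    stable∂ : (e : E[∂ b₀ ]) → B (otherEnd e) ≡ true → ∅
    stable∂ (e , inj₁ refl) p = stable e Bb₀ p
    stable∂ (e , inj₂ refl) p = stable e p Bb₀
    Bx : B x ≡ false
    Bx = Bool.¬-not (stable∂ e₀)
    B-cls : ∀ {v w} → cls v ≡ cls w → B v ≡ B w
    B-cls {v} {w} eq = trans (sym (B-c v)) (trans (cong B (cls-≡⁻ eq)) (B-c w))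
    distinct₁ : f (cls b₀) ≢ f (cls b₁)
    distinct₁ eq = b₀≢b₁ (trans (sym (c-on-B b₀ Bb₀)) (trans (cls-≡⁻ (f-injective eq)) (c-on-B b₁ Bb₁)))
    distinct₂ : f (cls b₀) ≢ f (cls x)
    distinct₂ eq = case trans (sym Bb₀) (trans (B-cls (f-injective eq)) Bx) of λ ()
    distinct₃ : f (cls b₁) ≢ f (cls x)
    distinct₃ eq = case trans (sym Bb₁) (trans (B-cls (f-injective eq)) Bx) of λ ()

  module _ (A₁ : Subset H.n) (A₁⊆A′ : ∀ {a} → a ∈ A₁ → a ∈ A′)
           (A₁-single : ∀ {a} → a ∈ A₁ → ∀ v → c v ≡ rep a → v ≡ rep a)
           (matchable : ∀ v → cls v ∉ A₁ → ∃ (IsλMatching G v)) where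

    private
      S′ : Subset H.n
      S′ = S A₁ A₁-single
      module At′ = At A₁ A₁-single

      -- Sorts the guests for the induction: all vertices other than `⋆` will be λ-matchable, so the
      -- state of `⋆` decides which half of `Complete` applies.
      InA₀ : H.V → Set
      InA₀ a = Σ (a ∈ S′) λ s → λ-Matchable (At′.K a s) (At′.⋆ a s)

      inA₀? : ∀ a → Dec (InA₀ a)
      inA₀? a with a ∈? S′
      ... | no q = no (q ∘ proj₁)
      ... | yes s with λ-matchable? (At′.K a s) (At′.⋆ a s)
      ... | yes m = yes (s , m)
      ... | no nm = no λ (t , m) → nm (subst (λ s → λ-Matchable (At′.K a s) (At′.⋆ a s)) (∈-irrelevant t s) m)

      A₀ : Subset H.n
      A₀ = tabulate λ a → does (inA₀? a)

      ∈A₀ : ∀ {a} → a ∈ A₀ → InA₀ a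
      ∈A₀ {a} p = does-true (inA₀? a) (trans (sym (lookup∘tabulate _ a)) (∈⇒lookup p))

      ∈A₀⁻ : ∀ {a} → InA₀ a → a ∈ A₀
      ∈A₀⁻ {a} p = lookup⇒∈ (trans (lookup∘tabulate _ a) (dec-true (inA₀? a) p))

      odd-λ : ∀ {u F} → IsλMatching G u F → ∀ v → ∃ λ g → d G F v ≡ suc (2 * g)
      odd-λ {u} (_ , at-u , off-u) v with v ≟ u
      ... | yes refl = 1 , at-u
      ... | no ne    = 0 , off-u v ne

      B-outside : ∀ {v} → B v ≡ true → cls v ∉ A₁
      B-outside {v} Bv s = case trans (sym (∈A′ (A₁⊆A′ s))) (trans (cong B (rep-cls v)) (trans (B-c v) Bv)) of λ ()

      -- A λ-matching of `G` centred at `rep b` has odd degree at every contracted component, so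
      -- `bipartite-pair` finds the one component whose cut it uses three times. Inside that
      -- component it becomes a λ-matching of the guest centred at `⋆`, which puts `a` into `A₀`.
      pairs : ∀ b → b ∉ A′ → ∃ λ a → a ∈ A₀ × λ-MatchablePair H a b
      pairs b b∉ with matchable (rep b) (B-outside Bb)
        where
        Bb : B (rep b) ≡ true
        Bb = Bool.¬-not (b∉ ∘ ∈A′⁻)
      ... | F , F≤1 , at-b , off-b = a , ∈A₀⁻ (s , fromλ (At′.K a s) (F ∘ At′.edgeₐ a s , F≤1 ∘ At′.edgeₐ a s ,
              trans (At′.d-⋆ a s F) d-a , guest-1)) ,
              support F₁ , trans (deg-support H (F≤1 ∘ edge) a) d-a , trans (deg-support H (F≤1 ∘ edge) b) d-b ,
              λ w w≢a w≢b → trans (deg-support H (F≤1 ∘ edge) w) (rest w (A w) refl w≢a w≢b)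
        where
        F₁ : H.E → ℕ
        F₁ = F ∘ edge
        Bb : B (rep b) ≡ true
        Bb = Bool.¬-not (b∉ ∘ ∈A′⁻)
        not-b : ∀ {v} → B v ≡ false → v ≢ rep b
        not-b Bv refl = case trans (sym Bv) Bb of λ ()
        off-A : ∀ w → A w ≡ false → w ≢ b → d H F₁ w ≡ 1
        off-A w Aw ne = trans (d-at-B F w Aw) (off-b (rep w) λ eq → ne (rep-injective eq))
        d-b : d H F₁ b ≡ 3
        d-b = trans (d-at-B F b (cong not Bb)) at-b
        found : ∃ λ a → A a ≡ true × d H F₁ a ≡ 3 × (∀ v → A v ≡ true → v ≢ a → d H F₁ v ≡ 1)
        found = bipartite-pair H A H-bipartite H-regular F₁ (cong not Bb) d-b off-A
          λ w _ → class-odd F w λ v _ → odd-λ {F = F} (F≤1 , at-b , off-b) v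
        a : H.V
        a = proj₁ found
        Ba : B (rep a) ≡ false
        Ba = Bool.not-injective (proj₁ (proj₂ found))
        d-a : d H F₁ a ≡ 3
        d-a = proj₁ (proj₂ (proj₂ found))
        a∉A₁ : a ∉ A₁
        -- A class in `A₁` is one vertex, different from `rep b`, so its degree is one and not
        -- three.
        a∉A₁ p = case trans (sym d-a) (trans (d-singleton F a (A₁-single p)) (off-b (rep a) (not-b Ba))) of λ ()
        s : a ∈ S′
        s = x∈p∧x∉q⇒x∈p─q (∈A′⁻ Ba) a∉A₁
        guest-1 : ∀ p → p ≢ At′.⋆ a s → d (At′.K a s) (F ∘ At′.edgeₐ a s) p ≡ 1
        guest-1 p ne = trans (At′.d-in a s F ne) (off-b _ (not-b (trans (sym (B-c _)) (trans (cong B (At′.repₐ-in a s ne)) Ba))))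
        rest : ∀ w x → A w ≡ x → w ≢ a → w ≢ b → d H F₁ w ≡ 1
        rest w true  Aw w≢a _ = proj₂ (proj₂ (proj₂ found)) w Aw w≢a
        rest w false Aw _ w≢b = off-A w Aw w≢b

      module _ (a : H.V) (s : a ∈ S′) where
        open At′ a s

        -- A λ-matching of `G` centred in the component crosses its cut once, by `class-ones`, so
        -- contracting the outside keeps it a λ-matching. This also shows that no component outside
        -- `A₁` is a single vertex: its guest would be a copy of `Θ`, which has no λ-matchable
        -- vertex.
        guest-matchable : ∀ p → p ≢ ⋆ → λ-Matchable K p
        guest-matchable p ne with matchable (repₐ p) (λ t → ∈─⇒∉ {p = A′} s (subst (_∈ A₁) (⇒cls≡ (repₐ-in ne)) t))
        ... | F , F≤1 , at-p , off-p = fromλ K (F ∘ edgeₐ , F≤1 ∘ edgeₐ , trans (d-in F ne) at-p , others)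
          where
          not-p : ∀ {v} → B v ≡ true → v ≢ repₐ p
          not-p Bv refl = case trans (sym Bv) (trans (sym (B-c _)) (trans (cong B (repₐ-in ne)) (∈A′ (p─q⊆p A′ A₁ s)))) of λ ()
          others : ∀ q → q ≢ p → d K (F ∘ edgeₐ) q ≡ 1
          others q q≢p with q ≟ ⋆
          ... | no q≢⋆   = trans (d-in F q≢⋆) (off-p _ λ eq → q≢p (repₐ-injective eq))
          ... | yes refl = trans (d-⋆ F) (class-ones F (λ v Bv → off-p v (not-p Bv)) (odd-λ {F = F} (F≤1 , at-p , off-p)) a)

        -- The induction descends because the barrier has two vertices: both lie outside the class
        -- and are identified in the guest.
        guest-complete : Complete K
        guest-complete = smaller K (orderₐ< b₁ b₁-moves) ⋆ K-regular (3ec-K 3ec)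
          where
          b₁-moves : cₐ b₁ ≢ b₁
          b₁-moves eq = b₀≢b₁ (trans (sym (cₐ-out λ p → case trans (sym Bb₁) (trans (sym (B-c b₁)) (trans (cong B p) (∈A′ (p─q⊆p A′ A₁ s)))) of λ ())) eq)

    decompose : ∀ X → ∣ A₁ ∣ ≤ 1 → (A₁ ≡ ⊥ → X ≡ ⊤) →
      (Nonempty A₁ → ∀ x → x ∈ X ⇔ (_∈Host_ H S′ (plug A₁ A₁-single) (_≅_.toV (φ A₁ A₁-single) x) A₁)) → 𝒩 G X
    decompose X ∣A₁∣ X-empty X-nonempty = spliced H A′ A₀ A₁
      (3ec⇒connected H H-regular (cls b₀) (3ec-Q 3ec))
      (λ i → lookup⇒∈ (trans (lookup∘tabulate _ i) (trans (cong₂ _xor_ (lookup∘tabulate A (src H i)) (lookup∘tabulate A (tgt H i))) (χ-true (ℕ.≤-reflexive (sym (H-bipartite i)))))))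
      (regular⇒cubic H H-regular) H≇Θ
      (λ p → p─q⊆p A′ A₁ (proj₁ (∈A₀ p))) pairs
      (λ p → x∈p∧x∉q⇒x∈p─q (A₁⊆A′ p) λ q → ∈─⇒∉ {p = A′} (proj₁ (∈A₀ q)) p) ∣A₁∣
      (plug A₁ A₁-single) guests₀ guests₁ (φ A₁ A₁-single) X-empty X-nonempty
      where
      guests₀ : ∀ a s → a ∈ A₀ → 𝒩 (At′.K a s) ⊤
      guests₀ a s p = proj₁ (guest-complete a s) all
        where
        all : ∀ v → λ-Matchable (At′.K a s) v
        all v with v ≟ At′.⋆ a s
        ... | no ne    = guest-matchable a s v ne
        ... | yes refl = subst (λ s → λ-Matchable (At′.K a s) (At′.⋆ a s)) (∈-irrelevant (proj₁ (∈A₀ p)) s) (proj₂ (∈A₀ p))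
      guests₁ : ∀ a s → a ∉ A₀ → 𝒩 (At′.K a s) ⁅ At′.⋆ a s ⁆
      guests₁ a s p = proj₂ (guest-complete a s) (At′.⋆ a s) (λ m → p (∈A₀⁻ (s , m))) (guest-matchable a s)

  decompose-⊤ : (∀ v → ∃ (IsλMatching G v)) → 𝒩 G ⊤
  decompose-⊤ all = decompose ⊥ (λ p → ⊥-elim (∉⊥ p)) (λ p → ⊥-elim (∉⊥ p)) (λ v _ → all v) ⊤
    (subst (_≤ 1) (sym (∣⊥∣≡0 H.n)) z≤n) (λ _ → refl) (λ (_ , p) → ⊥-elim (∉⊥ p))

  decompose-⁅⁆ : ∀ u → B u ≡ false → (∀ v → c v ≡ c u → v ≡ u) → (∀ v → v ≢ u → ∃ (IsλMatching G v)) → 𝒩 G ⁅ u ⁆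
  decompose-⁅⁆ u Bu single rest = decompose A₁ A₁⊆A′ A₁-single
    (λ v p → rest v λ { refl → p (x∈⁅x⁆ (cls v)) }) ⁅ u ⁆
    (ℕ.≤-reflexive (∣⁅x⁆∣≡1 (cls u))) (λ eq → ⊥-elim (∉⊥ (subst (cls u ∈_) eq (x∈⁅x⁆ (cls u))))) (λ _ → member)
    where
    A₁ : Subset H.n
    A₁ = ⁅ cls u ⁆
    A₁⊆A′ : ∀ {a} → a ∈ A₁ → a ∈ A′
    A₁⊆A′ p = subst (_∈ A′) (sym (x∈⁅y⁆⇒x≡y (cls u) p)) (∈A′⁻ (trans (cong B (rep-cls u)) (trans (B-c u) Bu)))
    c-u : c u ≡ u
    c-u = single (c u) (c-idem u)
    A₁-single : ∀ {a} → a ∈ A₁ → ∀ v → c v ≡ rep a → v ≡ rep a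
    A₁-single p v eq with x∈⁅y⁆⇒x≡y (cls u) p
    ... | refl = trans (single v (trans eq (rep-cls u))) (sym (trans (rep-cls u) c-u))
    S′ : Subset H.n
    S′ = S A₁ A₁-single
    toV′ : V → SV A₁ A₁-single
    toV′ = toV A₁ A₁-single
    u∉S : cls u ∉ S′
    u∉S p = ∈─⇒∉ {p = A′} p (x∈⁅x⁆ (cls u))
    member : ∀ x → x ∈ ⁅ u ⁆ ⇔ (_∈Host_ H S′ (plug A₁ A₁-single) (toV′ x) A₁)
    member x = mk⇔ forward backward
      where
      forward : x ∈ ⁅ u ⁆ → _∈Host_ H S′ (plug A₁ A₁-single) (toV′ x) A₁
      forward p with x∈⁅y⁆⇒x≡y u p
      ... | refl = subst (λ w → _∈Host_ H S′ (plug A₁ A₁-single) w A₁) (sym (toV-host A₁ A₁-single u refl u∉S)) (x∈⁅x⁆ (cls u))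
      host-case : ∀ D → _∈Host_ H S′ (plug A₁ A₁-single) (place A₁ A₁-single x D) A₁ → cls x ≡ cls u
      host-case (no _) p = x∈⁅y⁆⇒x≡y (cls u) p
      backward : _∈Host_ H S′ (plug A₁ A₁-single) (toV′ x) A₁ → x ∈ ⁅ u ⁆
      backward p = subst (_∈ ⁅ u ⁆) (sym (single x (cls-≡⁻ (host-case (cls x ∈? S′) p)))) (x∈⁅x⁆ u)

module _ (G : Graph) where
  open Graph G

  -- For distinct `x` and `z` these are the perfect matchings of `G − x − z`.
  Avoiding : V → V → (E → ℕ) → Set
  Avoiding x z F = ∀ v → d G F v ≡ χ (not (pair x z v))

  avoiding? : ∀ x z → Dec (∃ (Avoiding x z))
  avoiding? x z = anyBits? (λ F → all? λ v → d G F v ℕ.≟ χ (not (pair x z v))) (λ eq p v → trans (sym (d-cong G eq v)) (p v))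
    λ {F} p e → ℕ.≤-trans (F≤d G F (inj₁ refl)) (ℕ.≤-trans (ℕ.≤-reflexive (p (src G e))) (χ≤1 _))

complete : ∀ fuel G → Graph.n G ≤ fuel → Graph.V G → IsThreeRegular G → IsThreeEdgeConnected G → Complete G
complete zero G le v₀ cubic 3ec = case subst Fin (ℕ.n≤0⇒n≡0 le) v₀ of λ ()
complete (suc fuel) G le v₀ cubic 3ec = all-matchable , one-unmatchable
  where
  open Graph G
  smaller : ∀ K → Graph.n K < n → Graph.V K → IsThreeRegular K → IsThreeEdgeConnected K → Complete K
  smaller K lt = complete fuel K (ℕ.≤-pred (ℕ.<-≤-trans lt le))
  all-matchable : (∀ v → λ-Matchable G v) → 𝒩 G ⊤
  all-matchable matchable = decide (any? λ x → any? λ z → ¬? (x ≟ z) ×-dec ¬? (avoiding? G x z))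
    where
    decide : Dec (∃ λ x → ∃ λ z → x ≢ z × ¬ ∃ (Avoiding G x z)) → 𝒩 G ⊤
    decide (yes (x , z , x≢z , none)) = let 𝓑 , Bx , Bz = unmatched-pair⇒barrier G cubic 3ec x≢z none in
      decompose-⊤ G cubic 3ec 𝓑 x z Bx Bz x≢z smaller (λ v → toλ G (matchable v))
    decide (no none) = brick (regular⇒cubic G cubic) (bicritical⇒brick G cubic 3ec
      (λ {x} {z} x≢z → decidable-stable (avoiding? G x z) λ p → none (x , z , x≢z , p)) v₀
      -- A single λ-matchable vertex already rules out a bipartition.
      λ bip → bipartite⇒unmatchable G cubic bip v₀ (toλ G (matchable v₀))) refl
  one-unmatchable : ∀ u → ¬ λ-Matchable G u → (∀ v → v ≢ u → λ-Matchable G v) → 𝒩 G ⁅ u ⁆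
  one-unmatchable u none rest =
    let 𝓑 , Bu , single , x , z , Bx , Bz , x≢z = unmatchable⇒barrier G cubic 3ec u (third-vertex G nonbip u) (none ∘ fromλ G)
    in decompose-⁅⁆ G cubic 3ec 𝓑 x z Bx Bz x≢z smaller u Bu single (λ v ne → toλ G (rest v ne))
    where
    e : E[∂ u ]
    e = Cubic.edge-at G cubic u
    nonbip : ¬ IsBipartite G
    nonbip bip = bipartite⇒unmatchable G cubic bip (otherEnd e) (toλ G (rest _ (otherEnd≢ e)))

-- Counting λ-matchable vertices

length-filter : {P : Fin k → Set} (P? : ∀ v → Dec (P v)) → length (filter P? (allFin k)) ≡ ∑ (λ v → χ (does (P? v)))
length-filter {k} P? = go k id
  where
  -- Generalised from `id` to any tabulated `f`, since the tail of `allFin` is no longer of the form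
  -- `allFin`.
  go : ∀ l (f : Fin l → Fin k) → length (filter P? (List.tabulate f)) ≡ ∑ (λ v → χ (does (P? (f v))))
  go zero    f = sym (∑-[] _)
  go (suc l) f = trans head (sym (∑-∷ _))
    where
    head : length (filter P? (List.tabulate f)) ≡ χ (does (P? (f zero))) + ∑ (λ v → χ (does (P? (f (suc v)))))
    head with does (P? (f zero))
    ... | true  = cong suc (go l (f ∘ suc))
    ... | false = go l (f ∘ suc)

module _ (G : Graph) (v₀ : Graph.V G) where
  open Graph G

  private
    good : V → Bool
    good v = does (λ-matchable? G v)

    λ≡∑ : λ-number G ≡ ∑ (χ ∘ good)
    λ≡∑ = length-filter (λ-matchable? G)

    bad⇒ : ∀ {v} → good v ≡ false → ¬ λ-Matchable G v
    bad⇒ {v} p m = case trans (sym p) (dec-true (λ-matchable? G v) m) of λ ()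

  λ≡n⇒all : λ-number G ≡ n → ∀ v → λ-Matchable G v
  λ≡n⇒all eq v = does-true (λ-matchable? G v) (χ-true (ℕ.≤-reflexive (sym (∑-rigid (χ≤1 ∘ good)
    (ℕ.≤-reflexive (trans (∑-one n) (trans (sym eq) λ≡∑))) v))))

  all⇒λ≡n : (∀ v → λ-Matchable G v) → λ-number G ≡ n
  all⇒λ≡n all = trans λ≡∑ (∑-all λ v → dec-true (λ-matchable? G v) (all v))

  private
    -- Makes the truncated difference `n ∸ 1` a true predecessor.
    1≤n : 1 ≤ n
    1≤n = ℕ.n≢0⇒n>0 λ z → case subst Fin z v₀ of λ ()

  λ≡n-1⇒unique : λ-number G ≡ n ∸ 1 → ∃ λ u → ¬ λ-Matchable G u × ∀ v → v ≢ u → λ-Matchable G v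
  λ≡n-1⇒unique eq = u , bad⇒ u-bad , rest
    where
    ∑bad : ∑ (χ ∘ not ∘ good) ≡ 1
    ∑bad = ℕ.+-cancelʳ-≡ (n ∸ 1) _ _ (trans (cong (∑ (χ ∘ not ∘ good) +_) (trans (sym eq) λ≡∑)) (trans (∑-not good) (sym (ℕ.m+[n∸m]≡n 1≤n))))
    found : ∃ λ u → 1 ≤ χ (not (good u))
    found = ∑-positive (χ ∘ not ∘ good) (ℕ.≤-reflexive (sym ∑bad))
    u : V
    u = proj₁ found
    u-bad : good u ≡ false
    u-bad = Bool.not-injective (χ-true (proj₂ found))
    rest : ∀ v → v ≢ u → λ-Matchable G v
    rest v ne = decidable-stable (λ-matchable? G v) λ none → ℕ.<-irrefl refl (ℕ.≤-trans
      (ℕ.+-mono-≤ (ℕ.≤-reflexive (cong (χ ∘ not) (sym (dec-false (λ-matchable? G v) none)))) (proj₂ found))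
      (ℕ.≤-trans (two-terms≤∑ (χ ∘ not ∘ good) ne) (ℕ.≤-reflexive ∑bad)))

  unique⇒λ≡n-1 : ∀ {u} → ¬ λ-Matchable G u → (∀ v → v ≢ u → λ-Matchable G v) → λ-number G ≡ n ∸ 1
  unique⇒λ≡n-1 {u} none rest = trans λ≡∑ (ℕ.+-cancelˡ-≡ 1 _ _ (trans (cong (_+ ∑ (χ ∘ good)) (sym ∑bad)) (trans (∑-not good) (sym (ℕ.m+[n∸m]≡n 1≤n)))))
    where
    bad : ∀ v → χ (not (good v)) ≡ χ (u == v)
    bad v with u ≟ v
    ... | yes refl = cong (χ ∘ not) (dec-false (λ-matchable? G v) none)
    ... | no ne    = cong (χ ∘ not) (dec-true (λ-matchable? G v) (rest v (ne ∘ sym)))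
    ∑bad : ∑ (χ ∘ not ∘ good) ≡ 1
    ∑bad = trans (∑-cong bad) (∑-point u)

theorem3p12 : (G : Graph) → IsCubic G → IsConnected[_] G 3 →
    (λ-number G ≡ Graph.n G ⇔ 𝒩 G ⊤)
    × (λ-number G ≡ Graph.n G ∸ 1 ⇔ (∃ λ u → 𝒩 G ⁅ u ⁆))
    × (∀ u → 𝒩 G ⁅ u ⁆ → IsUniqueUnmatchable G u)
theorem3p12 G cubic conn =
  mk⇔ (λ eq → proj₁ completeness (λ≡n⇒all G v₀ eq)) (λ N → all⇒λ≡n G v₀ λ v → fromλ G (sound-⊤ (sound N) v)) ,
  mk⇔ (λ eq → let u , none , rest = λ≡n-1⇒unique G v₀ eq in u , proj₂ completeness u none rest)
      (λ (u , N) → unique⇒λ≡n-1 G v₀ (proj₁ (unmatchable N)) (proj₂ (unmatchable N))) ,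
  λ u N → proj₁ (unmatchable N) , λ w none → decidable-stable (w ≟ u) λ ne → none (proj₂ (unmatchable N) w ne)
  where
  regular : IsThreeRegular G
  regular = cubic⇒regular G cubic
  vertex : ∀ {k} → 1 ≤ k → Fin k
  vertex (s≤s _) = zero
  v₀ : Graph.V G
  v₀ = vertex (proj₁ conn)
  completeness : Complete G
  completeness = complete _ G ℕ.≤-refl v₀ regular (connected⇒3ec G regular conn)
  unmatchable : ∀ {u} → 𝒩 G ⁅ u ⁆ → ¬ λ-Matchable G u × ∀ v → v ≢ u → λ-Matchable G v
  unmatchable N = let none , rest = sound-⁅⁆ (sound N) in none ∘ toλ G , λ v ne → fromλ G (rest v ne)
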